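{- There exist $\epsilon\in(0,1]$ and an infinite family of finite bipartite graphs (with arbitrarily many vertices), each of which is a bipartite $\epsilon$-expander and admits a $3$-pushdown book embedding.
   Context: For $\epsilon\in(0,1]$, a bipartite graph $G$ with bipartition $V(G)=A\cup B$ is a bipartite $\epsilon$-expander if $|A|=|B|$ and $|N(S)|\geq(1+\epsilon)|S|$ for every subset $S\subset A$ with $|S|\leq |A|/2$, where $N(S)$ is the set of vertices adjacent to some vertex of $S$. A $k$-page book embedding of a graph $G$ consists of a linear order $(u_1,\dots,u_n)$ of $V(G)$ and a partition $E_1,\dots,E_k$ of $E(G)$ such that for each $i$ there are no edges $u_au_b,u_cu_d\in E_i$ with $a<c<b<d$. It is $k$-pushdown if in addition each $E_i$ is a matching. -}

module Defs where

open import Data.Nat using (ℕ; _+_; _*_; _≤_; _<_)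
open import Data.Fin using (Fin; toℕ)
open import Data.Fin.Subset using (Subset; _∈_; ∣_∣; inside; outside)
open import Data.Fin.Subset.Properties using (_∈?_)
open import Data.Fin.Properties using (any?)
open import Data.Vec using (tabulate)
open import Data.Bool using (Bool; T; if_then_else_)
open import Data.Bool.Properties using (T?)
open import Data.Product using (Σ; ∃; _×_; _,_)
open import Data.Sum using (_⊎_; inj₁; inj₂)
open import Relation.Nullary using (¬_)
open import Relation.Nullary.Decidable using (⌊_⌋; _×-dec_)
open import Relation.Binary.PropositionalEquality using (_≡_)
open import Function.Bundles using (Bijection; _⤖_)
import Data.Rational as ℚ
open import Data.Integer using (+_)

-- A finite bipartite graph with parts A = Fin n and B = Fin n (so |A| = |B| = n).
-- Adjacency  adj a b  is true iff  a ∈ A  is joined to  b ∈ B.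
-- Vertex set is  Fin n ⊎ Fin n  (inj₁ = side A, inj₂ = side B).
BipGraph : ℕ → Set
BipGraph n = Fin n → Fin n → Bool

N : ∀ {n} → BipGraph n → Subset n → Subset n
N adj S = tabulate λ b →
  if ⌊ any? (λ a → (a ∈? S) ×-dec T? (adj a b)) ⌋ then inside else outside

ℕ→ℚ : ℕ → ℚ.ℚ
ℕ→ℚ k = + k ℚ./ 1

IsBipExpander : ∀ {n} → ℚ.ℚ → BipGraph n → Set
IsBipExpander {n} ε adj =
  (S : Subset n) → 2 * ∣ S ∣ ≤ n →
  (ℚ.1ℚ ℚ.+ ε) ℚ.* ℕ→ℚ ∣ S ∣ ℚ.≤ ℕ→ℚ ∣ N adj S ∣

V : ℕ → Set
V n = Fin n ⊎ Fin n

-- Two unordered pairs {p,q}, {r,s} of positions cross (in some orientation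
-- p' < r' < q' < s' with {p',q'} = {p,q}, {r',s'} = {r,s}).
Chain : ℕ → ℕ → ℕ → ℕ → Set
Chain w x y z = w < x × x < y × y < z

Cross : ℕ → ℕ → ℕ → ℕ → Set
Cross p q r s = Chain p r q s ⊎ Chain q r p s ⊎ Chain p s q r ⊎ Chain q s p r

record PushdownBookEmbedding {n : ℕ} (k : ℕ) (adj : BipGraph n) : Set where
  field
    order : V n ⤖ Fin (n + n)
    page  : (a b : Fin n) → T (adj a b) → Fin k

  pos : V n → ℕ
  pos v = toℕ (Bijection.to order v)

  field
    noCrossing : ∀ a b a′ b′ (e : T (adj a b)) (e′ : T (adj a′ b′)) →
      page a b e ≡ page a′ b′ e′ →
      ¬ Cross (pos (inj₁ a)) (pos (inj₂ b)) (pos (inj₁ a′)) (pos (inj₂ b′))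
    matching : ∀ a b a′ b′ (e : T (adj a b)) (e′ : T (adj a′ b′)) →
      page a b e ≡ page a′ b′ e′ →
      (a ≡ a′ ⊎ b ≡ b′) → (a ≡ a′ × b ≡ b′)

-- A zig-zag tower of permutations of circles ℤ/N that are increasing, on lifting to the line, away from few points.
-- Given D such maps on ℤ/N, label words of length two by ℤ/K, K = D²Q, each word carried by a run of Q consecutive
-- labels.  On ℤ/KN = ℤ/K × ℤ/N the word of a run acts by its lift to the Q-fold cover of ℤ/N, so that its carries move
-- the label and order is broken only at the end of the run; the shifts of ℤ/K are rotations and break nothing.
-- Composing the words, on either side, with m ≈ K^(1/8) shifts that have a spectral gap gives m² maps of ℤ/KN with the
-- same gap as before.  The fraction of bad points at most doubles and grows by O(1/Q), so Q must grow like 4^τ at distance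
-- τ from the top of the tower, which makes the number of maps 2^O(1+τ): bounded at the top, however high the tower.
-- Cutting the top maps at the origin and deleting a thin set of points leaves boundedly many partial increasing maps
-- that expand all sets of at most half the points; they are spread over the layers of a 3-pushdown graph.
module Submission where

open import Algebra.Structures using (IsCommutativeSemiring)
open import Data.Bool using (Bool; true; false; T; not; _∧_; _∨_; if_then_else_)
open import Data.Bool.Properties as BoolP using (T-∧; T-≡; T?)
open import Data.Empty using (⊥-elim)
open import Data.Fin as F using (Fin; zero; suc; toℕ; combine; remQuot)
import Data.Fin.Properties as FP
open import Data.Fin.Subset using (Subset; ∣_∣; inside; outside)
open import Data.Fin.Subset.Properties using (anySubset?; _∈?_)
open import Data.Integer as ℤ using (ℤ; +_; +≤+; +<+)
import Data.Integer.Properties as ℤP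
import Data.Integer.Tactic.RingSolver as ℤR
open import Data.List using (List; []; _∷_; map; _++_; length; allFin; tabulate; concatMap; filter)
open import Data.List.Membership.Propositional using (_∈_)
open import Data.List.Membership.Propositional.Properties using (∈-allFin; ∈-filter⁺)
open import Data.List.Properties using (length-tabulate)
open import Data.List.Relation.Unary.Any using (here; there)
open import Data.Nat as ℕ using (ℕ; zero; suc; NonZero; z≤n; s≤s)
open import Data.Nat.DivMod as DM using (_mod_; _%_; _/_)
import Data.Nat.Properties as ℕP
import Data.Nat.Tactic.RingSolver as ℕR
open import Data.Product using (Σ; ∃; _×_; _,_; proj₁; proj₂; uncurry)
open import Data.Sum using (_⊎_; inj₁; inj₂; [_,_]′)
open import Data.Unit using (tt)
open import Data.Vec as V using (Vec; []; _∷_; lookup; _[_]≔_)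
import Data.Vec.Properties as VP
open import Function using (_∘_; id; _⤖_; mk⤖; Equivalence)
open import Relation.Binary using (tri<; tri≈; tri>)
open import Relation.Binary.PropositionalEquality
open import Relation.Nullary using (¬_; Dec; yes; no; does)
open import Relation.Nullary.Decidable using (dec-true; dec-false; _×-dec_; ⌊_⌋)

-- In the vertex order used here a page is the graph of one partial increasing map, so the expansion
-- must come from maps that respect order. Rotations do, but boundedly many of them commute and have
-- no uniform gap. Inside a zig-zag product they are affordable: the shifts act only on labels, and
-- m of them may serve up to m^8 / 2^96 labels. Their gap is found by counting: for some choice few
-- pairs of words of length 8 collide, which bounds the Hilbert-Schmidt norm of the eighth power of
-- the shift operator, and normality returns the bound to the operator. Eight is forced up by D²,
-- the fourth power of the number of shifts one level down: words must be longer than four to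
-- outnumber the labels, and a power of two lets the root be taken by Cauchy-Schwarz. The room left
-- over pays for 2^96, for Q and for degrees that grow downwards. All estimates are between
-- integers: sums replace averages, projections are multiplied by K. A very small set may consist of
-- bad points alone, so the gap is used only for sets between a quarter and three quarters of the
-- circle; hence the deletion of a thin set.

-- Finite sums in an ordered commutative semiring, over ℕ for counting and over ℤ for norms

module FiniteSum {A : Set} {_⊕_ _⊗_ : A → A → A} {𝟘 𝟙 : A}
                 (isSemiring : IsCommutativeSemiring _≡_ _⊕_ _⊗_ 𝟘 𝟙)
                 {_≼_ : A → A → Set} (≼-refl : ∀ {a} → a ≼ a)
                 (⊕-mono : ∀ {a b c d} → a ≼ b → c ≼ d → (a ⊕ c) ≼ (b ⊕ d)) where
  private module R = IsCommutativeSemiring isSemiring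

  ∑ : {X : Set} → List X → (X → A) → A
  ∑ []       f = 𝟘
  ∑ (x ∷ xs) f = f x ⊕ ∑ xs f

  infix 6 ∑
  syntax ∑ xs (λ x → e) = ∑[ x ∈ xs ] e

  private variable
    X Y : Set
    f g : X → A

  ∑-cong : ∀ (xs : List X) → (∀ x → f x ≡ g x) → ∑ xs f ≡ ∑ xs g
  ∑-cong []       f≡g = refl
  ∑-cong (x ∷ xs) f≡g = cong₂ _⊕_ (f≡g x) (∑-cong xs f≡g)

  ∑-mono : ∀ (xs : List X) → (∀ x → f x ≼ g x) → ∑ xs f ≼ ∑ xs g
  ∑-mono []       f≼g = ≼-refl
  ∑-mono (x ∷ xs) f≼g = ⊕-mono (f≼g x) (∑-mono xs f≼g)

  ⊕-interchange : ∀ a b c d → (a ⊕ b) ⊕ (c ⊕ d) ≡ (a ⊕ c) ⊕ (b ⊕ d)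
  ⊕-interchange a b c d = begin
    (a ⊕ b) ⊕ (c ⊕ d)   ≡⟨ R.+-assoc a b (c ⊕ d) ⟩
    a ⊕ (b ⊕ (c ⊕ d))   ≡⟨ cong (a ⊕_) (R.+-assoc b c d) ⟨
    a ⊕ ((b ⊕ c) ⊕ d)   ≡⟨ cong (λ z → a ⊕ (z ⊕ d)) (R.+-comm b c) ⟩
    a ⊕ ((c ⊕ b) ⊕ d)   ≡⟨ cong (a ⊕_) (R.+-assoc c b d) ⟩
    a ⊕ (c ⊕ (b ⊕ d))   ≡⟨ R.+-assoc a c (b ⊕ d) ⟨
    (a ⊕ c) ⊕ (b ⊕ d)   ∎
    where open ≡-Reasoning

  ∑-⊕ : ∀ (xs : List X) (f g : X → A) → (∑[ x ∈ xs ] (f x ⊕ g x)) ≡ ∑ xs f ⊕ ∑ xs g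
  ∑-⊕ []       f g = sym (R.+-identityˡ 𝟘)
  ∑-⊕ (x ∷ xs) f g = trans (cong ((f x ⊕ g x) ⊕_) (∑-⊕ xs f g)) (⊕-interchange _ _ _ _)

  ∑-⊗ : ∀ (xs : List X) c (f : X → A) → (∑[ x ∈ xs ] (c ⊗ f x)) ≡ c ⊗ ∑ xs f
  ∑-⊗ []       c f = sym (R.zeroʳ c)
  ∑-⊗ (x ∷ xs) c f = trans (cong ((c ⊗ f x) ⊕_) (∑-⊗ xs c f)) (sym (R.distribˡ c (f x) (∑ xs f)))

  ∑-⊗ʳ : ∀ (xs : List X) c (f : X → A) → (∑[ x ∈ xs ] (f x ⊗ c)) ≡ ∑ xs f ⊗ c
  ∑-⊗ʳ xs c f = trans (∑-cong xs λ x → R.*-comm (f x) c) (trans (∑-⊗ xs c f) (R.*-comm c _))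

  ∑-0 : ∀ (xs : List X) → (∑[ x ∈ xs ] 𝟘) ≡ 𝟘
  ∑-0 []       = refl
  ∑-0 (x ∷ xs) = trans (R.+-identityˡ _) (∑-0 xs)

  ∑-swap : ∀ (xs : List X) (ys : List Y) (f : X → Y → A) →
           (∑[ x ∈ xs ] ∑ ys (f x)) ≡ (∑[ y ∈ ys ] ∑[ x ∈ xs ] f x y)
  ∑-swap []       ys f = sym (∑-0 ys)
  ∑-swap (x ∷ xs) ys f = trans (cong (∑ ys (f x) ⊕_) (∑-swap xs ys f)) (sym (∑-⊕ ys (f x) _))

  ∑-*-∑ : ∀ (xs : List X) (ys : List Y) (f : X → A) (g : Y → A) →
          ∑ xs f ⊗ ∑ ys g ≡ (∑[ x ∈ xs ] ∑[ y ∈ ys ] (f x ⊗ g y))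
  ∑-*-∑ xs ys f g = trans (sym (∑-⊗ʳ xs (∑ ys g) f)) (∑-cong xs λ x → sym (∑-⊗ ys (f x) g))

  ∑-++ : ∀ (xs ys : List X) (f : X → A) → ∑ (xs ++ ys) f ≡ ∑ xs f ⊕ ∑ ys f
  ∑-++ []       ys f = sym (R.+-identityˡ _)
  ∑-++ (x ∷ xs) ys f = trans (cong (f x ⊕_) (∑-++ xs ys f)) (sym (R.+-assoc (f x) _ _))

  ∑-map : ∀ (h : X → Y) (xs : List X) (f : Y → A) → ∑ (map h xs) f ≡ ∑ xs (f ∘ h)
  ∑-map h []       f = refl
  ∑-map h (x ∷ xs) f = cong (f (h x) ⊕_) (∑-map h xs f)

  ∑-concatMap : ∀ (h : X → List Y) (xs : List X) (f : Y → A) →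
                ∑ (concatMap h xs) f ≡ (∑[ x ∈ xs ] ∑ (h x) f)
  ∑-concatMap h []       f = refl
  ∑-concatMap h (x ∷ xs) f = trans (∑-++ (h x) (concatMap h xs) f) (cong (∑ (h x) f ⊕_) (∑-concatMap h xs f))

  ∑-tabulate : ∀ n (h : Fin n → X) (f : X → A) → ∑ (tabulate h) f ≡ ∑ (allFin n) (f ∘ h)
  ∑-tabulate zero    h f = refl
  ∑-tabulate (suc n) h f = cong (f (h zero) ⊕_)
    (trans (∑-tabulate n (h ∘ suc) f) (sym (∑-tabulate n suc (f ∘ h))))

  ∑-suc : ∀ n (f : Fin (suc n) → A) → ∑ (allFin (suc n)) f ≡ f zero ⊕ ∑ (allFin n) (f ∘ suc)
  ∑-suc n f = cong (f zero ⊕_) (∑-tabulate n suc f)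

  ∑-↑ : ∀ m n (f : Fin (m ℕ.+ n) → A) →
        ∑ (allFin (m ℕ.+ n)) f ≡ ∑ (allFin m) (f ∘ (F._↑ˡ n)) ⊕ ∑ (allFin n) (f ∘ (m F.↑ʳ_))
  ∑-↑ zero    n f = sym (R.+-identityˡ _)
  ∑-↑ (suc m) n f = begin
    ∑ (allFin (suc m ℕ.+ n)) f
      ≡⟨ ∑-suc (m ℕ.+ n) f ⟩
    f zero ⊕ ∑ (allFin (m ℕ.+ n)) (f ∘ suc)
      ≡⟨ cong (f zero ⊕_) (∑-↑ m n (f ∘ suc)) ⟩
    f zero ⊕ (∑ (allFin m) (λ i → f (suc i F.↑ˡ n)) ⊕ ∑ (allFin n) (f ∘ (suc m F.↑ʳ_)))
      ≡⟨ R.+-assoc _ _ _ ⟨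
    (f zero ⊕ ∑ (allFin m) (λ i → f (suc i F.↑ˡ n))) ⊕ ∑ (allFin n) (f ∘ (suc m F.↑ʳ_))
      ≡⟨ cong (_⊕ ∑ (allFin n) (f ∘ (suc m F.↑ʳ_))) (∑-suc m (f ∘ (F._↑ˡ n))) ⟨
    ∑ (allFin (suc m)) (f ∘ (F._↑ˡ n)) ⊕ ∑ (allFin n) (f ∘ (suc m F.↑ʳ_)) ∎
    where open ≡-Reasoning

  ∑-combine : ∀ m n (f : Fin (m ℕ.* n) → A) →
              ∑ (allFin (m ℕ.* n)) f ≡ (∑[ i ∈ allFin m ] ∑[ j ∈ allFin n ] f (combine i j))
  ∑-combine zero    n f = refl
  ∑-combine (suc m) n f = begin
    ∑ (allFin (n ℕ.+ m ℕ.* n)) f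
      ≡⟨ ∑-↑ n (m ℕ.* n) f ⟩
    ∑ (allFin n) (f ∘ (F._↑ˡ (m ℕ.* n))) ⊕ ∑ (allFin (m ℕ.* n)) (f ∘ (n F.↑ʳ_))
      ≡⟨ cong (∑ (allFin n) (f ∘ (F._↑ˡ (m ℕ.* n))) ⊕_) (∑-combine m n (f ∘ (n F.↑ʳ_))) ⟩
    (∑[ j ∈ allFin n ] f (combine {suc m} zero j)) ⊕ (∑[ i ∈ allFin m ] ∑[ j ∈ allFin n ] f (combine (suc i) j))
      ≡⟨ ∑-suc m (λ i → ∑[ j ∈ allFin n ] f (combine i j)) ⟨
    (∑[ i ∈ allFin (suc m) ] ∑[ j ∈ allFin n ] f (combine i j)) ∎
    where open ≡-Reasoning

  ind : Bool → A
  ind b = if b then 𝟙 else 𝟘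

  ∑-pick : ∀ {n} (x : Fin n) (f : Fin n → A) → (∑[ y ∈ allFin n ] (ind (does (y F.≟ x)) ⊗ f y)) ≡ f x
  ∑-pick {suc n} zero f = begin
    (∑[ y ∈ allFin (suc n) ] (ind (does (y F.≟ zero)) ⊗ f y)) ≡⟨ ∑-suc n _ ⟩
    (𝟙 ⊗ f zero) ⊕ (∑[ y ∈ allFin n ] (𝟘 ⊗ f (suc y)))
      ≡⟨ cong₂ _⊕_ (R.*-identityˡ _) (trans (∑-cong (allFin n) λ y → R.zeroˡ (f (suc y))) (∑-0 (allFin n))) ⟩
    f zero ⊕ 𝟘                                          ≡⟨ R.+-identityʳ _ ⟩
    f zero ∎
    where open ≡-Reasoning
  ∑-pick {suc n} (suc x) f = begin
    (∑[ y ∈ allFin (suc n) ] (ind (does (y F.≟ suc x)) ⊗ f y)) ≡⟨ ∑-suc n _ ⟩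
    (𝟘 ⊗ f zero) ⊕ (∑[ y ∈ allFin n ] (ind (does (suc y F.≟ suc x)) ⊗ f (suc y)))
      ≡⟨ cong₂ _⊕_ (R.zeroˡ _) (∑-pick x (f ∘ suc)) ⟩
    𝟘 ⊕ f (suc x)                                       ≡⟨ R.+-identityˡ _ ⟩
    f (suc x) ∎
    where open ≡-Reasoning

module ∑ℕ = FiniteSum ℕP.+-*-isCommutativeSemiring {ℕ._≤_} ℕP.≤-refl ℕP.+-mono-≤
module ∑ℤ = FiniteSum ℤP.+-*-isCommutativeSemiring {ℤ._≤_} ℤP.≤-refl ℤP.+-mono-≤

length-allFin : ∀ n → length (allFin n) ≡ n
length-allFin n = length-tabulate {n = n} id

∑ℕ-const : ∀ {X : Set} (xs : List X) c → ∑ℕ.∑ xs (λ _ → c) ≡ length xs ℕ.* c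
∑ℕ-const []       c = refl
∑ℕ-const (x ∷ xs) c = cong (c ℕ.+_) (∑ℕ-const xs c)

∑-cast : ∀ {X : Set} (xs : List X) (f : X → ℕ) → ∑ℤ.∑ xs (λ x → + f x) ≡ + ∑ℕ.∑ xs f
∑-cast []       f = refl
∑-cast (x ∷ xs) f = trans (cong (ℤ._+_ (+ f x)) (∑-cast xs f)) (sym (ℤP.pos-+ (f x) _))

∑ℤ-const : ∀ {X : Set} (xs : List X) c → ∑ℤ.∑ xs (λ _ → c) ≡ + length xs ℤ.* c
∑ℤ-const []       c = refl
∑ℤ-const (x ∷ xs) c = begin
  c ℤ.+ ∑ℤ.∑ xs (λ _ → c)                 ≡⟨ cong (ℤ._+_ c) (∑ℤ-const xs c) ⟩
  c ℤ.+ + length xs ℤ.* c                 ≡⟨ ℤP.suc-* (+ length xs) c ⟨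
  (ℤ.suc (+ length xs)) ℤ.* c             ≡⟨⟩
  + suc (length xs) ℤ.* c                 ∎
  where open ≡-Reasoning

module CircleMaps where
  open import Data.Integer using (-[1+_]; _+_; _*_; _-_; -_; _≤_; 0ℤ; 1ℤ; +≤+)
  open ∑ℤ

  private variable
    X Y : Set

  -- Integer inequalities, inner products and Cauchy-Schwarz

  0≤+ : ∀ n → 0ℤ ≤ + n
  0≤+ n = +≤+ z≤n

  0≤x*x : ∀ x → 0ℤ ≤ x * x
  0≤x*x (+ n)      = subst (0ℤ ≤_) (ℤP.pos-* n n) (0≤+ _)
  0≤x*x (-[1+ n ]) = +≤+ z≤n

  ≤-by : ∀ {a b} c → 0ℤ ≤ c → b ≡ a + c → a ≤ b
  ≤-by {a} c 0≤c refl = subst (_≤ a + c) (ℤP.+-identityʳ a) (ℤP.+-monoʳ-≤ a 0≤c)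

  0≤+-mono : ∀ {a b} → 0ℤ ≤ a → 0ℤ ≤ b → 0ℤ ≤ a + b
  0≤+-mono = ℤP.+-mono-≤

  *-mono-0≤ : ∀ {c a b} → 0ℤ ≤ c → a ≤ b → c * a ≤ c * b
  *-mono-0≤ {c} 0≤c = ℤP.*-monoˡ-≤-nonNeg c {{ℤ.nonNegative 0≤c}}

  0≤* : ∀ {a b} → 0ℤ ≤ a → 0ℤ ≤ b → 0ℤ ≤ a * b
  0≤* {a} {b} 0≤a 0≤b = subst (_≤ a * b) (ℤP.*-zeroʳ a) (*-mono-0≤ 0≤a 0≤b)

  *-cancel-≤ : ∀ n {a b} .{{_ : NonZero n}} → + n * a ≤ + n * b → a ≤ b
  *-cancel-≤ (suc n) {a} {b} = ℤP.*-cancelˡ-≤-pos a b (+ suc n)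

  0≤∑ : ∀ (xs : List X) {f} → (∀ x → 0ℤ ≤ f x) → 0ℤ ≤ ∑ xs f
  0≤∑ xs {f} 0≤f = subst (_≤ ∑ xs f) (∑-0 xs) (∑-mono xs 0≤f)

  ⟨_∣_⟩ : ∀ {n} → (Fin n → ℤ) → (Fin n → ℤ) → ℤ
  ⟨_∣_⟩ {n} f g = ∑[ x ∈ allFin n ] (f x * g x)

  ‖_‖² : ∀ {n} → (Fin n → ℤ) → ℤ
  ‖ f ‖² = ⟨ f ∣ f ⟩

  0≤‖‖² : ∀ {n} (f : Fin n → ℤ) → 0ℤ ≤ ‖ f ‖²
  0≤‖‖² {n} f = 0≤∑ (allFin n) λ x → 0≤x*x (f x)

  ‖‖²-cong : ∀ {n} {f g : Fin n → ℤ} → (∀ x → f x ≡ g x) → ‖ f ‖² ≡ ‖ g ‖²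
  ‖‖²-cong {n} f≡g = ∑-cong (allFin n) λ x → cong₂ _*_ (f≡g x) (f≡g x)

  lagrange : ∀ a b c d → (a * d - c * b) * (a * d - c * b)
                       ≡ (a * a) * (d * d) + ((b * b) * (c * c) + (- + 2) * ((a * b) * (c * d)))
  lagrange = ℤR.solve-∀

  ∑-3 : ∀ (xs : List X) (f g h : X → ℤ) → (∑[ x ∈ xs ] (f x + (g x + h x))) ≡ ∑ xs f + (∑ xs g + ∑ xs h)
  ∑-3 xs f g h = trans (∑-⊕ xs f _) (cong (ℤ._+_ (∑ xs f)) (∑-⊕ xs g h))

  -- Lagrange's identity: the squares of f x g y - f y g x, summed over all pairs, give twice the
  -- difference of the two sides.
  cauchy-schwarz : ∀ (xs : List X) (f g : X → ℤ) →
    (∑[ x ∈ xs ] (f x * g x)) * (∑[ x ∈ xs ] (f x * g x)) ≤ (∑[ x ∈ xs ] (f x * f x)) * (∑[ x ∈ xs ] (g x * g x))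
  cauchy-schwarz xs f g = *-cancel-≤ 2 (≤-by S 0≤S eq)
    where
    A = ∑[ x ∈ xs ] (f x * f x)
    B = ∑[ x ∈ xs ] (g x * g x)
    C = ∑[ x ∈ xs ] (f x * g x)
    h : _ → _ → ℤ
    h x y = f x * g y - f y * g x
    S = ∑[ x ∈ xs ] ∑[ y ∈ xs ] (h x y * h x y)
    0≤S : 0ℤ ≤ S
    0≤S = 0≤∑ xs λ x → 0≤∑ xs λ y → 0≤x*x (h x y)
    S≡ : S ≡ A * B + (B * A + (- + 2) * (C * C))
    S≡ = begin
      S ≡⟨ ∑-cong xs (λ x → trans (∑-cong xs λ y → lagrange (f x) (g x) (f y) (g y)) (∑-3 xs _ _ _)) ⟩
      (∑[ x ∈ xs ] ((∑[ y ∈ xs ] (f x * f x * (g y * g y))) + ((∑[ y ∈ xs ] (g x * g x * (f y * f y)))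
                   + (∑[ y ∈ xs ] ((- + 2) * (f x * g x * (f y * g y)))))))
        ≡⟨ ∑-3 xs _ _ _ ⟩
      _ ≡⟨ cong₂ _+_ (sym (∑-*-∑ xs xs _ _)) (cong₂ _+_ (sym (∑-*-∑ xs xs _ _))
            (trans (∑-cong xs λ x → ∑-⊗ xs (- + 2) _) (trans (∑-⊗ xs (- + 2) _) (cong ((- + 2) *_) (sym (∑-*-∑ xs xs _ _)))))) ⟩
      A * B + (B * A + (- + 2) * (C * C)) ∎
      where open ≡-Reasoning
    alg : ∀ A B C → + 2 * (A * B) ≡ + 2 * (C * C) + (A * B + (B * A + (- + 2) * (C * C)))
    alg = ℤR.solve-∀
    eq : + 2 * (A * B) ≡ + 2 * (C * C) + S
    eq = trans (alg A B C) (cong (ℤ._+_ (+ 2 * (C * C))) (sym S≡))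

  ∑²≤ : ∀ (xs : List X) (f : X → ℤ) → ∑ xs f * ∑ xs f ≤ + length xs * (∑[ x ∈ xs ] (f x * f x))
  ∑²≤ xs f = subst₂ _≤_ (cong₂ _*_ e e) (cong (_* (∑[ x ∈ xs ] (f x * f x))) (trans (∑ℤ-const xs 1ℤ) (ℤP.*-identityʳ (+ length xs))))
              (cauchy-schwarz xs (λ _ → 1ℤ) f)
    where
    e : (∑[ x ∈ xs ] (1ℤ * f x)) ≡ ∑ xs f
    e = ∑-cong xs λ x → ℤP.*-identityˡ (f x)

  ⟨∣⟩²≤ : ∀ {n} (f g : Fin n → ℤ) → ⟨ f ∣ g ⟩ * ⟨ f ∣ g ⟩ ≤ ‖ f ‖² * ‖ g ‖²
  ⟨∣⟩²≤ {n} = cauchy-schwarz (allFin n)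

  ⟨∣⟩-comm : ∀ {n} (f g : Fin n → ℤ) → ⟨ f ∣ g ⟩ ≡ ⟨ g ∣ f ⟩
  ⟨∣⟩-comm {n} f g = ∑-cong (allFin n) λ x → ℤP.*-comm (f x) (g x)

  ⟨∣⟩-congʳ : ∀ {n} (f : Fin n → ℤ) {g h} → (∀ x → g x ≡ h x) → ⟨ f ∣ g ⟩ ≡ ⟨ f ∣ h ⟩
  ⟨∣⟩-congʳ {n} f g≡h = ∑-cong (allFin n) λ x → cong (f x *_) (g≡h x)

  -- Shifts of ℤ/K
  module Rotation (K : ℕ) .{{_ : NonZero K}} where

    infixl 6 _⊕_
    _⊕_ : Fin K → ℕ → Fin K
    a ⊕ k = (toℕ a ℕ.+ k) mod K

    toℕ-mod : ∀ k → toℕ (k mod K) ≡ k % K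
    toℕ-mod k = FP.toℕ-fromℕ< (DM.m%n<n k K)

    ⊕-assoc : ∀ a j k → a ⊕ j ⊕ k ≡ a ⊕ (j ℕ.+ k)
    ⊕-assoc a j k = FP.toℕ-injective (begin
      toℕ (a ⊕ j ⊕ k)                              ≡⟨ toℕ-mod _ ⟩
      (toℕ (a ⊕ j) ℕ.+ k) % K                       ≡⟨ cong (λ z → (z ℕ.+ k) % K) (toℕ-mod _) ⟩
      ((toℕ a ℕ.+ j) % K ℕ.+ k) % K                 ≡⟨ DM.%-distribˡ-+ ((toℕ a ℕ.+ j) % K) k K ⟩
      ((toℕ a ℕ.+ j) % K % K ℕ.+ k % K) % K         ≡⟨ cong (λ z → (z ℕ.+ k % K) % K) (DM.m%n%n≡m%n (toℕ a ℕ.+ j) K) ⟩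
      ((toℕ a ℕ.+ j) % K ℕ.+ k % K) % K             ≡⟨ DM.%-distribˡ-+ (toℕ a ℕ.+ j) k K ⟨
      (toℕ a ℕ.+ j ℕ.+ k) % K                       ≡⟨ cong (_% K) (ℕP.+-assoc (toℕ a) j k) ⟩
      (toℕ a ℕ.+ (j ℕ.+ k)) % K                     ≡⟨ toℕ-mod _ ⟨
      toℕ (a ⊕ (j ℕ.+ k))                          ∎)
      where open ≡-Reasoning

    ⊕-swap : ∀ a j k → a ⊕ j ⊕ k ≡ a ⊕ k ⊕ j
    ⊕-swap a j k = trans (⊕-assoc a j k) (trans (cong (a ⊕_) (ℕP.+-comm j k)) (sym (⊕-assoc a k j)))

    mod-toℕ : ∀ a → toℕ a mod K ≡ a
    mod-toℕ a = FP.toℕ-injective (trans (toℕ-mod _) (DM.m<n⇒m%n≡m (FP.toℕ<n a)))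

    mod-periodic : ∀ k → (K ℕ.+ k) mod K ≡ k mod K
    mod-periodic k = FP.toℕ-injective (trans (toℕ-mod _) (trans
      (trans (cong (_% K) (trans (ℕP.+-comm K k) (cong (k ℕ.+_) (sym (ℕP.*-identityˡ K))))) (DM.[m+kn]%n≡m%n k 1 K))
      (sym (toℕ-mod _))))

    -- Moving a window of n consecutive values by one step trades its first value for the next one.
    -- If h has period n the two agree, which yields invariance of sums under rotation; for other h
    -- it counts what a shift pushes out of a window.
    ∑-telescope : ∀ n (h : ℕ → ℤ) k →
      (∑[ z ∈ allFin n ] h (toℕ z ℕ.+ suc k)) + h k ≡ (∑[ z ∈ allFin n ] h (toℕ z ℕ.+ k)) + h (n ℕ.+ k)
    ∑-telescope zero    h k = refl
    ∑-telescope (suc n) h k = begin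
      (∑[ z ∈ allFin (suc n) ] h (toℕ z ℕ.+ suc k)) + h k
        ≡⟨ cong (_+ h k) (∑-suc n (λ z → h (toℕ z ℕ.+ suc k))) ⟩
      (h (suc k) + (∑[ z ∈ allFin n ] h (suc (toℕ z ℕ.+ suc k)))) + h k
        ≡⟨ alg (h (suc k)) _ (h k) ⟩
      h k + ((∑[ z ∈ allFin n ] h (suc (toℕ z ℕ.+ suc k))) + h (suc k))
        ≡⟨ cong (ℤ._+_ (h k)) (∑-telescope n (h ∘ suc) k) ⟩
      h k + ((∑[ z ∈ allFin n ] h (suc (toℕ z ℕ.+ k))) + h (suc n ℕ.+ k))
        ≡⟨ ℤP.+-assoc (h k) _ _ ⟨
      (h k + (∑[ z ∈ allFin n ] h (suc (toℕ z ℕ.+ k)))) + h (suc n ℕ.+ k)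
        ≡⟨ cong (_+ h (suc n ℕ.+ k)) (∑-suc n (λ z → h (toℕ z ℕ.+ k))) ⟨
      (∑[ z ∈ allFin (suc n) ] h (toℕ z ℕ.+ k)) + h (suc n ℕ.+ k) ∎
      where
      open ≡-Reasoning
      alg : ∀ a b c → (a + b) + c ≡ c + (b + a)
      alg = ℤR.solve-∀

    ∑-periodic : ∀ (f : Fin K → ℤ) k → (∑[ z ∈ allFin K ] f ((toℕ z ℕ.+ k) mod K)) ≡ ∑ (allFin K) f
    ∑-periodic f zero    = ∑-cong (allFin K) λ z →
      cong f (trans (cong (_mod K) (ℕP.+-identityʳ (toℕ z))) (mod-toℕ z))
    ∑-periodic f (suc k) = trans (∙-cancelʳ (f (k mod K)) _ _ (begin
      (∑[ z ∈ allFin K ] f ((toℕ z ℕ.+ suc k) mod K)) + f (k mod K)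
        ≡⟨ ∑-telescope K (λ j → f (j mod K)) k ⟩
      (∑[ z ∈ allFin K ] f ((toℕ z ℕ.+ k) mod K)) + f ((K ℕ.+ k) mod K)
        ≡⟨ cong (λ z → (∑[ z ∈ allFin K ] f ((toℕ z ℕ.+ k) mod K)) + f z) (mod-periodic k) ⟩
      (∑[ z ∈ allFin K ] f ((toℕ z ℕ.+ k) mod K)) + f (k mod K) ∎)) (∑-periodic f k)
      where
      open ≡-Reasoning
      open import Algebra.Properties.AbelianGroup ℤP.+-0-abelianGroup using (∙-cancelʳ)

    ∑-shift : ∀ (f : Fin K → ℤ) k → (∑[ a ∈ allFin K ] f (a ⊕ k)) ≡ ∑ (allFin K) f
    ∑-shift = ∑-periodic

    ∑-orbit : ∀ (f : Fin K → ℤ) a → (∑[ z ∈ allFin K ] f (a ⊕ toℕ z)) ≡ ∑ (allFin K) f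
    ∑-orbit f a = trans (∑-cong (allFin K) λ z → cong (λ k → f (k mod K)) (ℕP.+-comm (toℕ a) (toℕ z)))
                        (∑-periodic f (toℕ a))

    -- (K - 1) k represents -k modulo K without subtraction.
    neg : ℕ → ℕ
    neg k = ℕ.pred K ℕ.* k

    ⊕-neg : ∀ a k → a ⊕ neg k ⊕ k ≡ a
    ⊕-neg a k = trans (⊕-assoc a (neg k) k) (FP.toℕ-injective (begin
      toℕ (a ⊕ (neg k ℕ.+ k))           ≡⟨ toℕ-mod _ ⟩
      (toℕ a ℕ.+ (neg k ℕ.+ k)) % K     ≡⟨ cong (λ z → (toℕ a ℕ.+ z) % K) e ⟩
      (toℕ a ℕ.+ k ℕ.* K) % K           ≡⟨ DM.[m+kn]%n≡m%n (toℕ a) k K ⟩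
      toℕ a % K                         ≡⟨ DM.m<n⇒m%n≡m (FP.toℕ<n a) ⟩
      toℕ a                             ∎))
      where
      open ≡-Reasoning
      e : neg k ℕ.+ k ≡ k ℕ.* K
      e = trans (ℕP.+-comm (neg k) k) (trans (cong (ℕ._* k) (ℕP.suc-pred K)) (ℕP.*-comm K k))

    conv : List X → (X → ℕ) → (Fin K → ℤ) → Fin K → ℤ
    conv ks w g a = ∑[ t ∈ ks ] g (a ⊕ w t)

    conv-cong : ∀ (ks : List X) (w : X → ℕ) {g h : Fin K → ℤ} → (∀ a → g a ≡ h a) →
                ∀ a → conv ks w g a ≡ conv ks w h a
    conv-cong ks w g≡h a = ∑-cong ks λ t → g≡h (a ⊕ w t)

  -- Normal operators: from the eighth power back to the operator

  -- B is the adjoint of A and commutes with it. This stands in for the spectral theorem, which is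
  -- out of reach over ℤ. Operators act on functions, so respect for pointwise equality is part of
  -- the data.
  record Normal {n} (A B : (Fin n → ℤ) → Fin n → ℤ) : Set where
    field
      A-cong  : ∀ {g h} → (∀ x → g x ≡ h x) → ∀ x → A g x ≡ A h x
      B-cong  : ∀ {g h} → (∀ x → g x ≡ h x) → ∀ x → B g x ≡ B h x
      adjoint : ∀ g h → ⟨ A g ∣ h ⟩ ≡ ⟨ g ∣ B h ⟩
      commute : ∀ g x → A (B g) x ≡ B (A g) x

    ‖B‖≡‖A‖ : ∀ g → ‖ B g ‖² ≡ ‖ A g ‖²
    ‖B‖≡‖A‖ g = begin
      ⟨ B g ∣ B g ⟩     ≡⟨ adjoint (B g) g ⟨
      ⟨ A (B g) ∣ g ⟩   ≡⟨ ⟨∣⟩-comm (A (B g)) g ⟩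
      ⟨ g ∣ A (B g) ⟩   ≡⟨ ⟨∣⟩-congʳ g (commute g) ⟩
      ⟨ g ∣ B (A g) ⟩   ≡⟨ adjoint g (A g) ⟨
      ⟨ A g ∣ A g ⟩     ∎
      where open ≡-Reasoning

    -- ‖A g‖² is ⟨g ∣ B A g⟩, and by normality B A g is as long as A A g; Cauchy-Schwarz does the
    -- rest.
    log-convex : ∀ g → ‖ A g ‖² * ‖ A g ‖² ≤ ‖ g ‖² * ‖ A (A g) ‖²
    log-convex g = subst₂ _≤_ (cong₂ _*_ e e) (cong (‖ g ‖² *_) (‖B‖≡‖A‖ (A g))) (⟨∣⟩²≤ g (B (A g)))
      where
      e : ⟨ g ∣ B (A g) ⟩ ≡ ‖ A g ‖²
      e = sym (adjoint g (A g))

    square : Normal (A ∘ A) (B ∘ B)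
    square = record
      { A-cong  = λ g≡h → A-cong (A-cong g≡h)
      ; B-cong  = λ g≡h → B-cong (B-cong g≡h)
      ; adjoint = λ g h → trans (adjoint (A g) h) (adjoint g (B h))
      ; commute = λ g x → begin
          A (A (B (B g))) x   ≡⟨ A-cong (commute (B g)) x ⟩
          A (B (A (B g))) x   ≡⟨ commute (A (B g)) x ⟩
          B (A (A (B g))) x   ≡⟨ B-cong (A-cong (commute g)) x ⟩
          B (A (B (A g))) x   ≡⟨ B-cong (commute (A g)) x ⟩
          B (B (A (A g))) x   ∎
      }
      where open ≡-Reasoning

  sqrt-mono-≤ : ∀ {x y} → 0ℤ ≤ y → x * x ≤ y * y → x ≤ y
  sqrt-mono-≤ {x} {y} 0≤y x²≤y² with x ℤP.≤? y
  ... | yes x≤y = x≤y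
  ... | no  x≰y = ⊥-elim (ℤP.<-irrefl refl (ℤP.<-≤-trans y²<x² x²≤y²))
    where
    y<x : y ℤ.< x
    y<x = ℤP.≰⇒> x≰y
    y²<x² : y * y ℤ.< x * x
    y²<x² = ℤP.≤-<-trans (*-mono-0≤ 0≤y (ℤP.<⇒≤ y<x))
              (ℤP.*-monoʳ-<-pos x {{ℤ.positive (ℤP.≤-<-trans 0≤y y<x)}} y<x)

  root : ∀ s c u w M → 0ℤ ≤ s → 0ℤ ≤ M → u * u ≤ s * w → (c * c) * w ≤ (M * M) * s → c * u ≤ M * s
  root s c u w M 0≤s 0≤M u²≤sw cw≤Ms = sqrt-mono-≤ (0≤* 0≤M 0≤s) (begin
    (c * u) * (c * u)     ≡⟨ e₁ c u ⟩
    (c * c) * (u * u)     ≤⟨ *-mono-0≤ (0≤x*x c) u²≤sw ⟩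
    (c * c) * (s * w)     ≡⟨ e₂ (c * c) s w ⟩
    s * ((c * c) * w)     ≤⟨ *-mono-0≤ 0≤s cw≤Ms ⟩
    s * ((M * M) * s)     ≡⟨ e₃ s M ⟩
    (M * s) * (M * s)     ∎)
    where
    open ℤP.≤-Reasoning
    e₁ : ∀ c u → (c * u) * (c * u) ≡ (c * c) * (u * u)
    e₁ = ℤR.solve-∀
    e₂ : ∀ c s w → c * (s * w) ≡ s * (c * w)
    e₂ = ℤR.solve-∀
    e₃ : ∀ s M → s * ((M * M) * s) ≡ (M * s) * (M * s)
    e₃ = ℤR.solve-∀

  -- Log-convexity for A, A² and A⁴ halves the exponent three times, each time by `root`: if u² ≤ s
  -- w and c² w ≤ M² s then (c u)² ≤ (M s)².
  eighth-root : ∀ {n} {A B : (Fin n → ℤ) → Fin n → ℤ} → Normal A B → ∀ c M → 0ℤ ≤ M → ∀ g →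
    let c₂ = c * c; c₄ = c₂ * c₂; M₂ = M * M; M₄ = M₂ * M₂; A₂ = A ∘ A; A₄ = A₂ ∘ A₂ in
    (c₄ * c₄) * ‖ A₄ (A₄ g) ‖² ≤ (M₄ * M₄) * ‖ g ‖² → c * ‖ A g ‖² ≤ M * ‖ g ‖²
  eighth-root {n} {A} {B} N c M 0≤M g s₈≤ =
    root s c ‖ A g ‖² ‖ A₂ g ‖² M 0≤s 0≤M (log-convex N g)
      (root s (c * c) ‖ A₂ g ‖² ‖ A₄ g ‖² (M * M) 0≤s (0≤x*x M) (log-convex (square N) g)
        (root s (c * c * (c * c)) ‖ A₄ g ‖² ‖ A₄ (A₄ g) ‖² (M * M * (M * M)) 0≤s (0≤x*x (M * M))
          (log-convex (square (square N)) g) s₈≤))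
    where
    open Normal
    A₂ = A ∘ A
    A₄ = A₂ ∘ A₂
    s = ‖ g ‖²
    0≤s = 0≤‖‖² g

  0≤ind : ∀ b → 0ℤ ≤ ind b
  0≤ind true  = +≤+ z≤n
  0≤ind false = +≤+ z≤n

  ind≤1 : ∀ b → ind b ≤ 1ℤ
  ind≤1 true  = ℤP.≤-refl
  ind≤1 false = +≤+ z≤n

  ∑-ind≡1 : ∀ {n} (x : Fin n) → (∑[ y ∈ allFin n ] ind (does (y F.≟ x))) ≡ 1ℤ
  ∑-ind≡1 {n} x = trans (∑-cong (allFin n) λ y → sym (ℤP.*-identityʳ _)) (∑-pick x (λ _ → 1ℤ))

  does-sym : ∀ {n} (x y : Fin n) → does (x F.≟ y) ≡ does (y F.≟ x)
  does-sym x y with x F.≟ y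
  ... | yes refl = sym (dec-true (x F.≟ x) refl)
  ... | no  x≢y  = sym (dec-false (y F.≟ x) (x≢y ∘ sym))

  -- Convolution operators on ℤ/K and their Hilbert-Schmidt norm

  module Convolution (K : ℕ) .{{_ : NonZero K}} where
    open Rotation K

    conv-normal : ∀ (ks : List X) (w : X → ℕ) → Normal (conv ks w) (conv ks (neg ∘ w))
    conv-normal ks w = record
      { A-cong  = conv-cong ks w
      ; B-cong  = conv-cong ks (neg ∘ w)
      ; adjoint = adj
      ; commute = λ g a → trans (∑-swap ks ks _)
          (∑-cong ks λ t → ∑-cong ks λ t′ → cong g (⊕-swap a (w t′) (neg (w t))))
      }
      where
      open ≡-Reasoning
      adj : ∀ g h → ⟨ conv ks w g ∣ h ⟩ ≡ ⟨ g ∣ conv ks (neg ∘ w) h ⟩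
      adj g h = begin
        (∑[ a ∈ allFin K ] (conv ks w g a * h a))
          ≡⟨ ∑-cong (allFin K) (λ a → sym (∑-⊗ʳ ks (h a) _)) ⟩
        (∑[ a ∈ allFin K ] ∑[ t ∈ ks ] (g (a ⊕ w t) * h a))
          ≡⟨ ∑-swap (allFin K) ks _ ⟩
        (∑[ t ∈ ks ] ∑[ a ∈ allFin K ] (g (a ⊕ w t) * h a))
          ≡⟨ ∑-cong ks (λ t → trans
               (∑-cong (allFin K) λ a → cong (λ z → g (a ⊕ w t) * h z)
                  (sym (trans (⊕-swap a (w t) (neg (w t))) (⊕-neg a (w t)))))
               (∑-shift (λ a → g a * h (a ⊕ neg (w t))) (w t))) ⟩
        (∑[ t ∈ ks ] ∑[ a ∈ allFin K ] (g a * h (a ⊕ neg (w t))))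
          ≡⟨ ∑-swap ks (allFin K) _ ⟩
        (∑[ a ∈ allFin K ] ∑[ t ∈ ks ] (g a * h (a ⊕ neg (w t))))
          ≡⟨ ∑-cong (allFin K) (λ a → ∑-⊗ ks (g a) _) ⟩
        ⟨ g ∣ conv ks (neg ∘ w) h ⟩ ∎

    -- The squared Hilbert-Schmidt norm of `conv ts w`: the sum of squares of its kernel counts, for
    -- each a, the pairs of words leading from a to the same place.
    collisions : List X → (X → ℕ) → ℤ
    collisions ts w = ∑[ a ∈ allFin K ] ∑[ t ∈ ts ] ∑[ t′ ∈ ts ] ind (does (a ⊕ w t F.≟ a ⊕ w t′))

    module _ (ts : List X) (w : X → ℕ) where
      private
        κ M : ℤ
        κ = + K
        M = + length ts
        ν : Fin K → Fin K → ℤ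
        ν a d = ∑[ t ∈ ts ] ind (does (d F.≟ a ⊕ w t))

        ∑ν : ∀ a → (∑[ d ∈ allFin K ] ν a d) ≡ M
        ∑ν a = trans (∑-swap (allFin K) ts _)
          (trans (∑-cong ts λ t → ∑-ind≡1 (a ⊕ w t)) (trans (∑ℤ-const ts 1ℤ) (ℤP.*-identityʳ M)))

        ∑νg : ∀ g a → (∑[ d ∈ allFin K ] (ν a d * g d)) ≡ conv ts w g a
        ∑νg g a = trans (∑-cong (allFin K) λ d → sym (∑-⊗ʳ ts (g d) _))
          (trans (∑-swap (allFin K) ts _) (∑-cong ts λ t → ∑-pick (a ⊕ w t) g))

        ∑ν² : ∀ a → (∑[ d ∈ allFin K ] (ν a d * ν a d))
                  ≡ (∑[ t ∈ ts ] ∑[ t′ ∈ ts ] ind (does (a ⊕ w t F.≟ a ⊕ w t′)))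
        ∑ν² a = ∑νg (ν a) a

        sq : ∀ κ M n → (κ * n - M) * (κ * n - M) ≡ (κ * κ) * (n * n) + ((- + 2 * κ * M) * n + M * M)
        sq = ℤR.solve-∀

        variance : (∑[ a ∈ allFin K ] ∑[ d ∈ allFin K ] ((κ * ν a d - M) * (κ * ν a d - M)))
                 ≡ (κ * κ) * collisions ts w + - ((κ * κ) * (M * M))
        variance = begin
          (∑[ a ∈ allFin K ] ∑[ d ∈ allFin K ] ((κ * ν a d - M) * (κ * ν a d - M)))
            ≡⟨ ∑-cong (allFin K) (λ a → begin
                 (∑[ d ∈ allFin K ] ((κ * ν a d - M) * (κ * ν a d - M)))
                   ≡⟨ ∑-cong (allFin K) (λ d → sq κ M (ν a d)) ⟩
                 (∑[ d ∈ allFin K ] ((κ * κ) * (ν a d * ν a d) + ((- + 2 * κ * M) * ν a d + M * M)))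
                   ≡⟨ ∑-3 (allFin K) _ _ _ ⟩
                 _ ≡⟨ cong₂ _+_ (trans (∑-⊗ (allFin K) (κ * κ) _) (cong ((κ * κ) *_) (∑ν² a)))
                        (cong₂ _+_ (trans (∑-⊗ (allFin K) (- + 2 * κ * M) _) (cong ((- + 2 * κ * M) *_) (∑ν a)))
                                   (trans (∑ℤ-const (allFin K) (M * M)) (cong (λ n → + n * (M * M)) (length-allFin K)))) ⟩
                 (κ * κ) * E a + ((- + 2 * κ * M) * M + κ * (M * M)) ≡⟨ alg₁ κ M (E a) ⟩
                 (κ * κ) * E a + - (κ * (M * M)) ∎) ⟩
          (∑[ a ∈ allFin K ] ((κ * κ) * E a + - (κ * (M * M))))
            ≡⟨ ∑-⊕ (allFin K) _ _ ⟩
          _ ≡⟨ cong₂ _+_ (∑-⊗ (allFin K) (κ * κ) E)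
                 (trans (∑ℤ-const (allFin K) _) (cong (λ n → + n * - (κ * (M * M))) (length-allFin K))) ⟩
          (κ * κ) * ∑ (allFin K) E + κ * - (κ * (M * M)) ≡⟨ alg₂ κ M (∑ (allFin K) E) ⟩
          (κ * κ) * ∑ (allFin K) E + - ((κ * κ) * (M * M)) ∎
          where
          open ≡-Reasoning
          E : Fin K → ℤ
          E a = ∑[ t ∈ ts ] ∑[ t′ ∈ ts ] ind (does (a ⊕ w t F.≟ a ⊕ w t′))
          alg₁ : ∀ κ M e → (κ * κ) * e + ((- + 2 * κ * M) * M + κ * (M * M)) ≡ (κ * κ) * e + - (κ * (M * M))
          alg₁ = ℤR.solve-∀
          alg₂ : ∀ κ M e → (κ * κ) * e + κ * - (κ * (M * M)) ≡ (κ * κ) * e + - ((κ * κ) * (M * M))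
          alg₂ = ℤR.solve-∀

      -- On functions of sum zero the kernel may be replaced by its deviation from the mean M / K.
      -- This removes exactly M² from the squared Hilbert-Schmidt norm, and that norm dominates the
      -- operator norm. The deviation is multiplied by K to stay integral.
      hilbert-schmidt : ∀ R → collisions ts w ≤ M * M + R → ∀ g → ∑ (allFin K) g ≡ 0ℤ →
                        ‖ conv ts w g ‖² ≤ R * ‖ g ‖²
      hilbert-schmidt R E≤ g ∑g≡0 = *-cancel-≤ K (*-cancel-≤ K (begin
        κ * (κ * ‖ conv ts w g ‖²)
          ≡⟨ trans (sym (ℤP.*-assoc κ κ _)) (sym (∑-⊗ (allFin K) (κ * κ) _)) ⟩
        (∑[ a ∈ allFin K ] ((κ * κ) * (conv ts w g a * conv ts w g a)))
          ≡⟨ ∑-cong (allFin K) (λ a → trans (alg₁ κ (conv ts w g a)) (cong₂ _*_ (centre a) (centre a))) ⟩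
        (∑[ a ∈ allFin K ] (⟨ h a ∣ g ⟩ * ⟨ h a ∣ g ⟩))
          ≤⟨ ∑-mono (allFin K) (λ a → ⟨∣⟩²≤ (h a) g) ⟩
        (∑[ a ∈ allFin K ] (‖ h a ‖² * ‖ g ‖²))
          ≡⟨ trans (∑-⊗ʳ (allFin K) ‖ g ‖² _) (cong (_* ‖ g ‖²) variance) ⟩
        ((κ * κ) * collisions ts w + - ((κ * κ) * (M * M))) * ‖ g ‖²
          ≡⟨ alg₂ (κ * κ) (collisions ts w) (M * M) ‖ g ‖² ⟩
        ((κ * κ) * ‖ g ‖²) * collisions ts w + - ((κ * κ) * (M * M) * ‖ g ‖²)
          ≤⟨ ℤP.+-monoˡ-≤ (- ((κ * κ) * (M * M) * ‖ g ‖²)) (*-mono-0≤ (0≤* (0≤x*x κ) (0≤‖‖² g)) E≤) ⟩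
        ((κ * κ) * ‖ g ‖²) * (M * M + R) + - ((κ * κ) * (M * M) * ‖ g ‖²)
          ≡⟨ alg₃ κ ‖ g ‖² (M * M) R ⟩
        κ * (κ * (R * ‖ g ‖²)) ∎))
        where
        open ℤP.≤-Reasoning
        h : Fin K → Fin K → ℤ
        h a d = κ * ν a d - M
        centre : ∀ a → κ * conv ts w g a ≡ ⟨ h a ∣ g ⟩
        centre a = sym (begin-equality
          (∑[ d ∈ allFin K ] ((κ * ν a d - M) * g d))
            ≡⟨ ∑-cong (allFin K) (λ d → alg κ (ν a d) M (g d)) ⟩
          (∑[ d ∈ allFin K ] (κ * (ν a d * g d) + (- M) * g d))
            ≡⟨ ∑-⊕ (allFin K) _ _ ⟩
          _ ≡⟨ cong₂ _+_ (trans (∑-⊗ (allFin K) κ _) (cong (κ *_) (∑νg g a)))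
                 (trans (∑-⊗ (allFin K) (- M) g) (trans (cong ((- M) *_) ∑g≡0) (ℤP.*-zeroʳ (- M)))) ⟩
          κ * conv ts w g a + 0ℤ ≡⟨ ℤP.+-identityʳ _ ⟩
          κ * conv ts w g a ∎)
          where
          alg : ∀ κ n M g → (κ * n - M) * g ≡ κ * (n * g) + (- M) * g
          alg = ℤR.solve-∀
        alg₁ : ∀ κ c → (κ * κ) * (c * c) ≡ (κ * c) * (κ * c)
        alg₁ = ℤR.solve-∀
        alg₂ : ∀ k e m g → (k * e + - (k * m)) * g ≡ (k * g) * e + - (k * m * g)
        alg₂ = ℤR.solve-∀
        alg₃ : ∀ κ g m R → ((κ * κ) * g) * (m + R) + - ((κ * κ) * m * g) ≡ κ * (κ * (R * g))
        alg₃ = ℤR.solve-∀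

  -- Words, and how few pairs of them are repetitive

  allVec : List X → ∀ n → List (Vec X n)
  allVec xs zero    = [] ∷ []
  allVec xs (suc n) = concatMap (λ x → map (x ∷_) (allVec xs n)) xs

  ∑-allVec : ∀ (xs : List X) n (f : Vec X (suc n) → ℤ) →
             ∑ (allVec xs (suc n)) f ≡ (∑[ x ∈ xs ] ∑[ v ∈ allVec xs n ] f (x ∷ v))
  ∑-allVec xs n f = trans (∑-concatMap _ xs f) (∑-cong xs λ x → ∑-map (x ∷_) (allVec xs n) f)

  length-allVec : ∀ (xs : List X) n → + length (allVec xs n) ≡ + (length xs ℕ.^ n)
  length-allVec xs zero    = refl
  length-allVec xs (suc n) = begin
    + length (allVec xs (suc n))                    ≡⟨ one (allVec xs (suc n)) ⟨
    ∑ (allVec xs (suc n)) (λ _ → 1ℤ)                ≡⟨ ∑-allVec xs n _ ⟩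
    (∑[ x ∈ xs ] ∑ (allVec xs n) (λ _ → 1ℤ))        ≡⟨ ∑-cong xs (λ _ → trans (one (allVec xs n)) (length-allVec xs n)) ⟩
    (∑[ x ∈ xs ] + (length xs ℕ.^ n))               ≡⟨ ∑ℤ-const xs _ ⟩
    + length xs * + (length xs ℕ.^ n)               ≡⟨ ℤP.pos-* (length xs) _ ⟨
    + (length xs ℕ.^ suc n)                         ∎
    where
    open ≡-Reasoning
    one : ∀ {Z : Set} (zs : List Z) → ∑ zs (λ _ → 1ℤ) ≡ + length zs
    one zs = trans (∑ℤ-const zs 1ℤ) (ℤP.*-identityʳ _)

  ≤∑ : ∀ {xs : List X} {f : X → ℤ} → (∀ x → 0ℤ ≤ f x) → ∀ {x} → x ∈ xs → f x ≤ ∑ xs f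
  ≤∑ {xs = y ∷ xs} {f} 0≤f (here refl) = ≤-by (∑ xs f) (0≤∑ xs 0≤f) refl
  ≤∑ {xs = y ∷ xs} {f} 0≤f (there x∈)  = ℤP.≤-trans (≤∑ 0≤f x∈) (≤-by (f y) (0≤f y) (ℤP.+-comm (f y) _))

  ∃≤average : ∀ (xs : List X) (f : X → ℤ) c .{{_ : NonZero (length xs)}} →
              ∑ xs f ≤ + length xs * c → ∃ λ x → f x ≤ c
  ∃≤average xs f c ∑≤ with go xs
    where
    go : ∀ xs → (∃ λ x → f x ≤ c) ⊎ (+ length xs * (1ℤ + c) ≤ ∑ xs f)
    go [] = inj₂ ℤP.≤-refl
    go (x ∷ xs) with f x ℤP.≤? c
    ... | yes fx≤c = inj₁ (x , fx≤c)
    ... | no  fx≰c with go xs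
    ...   | inj₁ found = inj₁ found
    ...   | inj₂ ≤∑xs  = inj₂ (subst (_≤ f x + ∑ xs f) (sym (ℤP.suc-* (+ length xs) (1ℤ + c)))
                           (ℤP.+-mono-≤ (ℤP.i<j⇒suc[i]≤j (ℤP.≰⇒> fx≰c)) ≤∑xs))
  ... | inj₁ found = found
  ... | inj₂ ≤∑xs  = ⊥-elim (ℤP.<-irrefl refl (ℤP.<-≤-trans (ℤP.suc[i]≤j⇒i<j ℤP.≤-refl)
                       (*-cancel-≤ (length xs) (ℤP.≤-trans ≤∑xs ∑≤))))

  occ : ∀ {m n} → Fin m → Vec (Fin m) n → ℕ
  occ v []      = 0
  occ v (j ∷ t) = ∑ℕ.ind (does (v F.≟ j)) ℕ.+ occ v t

  ∑-occ : ∀ {m n} (t : Vec (Fin m) n) → ∑ℕ.∑ (allFin m) (λ v → occ v t) ≡ n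
  ∑-occ {m} []      = ∑ℕ.∑-0 (allFin m)
  ∑-occ {m} (j ∷ t) = trans (∑ℕ.∑-⊕ (allFin m) _ _) (cong₂ ℕ._+_
    (trans (∑ℕ.∑-cong (allFin m) λ v → sym (ℕP.*-identityʳ _)) (∑ℕ.∑-pick j (λ _ → 1))) (∑-occ t))

  occ-lookup : ∀ {m n} (t : Vec (Fin m) n) i → 1 ℕ.≤ occ (lookup t i) t
  occ-lookup (j ∷ t) zero rewrite dec-true (j F.≟ j) refl = s≤s z≤n
  occ-lookup (j ∷ t) (suc i) = ℕP.≤-trans (occ-lookup t i) (ℕP.m≤n+m _ _)

  module _ {m : ℕ} where

    -- Equality of words as a product of indicators, so that sums over words factor letter by
    -- letter.
    eqᵛ : ∀ {n} → Vec (Fin m) n → Vec (Fin m) n → ℤ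
    eqᵛ []      []      = 1ℤ
    eqᵛ (x ∷ t) (y ∷ s) = ind (does (x F.≟ y)) * eqᵛ t s

    eqᵛ-refl : ∀ {n} (t : Vec (Fin m) n) → eqᵛ t t ≡ 1ℤ
    eqᵛ-refl []      = refl
    eqᵛ-refl (x ∷ t) rewrite dec-true (x F.≟ x) refl = trans (ℤP.*-identityˡ _) (eqᵛ-refl t)

    0≤eqᵛ : ∀ {n} (t s : Vec (Fin m) n) → 0ℤ ≤ eqᵛ t s
    0≤eqᵛ []      []      = +≤+ z≤n
    0≤eqᵛ (x ∷ t) (y ∷ s) = 0≤* (0≤ind (does (x F.≟ y))) (0≤eqᵛ t s)

    ∑-eqᵛ : ∀ {n} (s : Vec (Fin m) n) → (∑[ t ∈ allVec (allFin m) n ] eqᵛ t s) ≡ 1ℤ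
    ∑-eqᵛ []              = refl
    ∑-eqᵛ {suc n} (y ∷ s) = begin
      ∑ (allVec (allFin m) (suc n)) (λ t → eqᵛ t (y ∷ s))
        ≡⟨ ∑-allVec (allFin m) n _ ⟩
      (∑[ x ∈ allFin m ] ∑[ t ∈ allVec (allFin m) n ] (ind (does (x F.≟ y)) * eqᵛ t s))
        ≡⟨ ∑-cong (allFin m) (λ x → trans (∑-⊗ (allVec (allFin m) n) (ind (does (x F.≟ y))) _)
             (trans (cong (ind (does (x F.≟ y)) *_) (∑-eqᵛ s)) (ℤP.*-identityʳ _))) ⟩
      (∑[ x ∈ allFin m ] ind (does (x F.≟ y)))
        ≡⟨ ∑-ind≡1 y ⟩
      1ℤ ∎
      where open ≡-Reasoning

    ≤∑-allVec : ∀ {n} (f : Vec (Fin m) n → ℤ) → (∀ t → 0ℤ ≤ f t) → ∀ s → f s ≤ ∑ (allVec (allFin m) n) f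
    ≤∑-allVec f 0≤f []      = ℤP.≤-reflexive (sym (ℤP.+-identityʳ _))
    ≤∑-allVec {suc n} f 0≤f (x ∷ s) = begin
      f (x ∷ s)                                       ≤⟨ ≤∑-allVec (f ∘ (x ∷_)) (λ t → 0≤f (x ∷ t)) s ⟩
      (∑[ t ∈ allVec (allFin m) n ] f (x ∷ t))
        ≤⟨ ≤∑ {f = λ y → ∑ (allVec (allFin m) n) (f ∘ (y ∷_))} (λ y → 0≤∑ (allVec (allFin m) n) λ t → 0≤f (y ∷ t)) (∈-allFin x) ⟩
      (∑[ y ∈ allFin m ] ∑[ t ∈ allVec (allFin m) n ] f (y ∷ t)) ≡⟨ ∑-allVec (allFin m) n f ⟨
      ∑ (allVec (allFin m) (suc n)) f ∎
      where open ℤP.≤-Reasoning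

  length-filter-twice : ∀ {P : X → Set} (P? : ∀ x → Dec (P x)) (c : X → ℕ) → (∀ {x} → P x → 2 ℕ.≤ c x) →
                        ∀ xs → 2 ℕ.* length (filter P? xs) ℕ.≤ ∑ℕ.∑ xs c
  length-filter-twice P? c P⇒2≤c []       = z≤n
  length-filter-twice P? c P⇒2≤c (x ∷ xs) with P? x
  ... | yes px = subst (ℕ._≤ c x ℕ.+ ∑ℕ.∑ xs c) (sym (ℕP.*-suc 2 (length (filter P? xs))))
                   (ℕP.+-mono-≤ (P⇒2≤c px) (length-filter-twice P? c P⇒2≤c xs))
  ... | no  _  = ℕP.≤-trans (length-filter-twice P? c P⇒2≤c xs) (ℕP.m≤n+m _ (c x))

  padding : ∀ n (xs : List X) → length xs ℕ.≤ n → X → Σ (Vec X n) λ r → ∀ {x} → x ∈ xs → ∃ λ i → lookup r i ≡ x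
  padding n       []       _         d = V.replicate n d , λ ()
  padding (suc n) (x ∷ xs) (s≤s xs≤) d with padding n xs xs≤ d
  ... | r , cover = x ∷ r , λ { (here refl) → zero , refl ; (there x∈) → let i , e = cover x∈ in suc i , e }

  encode : ∀ {n n′} (r : Vec X n′) (t : Vec X n) → (∀ i → ∃ λ c → lookup r c ≡ lookup t i) →
           ∃ λ α → V.map (lookup r) α ≡ t
  encode r []      cover = [] , refl
  encode r (x ∷ t) cover with cover zero | encode r t (cover ∘ suc)
  ... | c , e | α , e′ = c ∷ α , cong₂ _∷_ e e′

  iterate : ℕ → (X → X) → X → X
  iterate zero    f x = x
  iterate (suc n) f x = f (iterate n f x)

  ∃! : ∀ {m n n′} → Vec (Fin m) n → Vec (Fin m) n′ → Set
  ∃! t t′ = ∃ λ v → occ v t ℕ.+ occ v t′ ≡ 1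

  ∃!? : ∀ {m n n′} (t : Vec (Fin m) n) (t′ : Vec (Fin m) n′) → Dec (∃! t t′)
  ∃!? t t′ = FP.any? λ v → occ v t ℕ.+ occ v t′ ℕ.≟ 1

  repetitive : ∀ {m n n′} → Vec (Fin m) n → Vec (Fin m) n′ → ℤ
  repetitive t t′ = ind (not (does (∃!? t t′)))

  -- A pair of words without a letter of multiplicity one uses at most half as many letters as it is long.
  repetitive-code : ∀ {m n} (t t′ : Vec (Fin m) (suc n)) → ¬ ∃! t t′ →
    Σ (Vec (Fin m) (suc n)) λ r → Σ (Vec (Fin (suc n)) (suc n)) λ α → Σ (Vec (Fin (suc n)) (suc n)) λ α′ →
      V.map (lookup r) α ≡ t × V.map (lookup r) α′ ≡ t′
  repetitive-code {m} {n} t t′ no! = proj₁ pad , proj₁ cα , proj₁ cα′ , proj₂ cα , proj₂ cα′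
    where
    count : Fin m → ℕ
    count v = occ v t ℕ.+ occ v t′
    used? : ∀ v → Dec (1 ℕ.≤ count v)
    used? v = 1 ℕ.≤? count v
    letters : List (Fin m)
    letters = filter used? (allFin m)
    twice : ∀ {v} → 1 ℕ.≤ count v → 2 ℕ.≤ count v
    twice {v} 1≤ = ℕP.≤∧≢⇒< 1≤ λ e → no! (v , sym e)
    few : length letters ℕ.≤ suc n
    few = ℕP.*-cancelˡ-≤ 2 (ℕP.≤-trans (length-filter-twice used? count twice (allFin m))
      (ℕP.≤-reflexive (trans (∑ℕ.∑-⊕ (allFin m) _ _) (trans (cong₂ ℕ._+_ (∑-occ t) (∑-occ t′))
        (cong (suc n ℕ.+_) (sym (ℕP.+-identityʳ (suc n))))))))
    -- The alphabet in use is filled up to length `suc n` with a letter of `t`, so every pair gets a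
    -- code of the same shape.
    pad = padding (suc n) letters few (V.head t)
    cα = encode (proj₁ pad) t λ i → proj₂ pad (∈-filter⁺ used? (∈-allFin (lookup t i))
           (ℕP.≤-trans (occ-lookup t i) (ℕP.m≤m+n _ _)))
    cα′ = encode (proj₁ pad) t′ λ i → proj₂ pad (∈-filter⁺ used? (∈-allFin (lookup t′ i))
           (ℕP.≤-trans (occ-lookup t′ i) (ℕP.m≤n+m _ _)))

  -- A repetitive pair is decoded from n letters and two words over the n positions among them.
  -- Bounding its indicator by a sum over all codes leaves m^n * n^n * n^n, against m^(2n) pairs in
  -- all.
  ∑-repetitive : ∀ m n .{{_ : NonZero n}} → (∑[ t ∈ allVec (allFin m) n ] ∑[ t′ ∈ allVec (allFin m) n ] repetitive t t′)
                       ≤ + (m ℕ.^ n) * (+ (n ℕ.^ n) * + (n ℕ.^ n))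
  ∑-repetitive m n@(suc _) = begin
    (∑[ t ∈ W ] ∑[ t′ ∈ W ] repetitive t t′)
      ≤⟨ ∑-mono W (λ t → ∑-mono W λ t′ → covered t t′) ⟩
    (∑[ t ∈ W ] ∑[ t′ ∈ W ] ∑[ r ∈ W ] ∑[ α ∈ C ] ∑[ α′ ∈ C ] (eqᵛ t (V.map (lookup r) α) * eqᵛ t′ (V.map (lookup r) α′)))
      ≡⟨ ∑-cong W (λ t → trans (∑-swap W W _) (∑-cong W λ r → trans (∑-swap W C _) (∑-cong C λ α → ∑-swap W C _))) ⟩
    (∑[ t ∈ W ] ∑[ r ∈ W ] ∑[ α ∈ C ] ∑[ α′ ∈ C ] ∑[ t′ ∈ W ] (eqᵛ t (V.map (lookup r) α) * eqᵛ t′ (V.map (lookup r) α′)))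
      ≡⟨ ∑-cong W (λ t → ∑-cong W λ r → ∑-cong C λ α → ∑-cong C λ α′ →
           trans (∑-⊗ W (eqᵛ t (V.map (lookup r) α)) _)
                 (trans (cong (eqᵛ t (V.map (lookup r) α) *_) (∑-eqᵛ (V.map (lookup r) α′))) (ℤP.*-identityʳ _))) ⟩
    (∑[ t ∈ W ] ∑[ r ∈ W ] ∑[ α ∈ C ] ∑[ α′ ∈ C ] eqᵛ t (V.map (lookup r) α))
      ≡⟨ trans (∑-swap W W _) (∑-cong W λ r → trans (∑-swap W C _) (∑-cong C λ α → trans (∑-swap W C _)
           (∑-cong C λ α′ → ∑-eqᵛ (V.map (lookup r) α)))) ⟩
    (∑[ r ∈ W ] ∑[ α ∈ C ] ∑[ α′ ∈ C ] 1ℤ)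
      ≡⟨ trans (∑-cong W λ r → trans (∑-cong C λ α → trans (∑ℤ-const C 1ℤ) (ℤP.*-identityʳ _)) (∑ℤ-const C _)) (∑ℤ-const W _) ⟩
    + length W * (+ length C * + length C)
      ≡⟨ cong₂ (λ w c → w * (c * c)) (trans (length-allVec (allFin m) n) (cong (λ k → + (k ℕ.^ n)) (length-allFin m)))
           (trans (length-allVec (allFin n) n) (cong (λ k → + (k ℕ.^ n)) (length-allFin n))) ⟩
    + (m ℕ.^ n) * (+ (n ℕ.^ n) * + (n ℕ.^ n)) ∎
    where
    open ℤP.≤-Reasoning
    W = allVec (allFin m) n
    C = allVec (allFin n) n
    0≤term : ∀ t t′ r α α′ → 0ℤ ≤ eqᵛ t (V.map (lookup r) α) * eqᵛ t′ (V.map (lookup r) α′)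
    0≤term t t′ r α α′ = 0≤* (0≤eqᵛ t (V.map (lookup r) α)) (0≤eqᵛ t′ (V.map (lookup r) α′))
    covered : ∀ t t′ → repetitive t t′ ≤ (∑[ r ∈ W ] ∑[ α ∈ C ] ∑[ α′ ∈ C ] (eqᵛ t (V.map (lookup r) α) * eqᵛ t′ (V.map (lookup r) α′)))
    covered t t′ with ∃!? t t′
    ... | yes _  = 0≤∑ W λ r → 0≤∑ C λ α → 0≤∑ C λ α′ → 0≤term t t′ r α α′
    ... | no no! with repetitive-code t t′ no!
    ...   | r , α , α′ , refl , refl = begin
      1ℤ
        ≡⟨ cong₂ _*_ (eqᵛ-refl t) (eqᵛ-refl t′) ⟨
      eqᵛ t (V.map (lookup r) α) * eqᵛ t′ (V.map (lookup r) α′)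
        ≤⟨ ≤∑-allVec _ (0≤term t t′ r α) α′ ⟩
      (∑[ α′ ∈ C ] (eqᵛ t (V.map (lookup r) α) * eqᵛ t′ (V.map (lookup r) α′)))
        ≤⟨ ≤∑-allVec _ (λ α → 0≤∑ C (0≤term t t′ r α)) α ⟩
      (∑[ α ∈ C ] ∑[ α′ ∈ C ] (eqᵛ t (V.map (lookup r) α) * eqᵛ t′ (V.map (lookup r) α′)))
        ≤⟨ ≤∑-allVec _ (λ r → 0≤∑ C λ α → 0≤∑ C (0≤term t t′ r α)) r ⟩
      (∑[ r ∈ W ] ∑[ α ∈ C ] ∑[ α′ ∈ C ] (eqᵛ t (V.map (lookup r) α) * eqᵛ t′ (V.map (lookup r) α′))) ∎

  -- Drawing the v-th coordinate anew does not change the distribution. It allows all shifts but one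
  -- to be fixed first.
  ∑-resample : ∀ (xs : List X) {m} (v : Fin m) (Φ : Vec X m → ℤ) →
    + length xs * ∑ (allVec xs m) Φ ≡ (∑[ k ∈ allVec xs m ] ∑[ z ∈ xs ] Φ (k [ v ]≔ z))
  ∑-resample xs {suc m} zero Φ = begin
    + length xs * ∑ (allVec xs (suc m)) Φ
      ≡⟨ cong (+ length xs *_) (trans (∑-allVec xs m Φ) (∑-swap xs (allVec xs m) _)) ⟩
    + length xs * (∑[ k ∈ allVec xs m ] ∑[ z ∈ xs ] Φ (z ∷ k))
      ≡⟨ ∑ℤ-const xs _ ⟨
    (∑[ x ∈ xs ] ∑[ k ∈ allVec xs m ] ∑[ z ∈ xs ] Φ (z ∷ k))
      ≡⟨ ∑-allVec xs m _ ⟨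
    (∑[ k ∈ allVec xs (suc m) ] ∑[ z ∈ xs ] Φ (k [ zero ]≔ z)) ∎
    where open ≡-Reasoning
  ∑-resample xs {suc m} (suc v) Φ = begin
    + length xs * ∑ (allVec xs (suc m)) Φ
      ≡⟨ cong (+ length xs *_) (∑-allVec xs m Φ) ⟩
    + length xs * (∑[ x ∈ xs ] ∑[ k ∈ allVec xs m ] Φ (x ∷ k))
      ≡⟨ ∑-⊗ xs (+ length xs) _ ⟨
    (∑[ x ∈ xs ] (+ length xs * (∑[ k ∈ allVec xs m ] Φ (x ∷ k))))
      ≡⟨ ∑-cong xs (λ x → ∑-resample xs v (Φ ∘ (x ∷_))) ⟩
    (∑[ x ∈ xs ] ∑[ k ∈ allVec xs m ] ∑[ z ∈ xs ] Φ (x ∷ (k [ v ]≔ z)))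
      ≡⟨ ∑-allVec xs m _ ⟨
    (∑[ k ∈ allVec xs (suc m) ] ∑[ z ∈ xs ] Φ (k [ suc v ]≔ z)) ∎
    where open ≡-Reasoning

  -- For random shifts, two words in which some letter has total multiplicity one collide with probability exactly 1/K.
  module RandomShifts (K : ℕ) .{{_ : NonZero K}} (m : ℕ) where
    open Rotation K
    open Convolution K

    step : Vec (Fin K) m → Fin m → ℕ
    step k j = toℕ (lookup k j)

    weight : ∀ {n} → Vec (Fin K) m → Vec (Fin m) n → ℕ
    weight k []      = 0
    weight k (j ∷ t) = step k j ℕ.+ weight k t

    conv-iterate : ∀ n k g a → iterate n (conv (allFin m) (step k)) g a ≡ conv (allVec (allFin m) n) (weight k) g a
    conv-iterate zero    k g a = trans (sym (trans (cong (λ z → g (z mod K)) (ℕP.+-identityʳ (toℕ a))) (cong g (mod-toℕ a))))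
                                       (sym (ℤP.+-identityʳ _))
    conv-iterate (suc n) k g a = begin
      (∑[ j ∈ allFin m ] iterate n (conv (allFin m) (step k)) g (a ⊕ step k j))
        ≡⟨ ∑-cong (allFin m) (λ j → conv-iterate n k g (a ⊕ step k j)) ⟩
      (∑[ j ∈ allFin m ] ∑[ t ∈ allVec (allFin m) n ] g (a ⊕ step k j ⊕ weight k t))
        ≡⟨ ∑-cong (allFin m) (λ j → ∑-cong (allVec (allFin m) n) λ t → cong g (⊕-assoc a (step k j) (weight k t))) ⟩
      (∑[ j ∈ allFin m ] ∑[ t ∈ allVec (allFin m) n ] g (a ⊕ weight k (j ∷ t)))
        ≡⟨ ∑-allVec (allFin m) n _ ⟨
      conv (allVec (allFin m) (suc n)) (weight k) g a ∎
      where open ≡-Reasoning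

    weight-absent : ∀ {n} v (t : Vec (Fin m) n) → occ v t ≡ 0 → ∀ k z → weight (k [ v ]≔ z) t ≡ weight k t
    weight-absent v []      _ k z = refl
    weight-absent v (j ∷ t) e k z with v F.≟ j
    ... | no v≢j = cong₂ ℕ._+_ (cong toℕ (VP.lookup∘update′ (v≢j ∘ sym) k z)) (weight-absent v t e k z)

    -- If v occurs once, its shift enters the total with coefficient one, so a uniform shift makes
    -- the end point of the word uniform on ℤ/K.
    weight-once : ∀ {n} v (t : Vec (Fin m) n) → occ v t ≡ 1 → ∀ k → ∃ λ r → ∀ z → weight (k [ v ]≔ z) t ≡ r ℕ.+ toℕ z
    weight-once v (j ∷ t) e k with v F.≟ j
    ... | yes refl = weight k t , λ z → trans
            (cong₂ ℕ._+_ (cong toℕ (VP.lookup∘update v k z)) (weight-absent v t (ℕP.suc-injective e) k z))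
            (ℕP.+-comm (toℕ z) _)
    ... | no  v≢j with weight-once v t e k
    ...   | r , w≡ = step k j ℕ.+ r , λ z → trans
            (cong₂ ℕ._+_ (cong toℕ (VP.lookup∘update′ (v≢j ∘ sym) k z)) (w≡ z)) (sym (ℕP.+-assoc (step k j) r (toℕ z)))

    private
      Ks = allVec (allFin K) m
      N = + length Ks
      κ = + K

      collide : ∀ {n n′} → Fin K → Vec (Fin m) n → Vec (Fin m) n′ → Vec (Fin K) m → ℤ
      collide a t t′ k = ind (does (a ⊕ weight k t F.≟ a ⊕ weight k t′))

      collide-sym : ∀ {n n′} a (t : Vec (Fin m) n) (t′ : Vec (Fin m) n′) k → collide a t t′ k ≡ collide a t′ t k
      collide-sym a t t′ k = cong ind (does-sym (a ⊕ weight k t) (a ⊕ weight k t′))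

      orbit : ∀ {n n′} a v (t : Vec (Fin m) n) (t′ : Vec (Fin m) n′) → occ v t ≡ 1 → occ v t′ ≡ 0 → ∀ k →
              (∑[ z ∈ allFin K ] collide a t t′ (k [ v ]≔ z)) ≡ 1ℤ
      orbit a v t t′ e e′ k with weight-once v t e k
      ... | r , w≡ = trans (∑-cong (allFin K) λ z → cong₂ (λ x y → ind (does (x F.≟ y)))
                         (trans (cong (a ⊕_) (w≡ z)) (sym (⊕-assoc a r (toℕ z))))
                         (cong (a ⊕_) (weight-absent v t′ e′ k z)))
                       (trans (∑-orbit (λ b → ind (does (b F.≟ a ⊕ weight k t′))) (a ⊕ r)) (∑-ind≡1 (a ⊕ weight k t′)))

      uniform : ∀ {n n′} a v (t : Vec (Fin m) n) (t′ : Vec (Fin m) n′) → occ v t ≡ 1 → occ v t′ ≡ 0 →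
                κ * ∑ Ks (collide a t t′) ≡ N
      uniform a v t t′ e e′ = begin
        κ * ∑ Ks (collide a t t′)
          ≡⟨ cong (λ n → + n * ∑ Ks (collide a t t′)) (length-allFin K) ⟨
        + length (allFin K) * ∑ Ks (collide a t t′)
          ≡⟨ ∑-resample (allFin K) v (collide a t t′) ⟩
        (∑[ k ∈ Ks ] ∑[ z ∈ allFin K ] collide a t t′ (k [ v ]≔ z))
          ≡⟨ ∑-cong Ks (orbit a v t t′ e e′) ⟩
        ∑ Ks (λ _ → 1ℤ)
          ≡⟨ trans (∑ℤ-const Ks 1ℤ) (ℤP.*-identityʳ N) ⟩
        N ∎
        where open ≡-Reasoning

      split-1 : ∀ x y → x ℕ.+ y ≡ 1 → (x ≡ 1 × y ≡ 0) ⊎ (x ≡ 0 × y ≡ 1)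
      split-1 zero          y    e = inj₂ (refl , e)
      split-1 (suc zero)    zero e = inj₁ (refl , refl)

      unaffected : ∀ N κ → N ≡ N * (1ℤ + κ * 0ℤ)
      unaffected = ℤR.solve-∀

      -- The probability of a collision is 1/K, or trivially at most 1 for a repetitive pair; both
      -- sides carry the factor K * N.
      collide-bound : ∀ {n n′} a (t : Vec (Fin m) n) (t′ : Vec (Fin m) n′) →
        κ * ∑ Ks (collide a t t′) ≤ N * (1ℤ + κ * repetitive t t′)
      collide-bound a t t′ with ∃!? t t′
      ... | yes (v , e) with split-1 (occ v t) (occ v t′) e
      ...   | inj₁ (e₁ , e₀) = ℤP.≤-reflexive (trans (uniform a v t t′ e₁ e₀) (unaffected N κ))
      ...   | inj₂ (e₀ , e₁) = ℤP.≤-reflexive (trans (cong (κ *_) (∑-cong Ks (collide-sym a t t′)))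
                                 (trans (uniform a v t′ t e₁ e₀) (unaffected N κ)))
      collide-bound a t t′ | no _ = begin
        κ * ∑ Ks (collide a t t′)  ≤⟨ *-mono-0≤ (0≤+ K) (∑-mono Ks λ k → ind≤1 (does (a ⊕ weight k t F.≟ a ⊕ weight k t′))) ⟩
        κ * ∑ Ks (λ _ → 1ℤ)        ≡⟨ cong (κ *_) (trans (∑ℤ-const Ks 1ℤ) (ℤP.*-identityʳ N)) ⟩
        κ * N                      ≤⟨ ≤-by N (0≤+ _) (alg N κ) ⟩
        N * (1ℤ + κ * 1ℤ)          ∎
        where
        open ℤP.≤-Reasoning
        alg : ∀ N κ → N * (1ℤ + κ * 1ℤ) ≡ κ * N + N
        alg = ℤR.solve-∀

    module _ (n : ℕ) .{{_ : NonZero n}} where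
      private
        Ws = allVec (allFin m) n
        M = + length Ws
        ρ = ∑[ t ∈ Ws ] ∑[ t′ ∈ Ws ] repetitive t t′

        ∑-collisions : (∑[ k ∈ Ks ] collisions Ws (weight k)) ≤ N * (M * M + κ * ρ)
        ∑-collisions = *-cancel-≤ K (begin
          κ * (∑[ k ∈ Ks ] collisions Ws (weight k))
            ≡⟨ cong (κ *_) (trans (∑-swap Ks (allFin K) _) (∑-cong (allFin K) λ a →
                 trans (∑-swap Ks Ws _) (∑-cong Ws λ t → ∑-swap Ks Ws _))) ⟩
          κ * (∑[ a ∈ allFin K ] ∑[ t ∈ Ws ] ∑[ t′ ∈ Ws ] ∑ Ks (collide a t t′))
            ≡⟨ trans (sym (∑-⊗ (allFin K) κ _)) (∑-cong (allFin K) λ a →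
                 trans (sym (∑-⊗ Ws κ _)) (∑-cong Ws λ t → sym (∑-⊗ Ws κ _))) ⟩
          (∑[ a ∈ allFin K ] ∑[ t ∈ Ws ] ∑[ t′ ∈ Ws ] (κ * ∑ Ks (collide a t t′)))
            ≤⟨ ∑-mono (allFin K) (λ a → ∑-mono Ws λ t → ∑-mono Ws λ t′ → collide-bound a t t′) ⟩
          (∑[ a ∈ allFin K ] ∑[ t ∈ Ws ] ∑[ t′ ∈ Ws ] (N * (1ℤ + κ * repetitive t t′)))
            ≡⟨ trans (∑ℤ-const (allFin K) _) (cong (λ k → + k * (∑[ t ∈ Ws ] ∑[ t′ ∈ Ws ] (N * (1ℤ + κ * repetitive t t′)))) (length-allFin K)) ⟩
          κ * (∑[ t ∈ Ws ] ∑[ t′ ∈ Ws ] (N * (1ℤ + κ * repetitive t t′)))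
            ≡⟨ cong (κ *_) (trans (∑-cong Ws λ t → trans (∑-⊗ Ws N _)
                 (cong (N *_) (trans (∑-⊕ Ws _ _) (cong₂ _+_ (trans (∑ℤ-const Ws 1ℤ) (ℤP.*-identityʳ M)) (∑-⊗ Ws κ _)))))
                 (trans (∑-⊗ Ws N _) (cong (N *_) (trans (∑-⊕ Ws _ _) (cong₂ _+_ (∑ℤ-const Ws M) (∑-⊗ Ws κ _)))))) ⟩
          κ * (N * (M * M + κ * ρ)) ∎)
          where open ℤP.≤-Reasoning

        length-Ks : NonZero (length Ks)
        length-Ks = subst NonZero (sym (ℤP.+-injective (trans (length-allVec (allFin K) m)
                      (cong (λ k → + (k ℕ.^ m)) (length-allFin K))))) (ℕP.m^n≢0 K m)

      -- First moment method: some choice of shifts does no worse than the average.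
      few-collisions : ∃ λ k → collisions Ws (weight k) ≤ M * M + κ * ρ
      few-collisions = ∃≤average Ks (λ k → collisions Ws (weight k)) (M * M + κ * ρ) {{length-Ks}} ∑-collisions

      contracting : ∃ λ k → ∀ g → ∑ (allFin K) g ≡ 0ℤ →
        ‖ iterate n (conv (allFin m) (step k)) g ‖² ≤ (κ * (+ (m ℕ.^ n) * (+ (n ℕ.^ n) * + (n ℕ.^ n)))) * ‖ g ‖²
      contracting with few-collisions
      ... | k , E≤ = k , λ g ∑g≡0 → begin
        ‖ iterate n (conv (allFin m) (step k)) g ‖²  ≡⟨ ‖‖²-cong (conv-iterate n k g) ⟩
        ‖ conv Ws (weight k) g ‖²                    ≤⟨ hilbert-schmidt Ws (weight k) _ E≤ g ∑g≡0 ⟩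
        (κ * ρ) * ‖ g ‖²                             ≤⟨ ℤP.*-monoʳ-≤-nonNeg ‖ g ‖² {{ℤ.nonNegative (0≤‖‖² g)}}
                                                          (*-mono-0≤ (0≤+ K) (∑-repetitive m n)) ⟩
        _ ∎
        where open ℤP.≤-Reasoning

    -- The eighth power is contracted by K m^8 d², which by hypothesis is at most m^16 / c^8; the
    -- eighth root of this is m² / c.
    mixing-from-contraction : ∀ c d k → (c ℕ.^ 8 ℕ.* (d ℕ.* d)) ℕ.* K ℕ.≤ m ℕ.^ 8 → ∀ g →
      ‖ iterate 8 (conv (allFin m) (step k)) g ‖² ≤ (κ * (+ (m ℕ.^ 8) * (+ d * + d))) * ‖ g ‖² →
      + c * ‖ conv (allFin m) (step k) g ‖² ≤ (+ m * + m) * ‖ g ‖²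
    mixing-from-contraction c d k large g s₈≤ =
      eighth-root (conv-normal (allFin m) (step k)) (+ c) (μ * μ) (0≤x*x μ) g bound
      where
      A = conv (allFin m) (step k)
      D = + d
      μ = + m
      eighth : ℤ → ℤ
      eighth x = (x * x) * (x * x) * ((x * x) * (x * x))
      pos-8 : ∀ n → + (n ℕ.^ 8) ≡ eighth (+ n)
      pos-8 n = trans (cong +_ (alg n)) (trans (ℤP.pos-* ((n ℕ.* n) ℕ.* (n ℕ.* n)) ((n ℕ.* n) ℕ.* (n ℕ.* n))) (cong₂ _*_ e e))
        where
        alg : ∀ m → m ℕ.* (m ℕ.* (m ℕ.* (m ℕ.* (m ℕ.* (m ℕ.* (m ℕ.* (m ℕ.* 1))))))) ≡ ((m ℕ.* m) ℕ.* (m ℕ.* m)) ℕ.* ((m ℕ.* m) ℕ.* (m ℕ.* m))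
        alg = ℕR.solve-∀
        e : + ((n ℕ.* n) ℕ.* (n ℕ.* n)) ≡ (+ n * + n) * (+ n * + n)
        e = trans (ℤP.pos-* (n ℕ.* n) (n ℕ.* n)) (cong₂ _*_ (ℤP.pos-* n n) (ℤP.pos-* n n))
      C = eighth (+ c)
      M = eighth μ
      large′ : (C * (D * D)) * κ ≤ M
      large′ = subst₂ _≤_ (trans (ℤP.pos-* (c ℕ.^ 8 ℕ.* (d ℕ.* d)) K) (cong (_* κ)
                 (trans (ℤP.pos-* (c ℕ.^ 8) (d ℕ.* d)) (cong₂ _*_ (pos-8 c) (ℤP.pos-* d d))))) (pos-8 m) (+≤+ large)
      bound : C * ‖ A (A (A (A (A (A (A (A g))))))) ‖² ≤ eighth (μ * μ) * ‖ g ‖²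
      bound = begin
        C * ‖ iterate 8 A g ‖²                            ≤⟨ *-mono-0≤ (0≤x*x (+ c * + c * (+ c * + c))) s₈≤ ⟩
        C * ((κ * (+ (m ℕ.^ 8) * (D * D))) * ‖ g ‖²)      ≡⟨ cong (λ z → C * ((κ * (z * (D * D))) * ‖ g ‖²)) (pos-8 m) ⟩
        C * ((κ * (M * (D * D))) * ‖ g ‖²)                ≡⟨ alg C κ M D ‖ g ‖² ⟩
        (M * ‖ g ‖²) * ((C * (D * D)) * κ)                ≤⟨ *-mono-0≤ (0≤* (0≤x*x (μ * μ * (μ * μ))) (0≤‖‖² g)) large′ ⟩
        (M * ‖ g ‖²) * M                                  ≡⟨ alg′ M ‖ g ‖² ⟩
        (M * M) * ‖ g ‖²                                  ≡⟨ cong (_* ‖ g ‖²) (alg″ μ) ⟩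
        eighth (μ * μ) * ‖ g ‖²                           ∎
        where
        open ℤP.≤-Reasoning
        alg : ∀ C κ M D s → C * ((κ * (M * (D * D))) * s) ≡ (M * s) * ((C * (D * D)) * κ)
        alg = ℤR.solve-∀
        alg′ : ∀ M s → (M * s) * M ≡ (M * M) * s
        alg′ = ℤR.solve-∀
        alg″ : ∀ x → ((x * x) * (x * x) * ((x * x) * (x * x))) * ((x * x) * (x * x) * ((x * x) * (x * x)))
                   ≡ (x * x * (x * x)) * (x * x * (x * x)) * ((x * x * (x * x)) * (x * x * (x * x)))
        alg″ = ℤR.solve-∀

    -- The word length and the constant are variables tied down by equations, so that numerals such
    -- as 8^8 stay folded in the types.
    mixing-shifts : ∀ c n Γ .{{_ : NonZero n}} → n ≡ 8 → Γ ≡ c ℕ.^ 8 ℕ.* (n ℕ.^ n ℕ.* n ℕ.^ n) → Γ ℕ.* K ℕ.≤ m ℕ.^ 8 →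
      ∃ λ k → ∀ g → ∑ (allFin K) g ≡ 0ℤ → + c * ‖ conv (allFin m) (step k) g ‖² ≤ (+ m * + m) * ‖ g ‖²
    mixing-shifts c n Γ e Γ≡ large = proj₁ contracting-n , λ g ∑g≡0 →
      mixing-from-contraction c (n ℕ.^ n) (proj₁ contracting-n) (subst (λ γ → γ ℕ.* K ℕ.≤ m ℕ.^ 8) Γ≡ large) g
        (subst (λ i → ‖ iterate i (conv (allFin m) (step (proj₁ contracting-n))) g ‖²
                      ≤ (κ * (+ (m ℕ.^ i) * (+ (n ℕ.^ n) * + (n ℕ.^ n)))) * ‖ g ‖²) e (proj₂ contracting-n g ∑g≡0))
      where contracting-n = contracting n

  -- Circle maps and their lifts: composition, shifts and runs

  opaque
    -- Opaque, so that points of a product are handled through `combine` and `onPair-combine` only,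
    -- and `remQuot` never unfolds in a goal.
    onPair : ∀ {m n} → (Fin m → Fin n → X) → Fin (m ℕ.* n) → X
    onPair {n = n} f = uncurry f ∘ remQuot n

    onPair-combine : ∀ {m n} (f : Fin m → Fin n → X) i j → onPair f (combine i j) ≡ f i j
    onPair-combine f i j = cong (uncurry f) (FP.remQuot-combine i j)

  -- A permutation of the circle ℤ/N (its surjectivity is only needed through preserve) that lifts to the line:
  -- point x on sheet j is sent to point fun x on sheet carry x + j, and the lift is increasing on the good points.
  record CircleMap (N : ℕ) : Set where
    field
      fun        : Fin N → Fin N
      carry      : Fin N → ℕ
      good       : Fin N → Bool
      preserve   : ∀ (f : Fin N → ℤ) → ∑ (allFin N) (f ∘ fun) ≡ ∑ (allFin N) f
      increasing : ∀ x y j k → T (good x) → T (good y) → toℕ x ℕ.+ N ℕ.* j ℕ.< toℕ y ℕ.+ N ℕ.* k →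
                   toℕ (fun x) ℕ.+ N ℕ.* (carry x ℕ.+ j) ℕ.< toℕ (fun y) ℕ.+ N ℕ.* (carry y ℕ.+ k)

    badness : ℤ
    badness = ∑[ x ∈ allFin N ] ind (not (good x))

  open CircleMap

  identity : ∀ N → CircleMap N
  identity N = record
    { fun = id ; carry = λ _ → 0 ; good = λ _ → true ; preserve = λ f → refl
    ; increasing = λ x y j k _ _ lt → lt }

  T-∧ˡ : ∀ {a b} → T (a ∧ b) → T a
  T-∧ˡ = proj₁ ∘ Equivalence.to T-∧

  T-∧ʳ : ∀ {a b} → T (a ∧ b) → T b
  T-∧ʳ {a} = proj₂ ∘ Equivalence.to (T-∧ {a})

  infixr 9 _⊚_
  _⊚_ : ∀ {N} → CircleMap N → CircleMap N → CircleMap N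
  _⊚_ {N} φ ψ = record
    { fun = fun φ ∘ fun ψ
    ; carry = λ x → carry φ (fun ψ x) ℕ.+ carry ψ x
    ; good = λ x → good ψ x ∧ good φ (fun ψ x)
    ; preserve = λ f → trans (preserve ψ (f ∘ fun φ)) (preserve φ f)
    ; increasing = λ x y j k gx gy lt → subst₂ ℕ._<_
        (cong (λ s → toℕ (fun φ (fun ψ x)) ℕ.+ N ℕ.* s) (sym (ℕP.+-assoc (carry φ (fun ψ x)) (carry ψ x) j)))
        (cong (λ s → toℕ (fun φ (fun ψ y)) ℕ.+ N ℕ.* s) (sym (ℕP.+-assoc (carry φ (fun ψ y)) (carry ψ y) k)))
        (increasing φ (fun ψ x) (fun ψ y) (carry ψ x ℕ.+ j) (carry ψ y ℕ.+ k) (T-∧ʳ {good ψ x} gx) (T-∧ʳ {good ψ y} gy)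
          (increasing ψ x y j k (T-∧ˡ gx) (T-∧ˡ gy) lt))
    }

  ind-not-∧ : ∀ a b → ind (not (a ∧ b)) ≤ ind (not b) + ind (not a)
  ind-not-∧ true  b = ℤP.≤-reflexive (sym (ℤP.+-identityʳ _))
  ind-not-∧ false b = subst (_≤ ind (not b) + 1ℤ) (ℤP.+-identityˡ 1ℤ) (ℤP.+-monoˡ-≤ 1ℤ (0≤ind (not b)))

  badness-⊚ : ∀ {N} (φ ψ : CircleMap N) → badness (φ ⊚ ψ) ≤ badness φ + badness ψ
  badness-⊚ {N} φ ψ = begin
    badness (φ ⊚ ψ)
      ≤⟨ ∑-mono (allFin N) (λ x → ind-not-∧ (good ψ x) (good φ (fun ψ x))) ⟩
    (∑[ x ∈ allFin N ] (ind (not (good φ (fun ψ x))) + ind (not (good ψ x))))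
      ≡⟨ ∑-⊕ (allFin N) _ _ ⟩
    (∑[ x ∈ allFin N ] ind (not (good φ (fun ψ x)))) + badness ψ
      ≡⟨ cong (_+ badness ψ) (preserve ψ (λ x → ind (not (good φ x)))) ⟩
    badness φ + badness ψ ∎
    where open ℤP.≤-Reasoning

  module _ (N : ℕ) where
    lex-< : ∀ {j k r s} → r ℕ.< N → j ℕ.< k → r ℕ.+ N ℕ.* j ℕ.< s ℕ.+ N ℕ.* k
    lex-< {j} {k} {r} {s} r<N j<k = begin-strict
      r ℕ.+ N ℕ.* j   <⟨ ℕP.+-monoˡ-< (N ℕ.* j) r<N ⟩
      N ℕ.+ N ℕ.* j   ≡⟨ ℕP.*-suc N j ⟨
      N ℕ.* suc j     ≤⟨ ℕP.*-monoʳ-≤ N j<k ⟩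
      N ℕ.* k         ≤⟨ ℕP.m≤n+m _ s ⟩
      s ℕ.+ N ℕ.* k   ∎
      where open ℕP.≤-Reasoning

    lex-elim : ∀ {j k r s} → s ℕ.< N → r ℕ.+ N ℕ.* j ℕ.< s ℕ.+ N ℕ.* k → j ℕ.< k ⊎ (j ≡ k × r ℕ.< s)
    lex-elim {j} {k} {r} {s} s<N lt with ℕP.<-cmp j k
    ... | tri< j<k _ _ = inj₁ j<k
    ... | tri≈ _ refl _ = inj₂ (refl , ℕP.+-cancelʳ-< (N ℕ.* j) r s lt)
    ... | tri> _ _ k<j = ⊥-elim (ℕP.<-asym lt (lex-< s<N k<j))

  module Shift (K : ℕ) .{{_ : NonZero K}} (N : ℕ) where
    open Rotation K

    -- On the line this is translation by N * k: the quotient by K that the label loses reappears as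
    -- a carry. Hence every point is good.
    shift : ℕ → CircleMap (K ℕ.* N)
    shift k = record
      { fun = step ; carry = sheet ; good = λ _ → true ; preserve = pres
      ; increasing = λ x y i j _ _ lt → subst₂ ℕ._<_ (sym (lift x i)) (sym (lift y j)) (ℕP.+-monoˡ-< (N ℕ.* k) lt) }
      where
      step₂ : Fin K → Fin N → Fin (K ℕ.* N)
      step₂ a v = combine (a ⊕ k) v
      sheet₂ : Fin K → Fin N → ℕ
      sheet₂ a _ = (toℕ a ℕ.+ k) / K
      step = onPair step₂
      sheet = onPair sheet₂
      pres : ∀ f → ∑ (allFin (K ℕ.* N)) (f ∘ step) ≡ ∑ (allFin (K ℕ.* N)) f
      pres f = begin
        ∑ (allFin (K ℕ.* N)) (f ∘ step)
          ≡⟨ ∑-combine K N (f ∘ step) ⟩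
        (∑[ a ∈ allFin K ] ∑[ v ∈ allFin N ] f (step (combine a v)))
          ≡⟨ ∑-cong (allFin K) (λ a → ∑-cong (allFin N) λ v → cong f (onPair-combine step₂ a v)) ⟩
        (∑[ a ∈ allFin K ] ∑[ v ∈ allFin N ] f (combine (a ⊕ k) v))
          ≡⟨ ∑-shift (λ a → ∑[ v ∈ allFin N ] f (combine a v)) k ⟩
        (∑[ a ∈ allFin K ] ∑[ v ∈ allFin N ] f (combine a v))
          ≡⟨ ∑-combine K N f ⟨
        ∑ (allFin (K ℕ.* N)) f ∎
        where open ≡-Reasoning
      lift : ∀ x j → toℕ (step x) ℕ.+ K ℕ.* N ℕ.* (sheet x ℕ.+ j) ≡ (toℕ x ℕ.+ K ℕ.* N ℕ.* j) ℕ.+ N ℕ.* k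
      lift x j with FP.combine-surjective {K} {N} x
      ... | a , v , refl rewrite onPair-combine step₂ a v | onPair-combine sheet₂ a v = begin
        toℕ (combine (a ⊕ k) v) ℕ.+ K ℕ.* N ℕ.* (c ℕ.+ j)
          ≡⟨ cong (ℕ._+ K ℕ.* N ℕ.* (c ℕ.+ j)) (trans (FP.toℕ-combine (a ⊕ k) v) (cong (λ z → N ℕ.* z ℕ.+ toℕ v) (toℕ-mod _))) ⟩
        N ℕ.* r ℕ.+ toℕ v ℕ.+ K ℕ.* N ℕ.* (c ℕ.+ j)
          ≡⟨ alg N K r c j (toℕ v) ⟩
        N ℕ.* (r ℕ.+ c ℕ.* K) ℕ.+ (toℕ v ℕ.+ K ℕ.* N ℕ.* j)
          ≡⟨ cong (λ z → N ℕ.* z ℕ.+ (toℕ v ℕ.+ K ℕ.* N ℕ.* j)) (DM.m≡m%n+[m/n]*n (toℕ a ℕ.+ k) K) ⟨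
        N ℕ.* (toℕ a ℕ.+ k) ℕ.+ (toℕ v ℕ.+ K ℕ.* N ℕ.* j)
          ≡⟨ alg′ N (toℕ a) k (toℕ v) (K ℕ.* N ℕ.* j) ⟩
        (N ℕ.* toℕ a ℕ.+ toℕ v) ℕ.+ K ℕ.* N ℕ.* j ℕ.+ N ℕ.* k
          ≡⟨ cong (λ z → z ℕ.+ K ℕ.* N ℕ.* j ℕ.+ N ℕ.* k) (FP.toℕ-combine a v) ⟨
        toℕ (combine a v) ℕ.+ K ℕ.* N ℕ.* j ℕ.+ N ℕ.* k ∎
        where
        open ≡-Reasoning
        r = (toℕ a ℕ.+ k) % K
        c = (toℕ a ℕ.+ k) / K
        alg : ∀ N K r c j v → N ℕ.* r ℕ.+ v ℕ.+ K ℕ.* N ℕ.* (c ℕ.+ j) ≡ N ℕ.* (r ℕ.+ c ℕ.* K) ℕ.+ (v ℕ.+ K ℕ.* N ℕ.* j)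
        alg = ℕR.solve-∀
        alg′ : ∀ N a k v z → N ℕ.* (a ℕ.+ k) ℕ.+ (v ℕ.+ z) ≡ (N ℕ.* a ℕ.+ v) ℕ.+ z ℕ.+ N ℕ.* k
        alg′ = ℕR.solve-∀

    shift-combine : ∀ k a v → fun (shift k) (combine a v) ≡ combine (a ⊕ k) v
    shift-combine k = onPair-combine _

    badness-shift : ∀ k → badness (shift k) ≡ 0ℤ
    badness-shift k = ∑-0 (allFin (K ℕ.* N))

    carry-shift : ∀ k → k ℕ.≤ K → ∀ x → carry (shift k) x ℕ.≤ 1
    carry-shift k k≤K x with FP.combine-surjective {K} {N} x
    ... | a , v , refl rewrite onPair-combine {m = K} {n = N} (λ a _ → (toℕ a ℕ.+ k) / K) a v =
      ℕP.≤-pred (DM.m<n*o⇒m/o<n {n = 2} (ℕP.<-≤-trans (ℕP.+-mono-<-≤ (FP.toℕ<n a) k≤K)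
        (ℕP.≤-reflexive (cong (K ℕ.+_) (sym (ℕP.+-identityʳ K))))))

  -- The circle of length (W * Q) * N consists of W runs, each a Q-fold cover of the circle of length N; on the w-th
  -- run φ w acts by its lift, which leaves the run only from its last sheets.
  module Run (W Q : ℕ) .{{_ : NonZero Q}} {N : ℕ} (φ : Fin W → CircleMap N) where
    open Rotation Q

    private
      move₃ : Fin N → Fin W → Fin Q → Fin (W ℕ.* Q ℕ.* N)
      move₃ v w q = combine (combine w (q ⊕ carry (φ w) v)) (fun (φ w) v)

      move : Fin (W ℕ.* Q) → Fin N → Fin (W ℕ.* Q ℕ.* N)
      move a v = onPair (move₃ v) a

      stays₃ : Fin N → Fin W → Fin Q → Bool
      stays₃ v w q = good (φ w) v ∧ does (toℕ q ℕ.+ carry (φ w) v ℕ.<? Q)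

      stays : Fin (W ℕ.* Q) → Fin N → Bool
      stays a v = onPair (stays₃ v) a

    run : CircleMap (W ℕ.* Q ℕ.* N)
    run = record
      { fun = onPair move ; carry = λ _ → 0 ; good = onPair stays ; preserve = pres ; increasing = incr }
      where
      pres : ∀ f → ∑ (allFin (W ℕ.* Q ℕ.* N)) (f ∘ onPair move) ≡ ∑ (allFin (W ℕ.* Q ℕ.* N)) f
      pres f = begin
        ∑ (allFin (W ℕ.* Q ℕ.* N)) (f ∘ onPair move)
          ≡⟨ trans (∑-combine (W ℕ.* Q) N (f ∘ onPair move)) (∑-combine W Q _) ⟩
        (∑[ w ∈ allFin W ] ∑[ q ∈ allFin Q ] ∑[ v ∈ allFin N ] f (onPair move (combine (combine w q) v)))
          ≡⟨ ∑-cong (allFin W) (λ w → ∑-cong (allFin Q) λ q → ∑-cong (allFin N) λ v → cong f (trans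
               (onPair-combine move (combine w q) v) (onPair-combine (move₃ v) w q))) ⟩
        (∑[ w ∈ allFin W ] ∑[ q ∈ allFin Q ] ∑[ v ∈ allFin N ] f (combine (combine w (q ⊕ carry (φ w) v)) (fun (φ w) v)))
          ≡⟨ ∑-cong (allFin W) (λ w → begin
               (∑[ q ∈ allFin Q ] ∑[ v ∈ allFin N ] f (combine (combine w (q ⊕ carry (φ w) v)) (fun (φ w) v)))
                 ≡⟨ ∑-swap (allFin Q) (allFin N) _ ⟩
               (∑[ v ∈ allFin N ] ∑[ q ∈ allFin Q ] f (combine (combine w (q ⊕ carry (φ w) v)) (fun (φ w) v)))
                 ≡⟨ ∑-cong (allFin N) (λ v → ∑-shift (λ q → f (combine (combine w q) (fun (φ w) v))) (carry (φ w) v)) ⟩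
               (∑[ v ∈ allFin N ] ∑[ q ∈ allFin Q ] f (combine (combine w q) (fun (φ w) v)))
                 ≡⟨ ∑-swap (allFin N) (allFin Q) _ ⟩
               (∑[ q ∈ allFin Q ] ∑[ v ∈ allFin N ] f (combine (combine w q) (fun (φ w) v)))
                 ≡⟨ ∑-cong (allFin Q) (λ q → preserve (φ w) (λ v → f (combine (combine w q) v))) ⟩
               (∑[ q ∈ allFin Q ] ∑[ v ∈ allFin N ] f (combine (combine w q) v)) ∎) ⟩
        (∑[ w ∈ allFin W ] ∑[ q ∈ allFin Q ] ∑[ v ∈ allFin N ] f (combine (combine w q) v))
          ≡⟨ ∑-combine W Q (λ a → ∑[ v ∈ allFin N ] f (combine a v)) ⟨
        (∑[ a ∈ allFin (W ℕ.* Q) ] ∑[ v ∈ allFin N ] f (combine a v))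
          ≡⟨ ∑-combine (W ℕ.* Q) N f ⟨
        ∑ (allFin (W ℕ.* Q ℕ.* N)) f ∎
        where open ≡-Reasoning

      position : ∀ (w : Fin W) (q : Fin Q) (v : Fin N) j → toℕ (combine (combine w q) v) ℕ.+ W ℕ.* Q ℕ.* N ℕ.* j
                 ≡ (toℕ v ℕ.+ N ℕ.* toℕ q) ℕ.+ (Q ℕ.* N) ℕ.* (toℕ w ℕ.+ W ℕ.* j)
      position w q v j = trans (cong (ℕ._+ W ℕ.* Q ℕ.* N ℕ.* j) (trans (FP.toℕ-combine (combine w q) v)
          (cong (λ z → N ℕ.* z ℕ.+ toℕ v) (FP.toℕ-combine w q)))) (alg N Q W (toℕ w) (toℕ q) (toℕ v) j)
        where
        alg : ∀ N Q W w q v j → N ℕ.* (Q ℕ.* w ℕ.+ q) ℕ.+ v ℕ.+ W ℕ.* Q ℕ.* N ℕ.* j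
                              ≡ (v ℕ.+ N ℕ.* q) ℕ.+ (Q ℕ.* N) ℕ.* (w ℕ.+ W ℕ.* j)
        alg = ℕR.solve-∀

      inner< : ∀ (v : Fin N) {q} → q ℕ.< Q → toℕ v ℕ.+ N ℕ.* q ℕ.< Q ℕ.* N
      inner< v {q} q<Q = begin-strict
        toℕ v ℕ.+ N ℕ.* q   <⟨ ℕP.+-monoˡ-< (N ℕ.* q) (FP.toℕ<n v) ⟩
        N ℕ.+ N ℕ.* q       ≡⟨ ℕP.*-suc N q ⟨
        N ℕ.* suc q         ≤⟨ ℕP.*-monoʳ-≤ N q<Q ⟩
        N ℕ.* Q             ≡⟨ ℕP.*-comm N Q ⟩
        Q ℕ.* N             ∎
        where open ℕP.≤-Reasoning

      stay : ∀ w q v → T (does (toℕ q ℕ.+ carry (φ w) v ℕ.<? Q)) → toℕ (q ⊕ carry (φ w) v) ≡ toℕ q ℕ.+ carry (φ w) v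
      stay w q v t = trans (toℕ-mod _) (DM.m<n⇒m%n≡m (ℕP.<ᵇ⇒< _ _ t))

      incr : ∀ x y j k → T (onPair stays x) → T (onPair stays y) →
             toℕ x ℕ.+ W ℕ.* Q ℕ.* N ℕ.* j ℕ.< toℕ y ℕ.+ W ℕ.* Q ℕ.* N ℕ.* k →
             toℕ (onPair move x) ℕ.+ W ℕ.* Q ℕ.* N ℕ.* j ℕ.< toℕ (onPair move y) ℕ.+ W ℕ.* Q ℕ.* N ℕ.* k
      incr x y j k gx gy lt
        with a , v , refl ← FP.combine-surjective {W ℕ.* Q} {N} x | b , u , refl ← FP.combine-surjective {W ℕ.* Q} {N} y
        with w , q , refl ← FP.combine-surjective {W} {Q} a | w′ , q′ , refl ← FP.combine-surjective {W} {Q} b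
        rewrite onPair-combine move (combine w q) v | onPair-combine move (combine w′ q′) u
              | onPair-combine (move₃ v) w q | onPair-combine (move₃ u) w′ q′
              | onPair-combine stays (combine w q) v | onPair-combine stays (combine w′ q′) u
              | onPair-combine (stays₃ v) w q | onPair-combine (stays₃ u) w′ q′
        = subst₂ ℕ._<_ (sym (position w (q ⊕ c) (fun (φ w) v) j)) (sym (position w′ (q′ ⊕ c′) (fun (φ w′) u) k))
            (go (lex-elim (Q ℕ.* N) (inner< u (FP.toℕ<n q′)) (subst₂ ℕ._<_ (position w q v j) (position w′ q′ u k) lt)))
        where
        c = carry (φ w) v
        c′ = carry (φ w′) u
        go : toℕ w ℕ.+ W ℕ.* j ℕ.< toℕ w′ ℕ.+ W ℕ.* k ⊎
             (toℕ w ℕ.+ W ℕ.* j ≡ toℕ w′ ℕ.+ W ℕ.* k × toℕ v ℕ.+ N ℕ.* toℕ q ℕ.< toℕ u ℕ.+ N ℕ.* toℕ q′) →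
             toℕ (fun (φ w) v) ℕ.+ N ℕ.* toℕ (q ⊕ c) ℕ.+ Q ℕ.* N ℕ.* (toℕ w ℕ.+ W ℕ.* j)
             ℕ.< toℕ (fun (φ w′) u) ℕ.+ N ℕ.* toℕ (q′ ⊕ c′) ℕ.+ Q ℕ.* N ℕ.* (toℕ w′ ℕ.+ W ℕ.* k)
        go (inj₁ runs<) = lex-< (Q ℕ.* N) (inner< (fun (φ w) v) (FP.toℕ<n (q ⊕ c))) runs<
        -- The run index on the line, taken modulo W, is the run itself, so both points are moved by
        -- the same map.
        go (inj₂ (run≡ , inner)) with FP.toℕ-injective {i = w} {j = w′} same
          where
          same : toℕ w ≡ toℕ w′
          instance
            W≢0 : NonZero W
            W≢0 = FP.nonZeroIndex w
          mod-W : ∀ (w : Fin W) j → (toℕ w ℕ.+ W ℕ.* j) % W ≡ toℕ w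
          mod-W w j = trans (cong (λ z → (toℕ w ℕ.+ z) % W) (ℕP.*-comm W j))
            (trans (DM.[m+kn]%n≡m%n (toℕ w) j W) (DM.m<n⇒m%n≡m (FP.toℕ<n w)))
          same = trans (sym (mod-W w j)) (trans (cong (_% W) run≡) (mod-W w′ k))
        ... | refl = subst (λ z → toℕ (fun (φ w) v) ℕ.+ N ℕ.* toℕ (q ⊕ c) ℕ.+ Q ℕ.* N ℕ.* z
                                ℕ.< toℕ (fun (φ w) u) ℕ.+ N ℕ.* toℕ (q′ ⊕ c′) ℕ.+ Q ℕ.* N ℕ.* (toℕ w ℕ.+ W ℕ.* k)) (sym run≡)
            (ℕP.+-monoˡ-< (Q ℕ.* N ℕ.* (toℕ w ℕ.+ W ℕ.* k)) (subst₂ (λ s t → toℕ (fun (φ w) v) ℕ.+ N ℕ.* s ℕ.< toℕ (fun (φ w) u) ℕ.+ N ℕ.* t)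
              (sym (trans (stay w q v (T-∧ʳ {good (φ w) v} gx)) (ℕP.+-comm (toℕ q) c)))
              (sym (trans (stay w q′ u (T-∧ʳ {good (φ w) u} gy)) (ℕP.+-comm (toℕ q′) c′)))
              (increasing (φ w) v u (toℕ q) (toℕ q′) (T-∧ˡ gx) (T-∧ˡ gy) inner)))

    run-combine : ∀ w q v → fun run (combine (combine w q) v) ≡ combine (combine w (q ⊕ carry (φ w) v)) (fun (φ w) v)
    run-combine w q v = trans (onPair-combine move (combine w q) v) (onPair-combine (move₃ v) w q)

    private
      exits : ℕ → ℤ
      exits k = ind (not (does (k ℕ.<? Q)))

      -- A shift by c pushes c of the Q sheets out of the run; each unit of c adds at most one exit.
      ∑-exits : ∀ c → (∑[ q ∈ allFin Q ] exits (toℕ q ℕ.+ c)) ≤ + c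
      ∑-exits zero = ℤP.≤-reflexive (trans (∑-cong (allFin Q) λ q → cong (λ b → ind (not b))
        (dec-true (toℕ q ℕ.+ 0 ℕ.<? Q) (subst (ℕ._< Q) (sym (ℕP.+-identityʳ (toℕ q))) (FP.toℕ<n q)))) (∑-0 (allFin Q)))
      ∑-exits (suc c) = begin
        (∑[ q ∈ allFin Q ] exits (toℕ q ℕ.+ suc c))
          ≤⟨ ≤-by (exits c) (0≤ind _) refl ⟩
        (∑[ q ∈ allFin Q ] exits (toℕ q ℕ.+ suc c)) + exits c
          ≡⟨ ∑-telescope Q exits c ⟩
        (∑[ q ∈ allFin Q ] exits (toℕ q ℕ.+ c)) + exits (Q ℕ.+ c)
          ≤⟨ ℤP.+-mono-≤ (∑-exits c) (ind≤1 _) ⟩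
        + c + 1ℤ
          ≡⟨ ℤP.+-comm (+ c) 1ℤ ⟩
        + suc c ∎
        where open ℤP.≤-Reasoning

    -- A bad point of φ w is repeated on Q sheets, and any point leaves its run from at most C of
    -- them.
    badness-run : ∀ C → (∀ w v → carry (φ w) v ℕ.≤ C) →
      badness run ≤ + Q * (∑[ w ∈ allFin W ] badness (φ w)) + + W * (+ N * + C)
    badness-run C carry≤C = begin
      badness run
        ≡⟨ trans (∑-combine (W ℕ.* Q) N _) (∑-combine W Q _) ⟩
      (∑[ w ∈ allFin W ] ∑[ q ∈ allFin Q ] ∑[ v ∈ allFin N ] ind (not (good run (combine (combine w q) v))))
        ≤⟨ ∑-mono (allFin W) (λ w → ∑-mono (allFin Q) λ q → ∑-mono (allFin N) λ v → subst
             (λ b → ind (not b) ≤ exits (toℕ q ℕ.+ carry (φ w) v) + ind (not (good (φ w) v)))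
             (sym (trans (onPair-combine stays (combine w q) v) (onPair-combine (stays₃ v) w q)))
             (ind-not-∧ (good (φ w) v) _)) ⟩
      (∑[ w ∈ allFin W ] ∑[ q ∈ allFin Q ] ∑[ v ∈ allFin N ] (exits (toℕ q ℕ.+ carry (φ w) v) + ind (not (good (φ w) v))))
        ≡⟨ ∑-cong (allFin W) (λ w → trans (∑-swap (allFin Q) (allFin N) _) (trans (∑-cong (allFin N) λ v →
             trans (∑-⊕ (allFin Q) _ _) (cong (λ z → (∑[ q ∈ allFin Q ] exits (toℕ q ℕ.+ carry (φ w) v)) + z)
               (trans (∑ℤ-const (allFin Q) _) (cong (λ n → + n * ind (not (good (φ w) v))) (length-allFin Q)))))
             (∑-⊕ (allFin N) _ _))) ⟩
      (∑[ w ∈ allFin W ] ((∑[ v ∈ allFin N ] ∑[ q ∈ allFin Q ] exits (toℕ q ℕ.+ carry (φ w) v))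
                        + (∑[ v ∈ allFin N ] (+ Q * ind (not (good (φ w) v))))))
        ≤⟨ ∑-mono (allFin W) (λ w → ℤP.+-mono-≤ (∑-mono (allFin N) λ v → ℤP.≤-trans (∑-exits (carry (φ w) v)) (+≤+ (carry≤C w v)))
             (ℤP.≤-reflexive (∑-⊗ (allFin N) (+ Q) _))) ⟩
      (∑[ w ∈ allFin W ] ((∑[ v ∈ allFin N ] + C) + + Q * badness (φ w)))
        ≡⟨ trans (∑-⊕ (allFin W) _ _) (trans (cong₂ _+_
             (trans (∑-cong (allFin W) λ w → trans (∑ℤ-const (allFin N) (+ C)) (cong (λ n → + n * + C) (length-allFin N)))
               (trans (∑ℤ-const (allFin W) _) (cong (λ n → + n * (+ N * + C)) (length-allFin W))))
             (∑-⊗ (allFin W) (+ Q) _)) (ℤP.+-comm (+ W * (+ N * + C)) _)) ⟩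
      + Q * (∑[ w ∈ allFin W ] badness (φ w)) + + W * (+ N * + C) ∎
      where open ℤP.≤-Reasoning

  -- Sum operators, clouds and the zig-zag product

  sumOp : ∀ {D N} → (Fin D → CircleMap N) → (Fin N → ℤ) → Fin N → ℤ
  sumOp {D} φ f x = ∑[ i ∈ allFin D ] f (fun (φ i) x)

  ‖‖²-preserve : ∀ {N} (φ : CircleMap N) f → ‖ f ∘ fun φ ‖² ≡ ‖ f ‖²
  ‖‖²-preserve φ f = preserve φ (λ x → f x * f x)

  ‖sumOp‖²≤ : ∀ {D N} (φ : Fin D → CircleMap N) f → ‖ sumOp φ f ‖² ≤ (+ D * + D) * ‖ f ‖²
  ‖sumOp‖²≤ {D} {N} φ f = begin
    ‖ sumOp φ f ‖²
      ≤⟨ ∑-mono (allFin N) (λ x → ∑²≤ (allFin D) (λ i → f (fun (φ i) x))) ⟩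
    (∑[ x ∈ allFin N ] (+ length (allFin D) * (∑[ i ∈ allFin D ] (f (fun (φ i) x) * f (fun (φ i) x)))))
      ≡⟨ trans (∑-⊗ (allFin N) (+ length (allFin D)) _) (cong₂ (λ n s → + n * s) (length-allFin D) (∑-swap (allFin N) (allFin D) _)) ⟩
    + D * (∑[ i ∈ allFin D ] ‖ f ∘ fun (φ i) ‖²)
      ≡⟨ cong (+ D *_) (trans (∑-cong (allFin D) λ i → ‖‖²-preserve (φ i) f)
           (trans (∑ℤ-const (allFin D) ‖ f ‖²) (cong (λ n → + n * ‖ f ‖²) (length-allFin D)))) ⟩
    + D * (+ D * ‖ f ‖²)
      ≡⟨ ℤP.*-assoc (+ D) (+ D) ‖ f ‖² ⟨
    (+ D * + D) * ‖ f ‖² ∎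
    where open ℤP.≤-Reasoning

  ∑-sumOp : ∀ {D N} (φ : Fin D → CircleMap N) f → ∑ (allFin N) (sumOp φ f) ≡ + D * ∑ (allFin N) f
  ∑-sumOp {D} {N} φ f = trans (∑-swap (allFin N) (allFin D) _) (trans (∑-cong (allFin D) λ i → preserve (φ i) f)
    (trans (∑ℤ-const (allFin D) _) (cong (λ n → + n * ∑ (allFin N) f) (length-allFin D))))

  sumOp-cong : ∀ {D N} (φ : Fin D → CircleMap N) {f g} → (∀ x → f x ≡ g x) → ∀ x → sumOp φ f x ≡ sumOp φ g x
  sumOp-cong {D} φ f≡g x = ∑-cong (allFin D) λ i → f≡g (fun (φ i) x)

  sumOp-linear : ∀ {D N} (φ : Fin D → CircleMap N) a f b g x →
                 sumOp φ (λ y → a * f y + b * g y) x ≡ a * sumOp φ f x + b * sumOp φ g x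
  sumOp-linear {D} φ a f b g x = trans (∑-⊕ (allFin D) _ _) (cong₂ _+_ (∑-⊗ (allFin D) a _) (∑-⊗ (allFin D) b _))

  ‖‖²-scale : ∀ {N} c (f : Fin N → ℤ) → ‖ (λ x → c * f x) ‖² ≡ (c * c) * ‖ f ‖²
  ‖‖²-scale {N} c f = trans (∑-cong (allFin N) λ x → alg c (f x)) (∑-⊗ (allFin N) (c * c) _)
    where
    alg : ∀ c y → (c * y) * (c * y) ≡ (c * c) * (y * y)
    alg = ℤR.solve-∀

  ‖‖²-3 : ∀ {N} (f g h : Fin N → ℤ) → ‖ (λ x → f x + (g x + h x)) ‖² ≤ + 3 * (‖ f ‖² + (‖ g ‖² + ‖ h ‖²))
  ‖‖²-3 {N} f g h = begin
    ‖ (λ x → f x + (g x + h x)) ‖²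
      ≤⟨ ∑-mono (allFin N) (λ x → ≤-by (defect (f x) (g x) (h x)) (0≤defect (f x) (g x) (h x)) (alg (f x) (g x) (h x))) ⟩
    (∑[ x ∈ allFin N ] (+ 3 * (f x * f x + (g x * g x + h x * h x))))
      ≡⟨ trans (∑-⊗ (allFin N) (+ 3) _) (cong (+ 3 *_) (∑-3 (allFin N) _ _ _)) ⟩
    + 3 * (‖ f ‖² + (‖ g ‖² + ‖ h ‖²)) ∎
    where
    open ℤP.≤-Reasoning
    defect : ℤ → ℤ → ℤ → ℤ
    defect a b c = (a - b) * (a - b) + ((b - c) * (b - c) + (a - c) * (a - c))
    0≤defect : ∀ a b c → 0ℤ ≤ defect a b c
    0≤defect a b c = 0≤+-mono (0≤x*x (a - b)) (0≤+-mono (0≤x*x (b - c)) (0≤x*x (a - c)))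
    alg : ∀ a b c → + 3 * (a * a + (b * b + c * c))
                  ≡ (a + (b + c)) * (a + (b + c)) + ((a - b) * (a - b) + ((b - c) * (b - c) + (a - c) * (a - c)))
    alg = ℤR.solve-∀

  module Cloud (K N : ℕ) where

    cloud : (Fin (K ℕ.* N) → ℤ) → Fin N → ℤ
    cloud f v = ∑[ a ∈ allFin K ] f (combine a v)

    pull : (Fin N → ℤ) → Fin (K ℕ.* N) → ℤ
    pull F = onPair {m = K} λ a v → F v

    -- K times the projection of f off the functions that are constant on clouds; the factor keeps
    -- it integral.
    residue : (Fin (K ℕ.* N) → ℤ) → Fin (K ℕ.* N) → ℤ
    residue f x = + K * f x + (- 1ℤ) * pull (cloud f) x

    pull-combine : ∀ F a v → pull F (combine a v) ≡ F v
    pull-combine F = onPair-combine _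

    split : ∀ f x → + K * f x ≡ 1ℤ * pull (cloud f) x + 1ℤ * residue f x
    split f x = alg (+ K * f x) (pull (cloud f) x)
      where
      alg : ∀ y p → y ≡ 1ℤ * p + 1ℤ * (y + (- 1ℤ) * p)
      alg = ℤR.solve-∀

    ∑-cloud : ∀ f → ∑ (allFin N) (cloud f) ≡ ∑ (allFin (K ℕ.* N)) f
    ∑-cloud f = trans (∑-swap (allFin N) (allFin K) _) (sym (∑-combine K N f))

    ‖pull‖² : ∀ F → ‖ pull F ‖² ≡ + K * ‖ F ‖²
    ‖pull‖² F = trans (∑-combine K N _) (trans
      (∑-cong (allFin K) λ a → ∑-cong (allFin N) λ v → cong₂ _*_ (pull-combine F a v) (pull-combine F a v))
      (trans (∑ℤ-const (allFin K) ‖ F ‖²) (cong (λ n → + n * ‖ F ‖²) (length-allFin K))))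

    cloud-residue : ∀ f v → cloud (residue f) v ≡ 0ℤ
    cloud-residue f v = begin
      (∑[ a ∈ allFin K ] (+ K * f (combine a v) + (- 1ℤ) * pull (cloud f) (combine a v)))
        ≡⟨ trans (∑-⊕ (allFin K) _ _) (cong₂ _+_ (∑-⊗ (allFin K) (+ K) _) (trans (∑-⊗ (allFin K) (- 1ℤ) _) (cong ((- 1ℤ) *_)
             (trans (∑-cong (allFin K) λ a → pull-combine (cloud f) a v)
               (trans (∑ℤ-const (allFin K) (cloud f v)) (cong (λ n → + n * cloud f v) (length-allFin K))))))) ⟩
      + K * cloud f v + (- 1ℤ) * (+ K * cloud f v)
        ≡⟨ alg (+ K * cloud f v) ⟩
      0ℤ ∎
      where
      open ≡-Reasoning
      alg : ∀ y → y + (- 1ℤ) * y ≡ 0ℤ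
      alg = ℤR.solve-∀

    ⟨∣pull⟩ : ∀ f F → ⟨ f ∣ pull F ⟩ ≡ ⟨ cloud f ∣ F ⟩
    ⟨∣pull⟩ f F = trans (∑-combine K N _) (trans (∑-swap (allFin K) (allFin N) _) (∑-cong (allFin N) λ v →
      trans (∑-cong (allFin K) λ a → cong (f (combine a v) *_) (pull-combine F a v)) (∑-⊗ʳ (allFin K) (F v) _)))

    -- Pythagoras for the splitting of K f into its cloud-constant part and the residue.
    ‖residue‖² : ∀ f → ‖ residue f ‖² ≡ (+ K * + K) * ‖ f ‖² + - (+ K * ‖ cloud f ‖²)
    ‖residue‖² f = begin
      ‖ residue f ‖²
        ≡⟨ ∑-cong (allFin (K ℕ.* N)) (λ x → alg (+ K) (f x) (pull (cloud f) x)) ⟩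
      (∑[ x ∈ allFin (K ℕ.* N) ] ((+ K * + K) * (f x * f x) + ((- + 2 * + K) * (f x * pull (cloud f) x)
                                + pull (cloud f) x * pull (cloud f) x)))
        ≡⟨ trans (∑-3 (allFin (K ℕ.* N)) _ _ _) (cong₂ _+_ (∑-⊗ (allFin (K ℕ.* N)) (+ K * + K) _)
             (cong₂ _+_ (trans (∑-⊗ (allFin (K ℕ.* N)) (- + 2 * + K) _) (cong ((- + 2 * + K) *_) (⟨∣pull⟩ f (cloud f))))
                        (‖pull‖² (cloud f)))) ⟩
      (+ K * + K) * ‖ f ‖² + ((- + 2 * + K) * ‖ cloud f ‖² + + K * ‖ cloud f ‖²)
        ≡⟨ alg′ (+ K) ‖ f ‖² ‖ cloud f ‖² ⟩
      (+ K * + K) * ‖ f ‖² + - (+ K * ‖ cloud f ‖²) ∎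
      where
      open ≡-Reasoning
      alg : ∀ k y p → (k * y + (- 1ℤ) * p) * (k * y + (- 1ℤ) * p) ≡ (k * k) * (y * y) + ((- + 2 * k) * (y * p) + p * p)
      alg = ℤR.solve-∀
      alg′ : ∀ k s c → (k * k) * s + ((- + 2 * k) * c + k * c) ≡ (k * k) * s + - (k * c)
      alg′ = ℤR.solve-∀

  -- The averaging operator shrinks functions of sum zero to half their norm; squares and the factor
  -- D² keep the statement integral.
  SpectralGap : ∀ {D N} → (Fin D → CircleMap N) → Set
  SpectralGap {D} {N} φ = ∀ f → ∑ (allFin N) f ≡ 0ℤ → + 4 * ‖ sumOp φ f ‖² ≤ (+ D * + D) * ‖ f ‖²

  module ZigZag {D N : ℕ} (φ : Fin D → CircleMap N) (gap : SpectralGap φ)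
                (Q : ℕ) .{{_ : NonZero Q}} .{{_ : NonZero (D ℕ.* D ℕ.* Q)}} {m : ℕ} (s : Fin m → ℕ) where

    K : ℕ
    K = D ℕ.* D ℕ.* Q

    open Rotation K using (conv; _⊕_)
    open Cloud K N

    words : Fin (D ℕ.* D) → CircleMap N
    words = onPair λ i j → φ i ⊚ φ j

    R : CircleMap (K ℕ.* N)
    R = Run.run (D ℕ.* D) Q words

    H : Fin m → CircleMap (K ℕ.* N)
    H κ = Shift.shift K N (s κ)

    zigzag : Fin (m ℕ.* m) → CircleMap (K ℕ.* N)
    zigzag = onPair λ κ κ′ → H κ′ ⊚ R ⊚ H κ

    sumOp-zigzag : ∀ f x → sumOp zigzag f x ≡ sumOp H (sumOp H f ∘ fun R) x
    sumOp-zigzag f x = trans (∑-combine m m _) (∑-cong (allFin m) λ κ → ∑-cong (allFin m) λ κ′ →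
      cong (λ ψ → f (fun ψ x)) (onPair-combine (λ κ κ′ → H κ′ ⊚ R ⊚ H κ) κ κ′))

    H-combine : ∀ g a v → sumOp H g (combine a v) ≡ conv (allFin m) s (λ b → g (combine b v)) a
    H-combine g a v = ∑-cong (allFin m) λ κ → cong g (Shift.shift-combine K N (s κ) a v)

    H-pull : ∀ F x → sumOp H (pull F) x ≡ + m * pull F x
    H-pull F x with FP.combine-surjective {K} {N} x
    ... | a , v , refl = begin
      sumOp H (pull F) (combine a v)                       ≡⟨ H-combine (pull F) a v ⟩
      (∑[ κ ∈ allFin m ] pull F (combine (a ⊕ s κ) v))
        ≡⟨ ∑-cong (allFin m) (λ κ → trans (pull-combine F (a ⊕ s κ) v) (sym (pull-combine F a v))) ⟩
      (∑[ κ ∈ allFin m ] pull F (combine a v))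
        ≡⟨ trans (∑ℤ-const (allFin m) _) (cong (λ n → + n * pull F (combine a v)) (length-allFin m)) ⟩
      + m * pull F (combine a v) ∎
      where open ≡-Reasoning

    -- For a function constant on clouds the label reached by R is irrelevant, and each of the D²
    -- words is met on Q labels: R acts as Q times the square of the old operator.
    cloud-R : ∀ F v → cloud (pull F ∘ fun R) v ≡ + Q * sumOp φ (sumOp φ F) v
    cloud-R F v = begin
      (∑[ a ∈ allFin K ] pull F (fun R (combine a v)))
        ≡⟨ ∑-combine (D ℕ.* D) Q _ ⟩
      (∑[ w ∈ allFin (D ℕ.* D) ] ∑[ q ∈ allFin Q ] pull F (fun R (combine (combine w q) v)))
        ≡⟨ ∑-cong (allFin (D ℕ.* D)) (λ w → trans (∑-cong (allFin Q) λ q →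
             trans (cong (pull F) (Run.run-combine (D ℕ.* D) Q words w q v)) (pull-combine F _ (fun (words w) v)))
             (trans (∑ℤ-const (allFin Q) _) (cong (λ n → + n * F (fun (words w) v)) (length-allFin Q)))) ⟩
      (∑[ w ∈ allFin (D ℕ.* D) ] (+ Q * F (fun (words w) v)))
        ≡⟨ trans (∑-⊗ (allFin (D ℕ.* D)) (+ Q) _) (cong (+ Q *_) (trans (∑-combine D D _)
             (trans (∑-cong (allFin D) λ i → ∑-cong (allFin D) λ j → cong (λ ψ → F (fun ψ v)) (onPair-combine (λ i j → φ i ⊚ φ j) i j))
               (∑-swap (allFin D) (allFin D) _)))) ⟩
      + Q * sumOp φ (sumOp φ F) v ∎
      where open ≡-Reasoning

    gap² : ∀ F → ∑ (allFin N) F ≡ 0ℤ → + 16 * ‖ sumOp φ (sumOp φ F) ‖² ≤ ((+ D * + D) * (+ D * + D)) * ‖ F ‖²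
    gap² F ∑F≡0 = begin
      + 16 * ‖ sumOp φ (sumOp φ F) ‖²
        ≡⟨ ℤP.*-assoc (+ 4) (+ 4) _ ⟩
      + 4 * (+ 4 * ‖ sumOp φ (sumOp φ F) ‖²)
        ≤⟨ *-mono-0≤ (0≤+ 4) (gap (sumOp φ F) (trans (∑-sumOp φ F) (trans (cong (+ D *_) ∑F≡0) (ℤP.*-zeroʳ (+ D))))) ⟩
      + 4 * ((+ D * + D) * ‖ sumOp φ F ‖²)
        ≡⟨ alg (+ D * + D) ‖ sumOp φ F ‖² ⟩
      (+ D * + D) * (+ 4 * ‖ sumOp φ F ‖²)
        ≤⟨ *-mono-0≤ (0≤x*x (+ D)) (gap F ∑F≡0) ⟩
      (+ D * + D) * ((+ D * + D) * ‖ F ‖²)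
        ≡⟨ ℤP.*-assoc (+ D * + D) (+ D * + D) ‖ F ‖² ⟨
      ((+ D * + D) * (+ D * + D)) * ‖ F ‖² ∎
      where
      open ℤP.≤-Reasoning
      alg : ∀ d y → + 4 * (d * y) ≡ d * (+ 4 * y)
      alg = ℤR.solve-∀

    module _ (mixing : ∀ g → ∑ (allFin K) g ≡ 0ℤ → + 64 * ‖ conv (allFin m) s g ‖² ≤ (+ m * + m) * ‖ g ‖²) where

      -- Shifts move labels only, so the mixing of ℤ/K applies on each cloud separately, where g
      -- sums to zero.
      H-mixing : ∀ g → (∀ v → cloud g v ≡ 0ℤ) → + 64 * ‖ sumOp H g ‖² ≤ (+ m * + m) * ‖ g ‖²
      H-mixing g g≡0 = begin
        + 64 * ‖ sumOp H g ‖²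
          ≡⟨ cong (+ 64 *_) (trans (∑-combine K N _) (trans (∑-cong (allFin K) λ a → ∑-cong (allFin N) λ v →
               cong₂ _*_ (H-combine g a v) (H-combine g a v)) (∑-swap (allFin K) (allFin N) _))) ⟩
        + 64 * (∑[ v ∈ allFin N ] ‖ conv (allFin m) s (λ (b : Fin K) → g (combine b v)) ‖²)
          ≡⟨ ∑-⊗ (allFin N) (+ 64) _ ⟨
        (∑[ v ∈ allFin N ] (+ 64 * ‖ conv (allFin m) s (λ (b : Fin K) → g (combine b v)) ‖²))
          ≤⟨ ∑-mono (allFin N) (λ v → mixing (λ (b : Fin K) → g (combine b v)) (g≡0 v)) ⟩
        (∑[ v ∈ allFin N ] ((+ m * + m) * ‖ (λ (b : Fin K) → g (combine b v)) ‖²))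
          ≡⟨ trans (∑-⊗ (allFin N) (+ m * + m) _) (cong ((+ m * + m) *_)
               (trans (∑-swap (allFin N) (allFin K) _) (sym (∑-combine K N _)))) ⟩
        (+ m * + m) * ‖ g ‖² ∎
        where open ℤP.≤-Reasoning

      -- K² Z f = t₁ + t₂ + t₃: the part of f that is constant on clouds is contracted by the words or else made to vary
      -- on clouds and contracted by the shifts after them; the rest is contracted by the shifts before them.
      zigzag-gap : .{{_ : NonZero K}} → SpectralGap zigzag
      zigzag-gap f ∑f≡0 = *-cancel-≤ 16 (*-cancel-≤ K (*-cancel-≤ K (*-cancel-≤ K (*-cancel-≤ K (begin
        κ * (κ * (κ * (κ * (+ 16 * (+ 4 * ‖ Z ‖²)))))
          ≡⟨ alg₁ κ ‖ Z ‖² ⟩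
        + 64 * (((κ * κ) * (κ * κ)) * ‖ Z ‖²)
          ≡⟨ cong (+ 64 *_) (trans (sym (‖‖²-scale (κ * κ) Z)) (‖‖²-cong decomposition)) ⟩
        + 64 * ‖ (λ x → t₁ x + (t₂ x + t₃ x)) ‖²
          ≤⟨ *-mono-0≤ (0≤+ 64) (‖‖²-3 t₁ t₂ t₃) ⟩
        + 64 * (+ 3 * (‖ t₁ ‖² + (‖ t₂ ‖² + ‖ t₃ ‖²)))
          ≡⟨ alg₂ ‖ t₁ ‖² ‖ t₂ ‖² ‖ t₃ ‖² ⟩
        + 3 * (+ 64 * ‖ t₁ ‖² + (+ 64 * ‖ t₂ ‖² + + 64 * ‖ t₃ ‖²))
          ≤⟨ *-mono-0≤ (0≤+ 3) (ℤP.+-mono-≤ bound₁ (ℤP.+-mono-≤ bound₂ bound₃)) ⟩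
        + 3 * (+ 4 * ((M * M) * ((κ * κ) * P)) + ((M * M) * ((κ * κ) * P) + (M * M) * ((κ * κ) * (κ * κ * E + - P))))
          ≡⟨ alg₃ (M * M) (κ * κ) P E ⟩
        (+ 3 * ((M * M) * (κ * κ))) * (+ 4 * P + κ * κ * E)
          ≤⟨ *-mono-0≤ (0≤* (0≤+ 3) (0≤* (0≤x*x M) (0≤x*x κ))) (ℤP.+-monoˡ-≤ (κ * κ * E) (*-mono-0≤ (0≤+ 4) P≤)) ⟩
        (+ 3 * ((M * M) * (κ * κ))) * (+ 4 * (κ * κ * E) + κ * κ * E)
          -- The old gap, squared by words of two letters, costs 1/16 and the shifts cost 1/64: 3
          -- (1/16 + 1/64) = 15/64 is below the required 1/4. The last two terms share a single 1/64
          -- because their parts of f are orthogonal.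
          ≤⟨ ≤-by ((M * M) * ((κ * κ) * (κ * κ) * E)) (0≤* (0≤x*x M) (0≤* (0≤x*x (κ * κ)) (0≤‖‖² f))) (alg₄ (M * M) κ E) ⟩
        κ * (κ * (κ * (κ * (+ 16 * ((M * M) * E))))) ≡⟨ cong (λ z → κ * (κ * (κ * (κ * (+ 16 * ((z * z) * E)))))) (ℤP.pos-* m m) ⟨
        κ * (κ * (κ * (κ * (+ 16 * ((+ (m ℕ.* m) * + (m ℕ.* m)) * E))))) ∎)))))
        where
        open ℤP.≤-Reasoning
        κ μ M E P : ℤ
        κ = + K
        μ = + m
        M = μ * μ
        Z p g g′ t₁ t₂ t₃ : Fin (K ℕ.* N) → ℤ
        Z = sumOp zigzag f
        F G : Fin N → ℤ
        F = cloud f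
        g = residue f
        p = pull F ∘ fun R
        G = cloud p
        g′ = residue p
        E = ‖ f ‖²
        P = κ * ‖ F ‖²
        t₁ x = M * pull G x
        t₂ x = μ * sumOp H g′ x
        t₃ x = κ * sumOp H (sumOp H g ∘ fun R) x

        decomposition : ∀ x → (κ * κ) * Z x ≡ t₁ x + (t₂ x + t₃ x)
        decomposition x = begin-equality
          (κ * κ) * Z x
            ≡⟨ trans (ℤP.*-assoc κ κ (Z x)) (cong (λ z → κ * (κ * z)) (sumOp-zigzag f x)) ⟩
          κ * (κ * sumOp H (sumOp H f ∘ fun R) x)
            ≡⟨ cong (κ *_) (scale (sumOp H f ∘ fun R) x) ⟩
          κ * sumOp H (λ y → κ * sumOp H f (fun R y)) x
            ≡⟨ cong (κ *_) (sumOp-cong H (λ y → trans (scale f (fun R y)) (trans (sumOp-cong H (split f) (fun R y))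
                 (sumOp-linear H 1ℤ (pull F) 1ℤ g (fun R y)))) x) ⟩
          κ * sumOp H (λ y → 1ℤ * sumOp H (pull F) (fun R y) + 1ℤ * sumOp H g (fun R y)) x
            ≡⟨ cong (κ *_) (sumOp-cong H (λ y → cong (_+ 1ℤ * sumOp H g (fun R y)) (trans (ℤP.*-identityˡ _) (H-pull F (fun R y)))) x) ⟩
          κ * sumOp H (λ y → μ * p y + 1ℤ * sumOp H g (fun R y)) x
            ≡⟨ cong (κ *_) (sumOp-linear H μ p 1ℤ (sumOp H g ∘ fun R) x) ⟩
          κ * (μ * sumOp H p x + 1ℤ * sumOp H (sumOp H g ∘ fun R) x)
            ≡⟨ alg κ μ (sumOp H p x) (sumOp H (sumOp H g ∘ fun R) x) ⟩
          μ * (κ * sumOp H p x) + t₃ x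
            ≡⟨ cong (λ z → μ * z + t₃ x) (trans (scale p x) (trans (sumOp-cong H (split p) x) (sumOp-linear H 1ℤ (pull G) 1ℤ g′ x))) ⟩
          μ * (1ℤ * sumOp H (pull G) x + 1ℤ * sumOp H g′ x) + t₃ x
            ≡⟨ cong (λ z → μ * (1ℤ * z + 1ℤ * sumOp H g′ x) + t₃ x) (H-pull G x) ⟩
          μ * (1ℤ * (μ * pull G x) + 1ℤ * sumOp H g′ x) + t₃ x
            ≡⟨ alg′ μ (pull G x) (sumOp H g′ x) (t₃ x) ⟩
          t₁ x + (t₂ x + t₃ x) ∎
          where
          scale : ∀ h x → κ * sumOp H h x ≡ sumOp H (λ y → κ * h y) x
          scale h x = sym (∑-⊗ (allFin m) κ _)
          alg : ∀ κ μ a b → κ * (μ * a + 1ℤ * b) ≡ μ * (κ * a) + κ * b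
          alg = ℤR.solve-∀
          alg′ : ∀ μ a b t → μ * (1ℤ * (μ * a) + 1ℤ * b) + t ≡ (μ * μ) * a + (μ * b + t)
          alg′ = ℤR.solve-∀

        ‖p‖² : ‖ p ‖² ≡ P
        ‖p‖² = trans (‖‖²-preserve R (pull F)) (‖pull‖² F)

        P≤ : P ≤ κ * κ * E
        P≤ = ≤-by ‖ g ‖² (0≤‖‖² g) (trans (alg (κ * κ * E) P) (cong (ℤ._+_ P) (sym (‖residue‖² f))))
          where
          alg : ∀ e p → e ≡ p + (e + - p)
          alg = ℤR.solve-∀

        ∑F≡0 : ∑ (allFin N) F ≡ 0ℤ
        ∑F≡0 = trans (∑-cloud f) ∑f≡0

        bound₁ : + 64 * ‖ t₁ ‖² ≤ + 4 * ((M * M) * ((κ * κ) * P))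
        bound₁ = begin
          + 64 * ‖ t₁ ‖²
            ≡⟨ cong (+ 64 *_) (trans (‖‖²-scale M (pull G)) (cong ((M * M) *_) (trans (‖pull‖² G) (cong (κ *_)
                 (trans (‖‖²-cong (cloud-R F)) (‖‖²-scale (+ Q) (sumOp φ (sumOp φ F)))))))) ⟩
          + 64 * ((M * M) * (κ * ((+ Q * + Q) * ‖ sumOp φ (sumOp φ F) ‖²)))
            ≡⟨ alg (M * M) κ (+ Q * + Q) ‖ sumOp φ (sumOp φ F) ‖² ⟩
          (+ 4 * ((M * M) * (κ * (+ Q * + Q)))) * (+ 16 * ‖ sumOp φ (sumOp φ F) ‖²)
            ≤⟨ *-mono-0≤ (0≤* (0≤+ 4) (0≤* (0≤x*x M) (0≤* (0≤+ K) (0≤x*x (+ Q))))) (gap² F ∑F≡0) ⟩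
          (+ 4 * ((M * M) * (κ * (+ Q * + Q)))) * (((+ D * + D) * (+ D * + D)) * ‖ F ‖²)
            -- The D⁴ of the squared gap and the Q² of the runs make up exactly K².
            ≡⟨ alg′ (M * M) κ (+ Q) (+ D) ‖ F ‖² ⟩
          + 4 * ((M * M) * (((+ D * + D * + Q) * (+ D * + D * + Q)) * (κ * ‖ F ‖²)))
            ≡⟨ cong (λ z → + 4 * ((M * M) * ((z * z) * P))) (trans (ℤP.pos-* (D ℕ.* D) Q) (cong (_* + Q) (ℤP.pos-* D D))) ⟨
          + 4 * ((M * M) * ((κ * κ) * P)) ∎
          where
          alg : ∀ M κ q s → + 64 * (M * (κ * (q * s))) ≡ (+ 4 * (M * (κ * q))) * (+ 16 * s)
          alg = ℤR.solve-∀
          alg′ : ∀ M κ q d s → (+ 4 * (M * (κ * (q * q)))) * (((d * d) * (d * d)) * s)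
                             ≡ + 4 * (M * (((d * d * q) * (d * d * q)) * (κ * s)))
          alg′ = ℤR.solve-∀

        bound₂ : + 64 * ‖ t₂ ‖² ≤ (M * M) * ((κ * κ) * P)
        bound₂ = begin
          + 64 * ‖ t₂ ‖²                       ≡⟨ trans (cong (+ 64 *_) (‖‖²-scale μ (sumOp H g′))) (alg M ‖ sumOp H g′ ‖²) ⟩
          M * (+ 64 * ‖ sumOp H g′ ‖²)         ≤⟨ *-mono-0≤ (0≤x*x μ) (H-mixing g′ (cloud-residue p)) ⟩
          M * (M * ‖ g′ ‖²)                    ≡⟨ trans (sym (ℤP.*-assoc M M ‖ g′ ‖²)) (cong ((M * M) *_) (‖residue‖² p)) ⟩
          (M * M) * ((κ * κ) * ‖ p ‖² + - (κ * ‖ G ‖²))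
            ≤⟨ *-mono-0≤ (0≤x*x M) (≤-by (κ * ‖ G ‖²) (0≤* (0≤+ K) (0≤‖‖² G)) (alg′ ((κ * κ) * ‖ p ‖²) (κ * ‖ G ‖²))) ⟩
          (M * M) * ((κ * κ) * ‖ p ‖²)         ≡⟨ cong (λ z → (M * M) * ((κ * κ) * z)) ‖p‖² ⟩
          (M * M) * ((κ * κ) * P)              ∎
          where
          alg : ∀ M s → + 64 * (M * s) ≡ M * (+ 64 * s)
          alg = ℤR.solve-∀
          alg′ : ∀ a b → a ≡ (a + - b) + b
          alg′ = ℤR.solve-∀

        bound₃ : + 64 * ‖ t₃ ‖² ≤ (M * M) * ((κ * κ) * (κ * κ * E + - P))
        bound₃ = begin
          + 64 * ‖ t₃ ‖²
            ≡⟨ trans (cong (+ 64 *_) (‖‖²-scale κ (sumOp H (sumOp H g ∘ fun R)))) (alg (κ * κ) ‖ sumOp H (sumOp H g ∘ fun R) ‖²) ⟩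
          (+ 64 * (κ * κ)) * ‖ sumOp H (sumOp H g ∘ fun R) ‖²
            ≤⟨ *-mono-0≤ (0≤* (0≤+ 64) (0≤x*x κ)) (‖sumOp‖²≤ H (sumOp H g ∘ fun R)) ⟩
          (+ 64 * (κ * κ)) * (M * ‖ sumOp H g ∘ fun R ‖²)
            ≡⟨ cong (λ z → (+ 64 * (κ * κ)) * (M * z)) (‖‖²-preserve R (sumOp H g)) ⟩
          (+ 64 * (κ * κ)) * (M * ‖ sumOp H g ‖²)
            ≡⟨ alg′ (κ * κ) M ‖ sumOp H g ‖² ⟩
          (M * (κ * κ)) * (+ 64 * ‖ sumOp H g ‖²)
            ≤⟨ *-mono-0≤ (0≤* (0≤x*x μ) (0≤x*x κ)) (H-mixing g (cloud-residue f)) ⟩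
          (M * (κ * κ)) * (M * ‖ g ‖²)
            ≡⟨ trans (cong (λ z → (M * (κ * κ)) * (M * z)) (‖residue‖² f)) (alg″ M (κ * κ) _) ⟩
          (M * M) * ((κ * κ) * (κ * κ * E + - P)) ∎
          where
          alg : ∀ k s → + 64 * (k * s) ≡ (+ 64 * k) * s
          alg = ℤR.solve-∀
          alg′ : ∀ k M s → (+ 64 * k) * (M * s) ≡ (M * k) * (+ 64 * s)
          alg′ = ℤR.solve-∀
          alg″ : ∀ M k r → (M * k) * (M * r) ≡ (M * M) * (k * r)
          alg″ = ℤR.solve-∀

        alg₁ : ∀ κ z → κ * (κ * (κ * (κ * (+ 16 * (+ 4 * z))))) ≡ + 64 * (((κ * κ) * (κ * κ)) * z)
        alg₁ = ℤR.solve-∀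
        alg₂ : ∀ a b c → + 64 * (+ 3 * (a + (b + c))) ≡ + 3 * (+ 64 * a + (+ 64 * b + + 64 * c))
        alg₂ = ℤR.solve-∀
        alg₃ : ∀ M k P E → + 3 * (+ 4 * (M * (k * P)) + (M * (k * P) + M * (k * (k * E + - P))))
                         ≡ (+ 3 * (M * k)) * (+ 4 * P + k * E)
        alg₃ = ℤR.solve-∀
        alg₄ : ∀ M κ E → κ * (κ * (κ * (κ * (+ 16 * (M * E)))))
                       ≡ (+ 3 * (M * (κ * κ))) * (+ 4 * (κ * κ * E) + κ * κ * E) + M * ((κ * κ) * (κ * κ) * E)
        alg₄ = ℤR.solve-∀

  -- The tower and its parameters

  opaque
    pow2 : ℕ → ℕ
    pow2 n = 2 ℕ.^ n

    pow2-+ : ∀ a b → pow2 (a ℕ.+ b) ≡ pow2 a ℕ.* pow2 b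
    pow2-+ = ℕP.^-distribˡ-+-* 2

    pow2-mono : ∀ {a b} → a ℕ.≤ b → pow2 a ℕ.≤ pow2 b
    pow2-mono = ℕP.^-monoʳ-≤ 2

    pow2-2 : pow2 2 ≡ 4
    pow2-2 = refl

    pow2-3 : pow2 3 ≡ 8
    pow2-3 = refl

    pow2-6 : pow2 6 ≡ 64
    pow2-6 = refl

    pow2≢0 : ∀ n → NonZero (pow2 n)
    pow2≢0 n = ℕP.m^n≢0 2 n

    pow2-96 : pow2 96 ≡ 64 ℕ.^ 8 ℕ.* (8 ℕ.^ 8 ℕ.* 8 ℕ.^ 8)
    pow2-96 = refl

  -- β bounds the fraction of bad pairs (map, point) by 2^-β.
  record Tower (D N β : ℕ) : Set where
    field
      maps    : Fin D → CircleMap N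
      carry≤2 : ∀ i x → carry (maps i) x ℕ.≤ 2
      gap     : SpectralGap maps
      bad     : + pow2 β * (∑[ i ∈ allFin D ] badness (maps i)) ≤ + D * + N

  open Tower

  -- On one point a function of sum zero vanishes, so the gap is void. The bottom of the tower can
  -- thus have any degree.
  trivial : ∀ D β → Tower D 1 β
  trivial D β = record
    { maps = λ _ → identity 1
    ; carry≤2 = λ _ _ → z≤n
    ; gap = λ f ∑f≡0 → let f0≡0 = trans (sym (ℤP.+-identityʳ (f zero))) ∑f≡0 in
        subst (_≤ (+ D * + D) * ‖ f ‖²) (sym (vanish f f0≡0)) (0≤* (0≤x*x (+ D)) (0≤‖‖² f))
    ; bad = subst (_≤ + D * + 1) (sym (trans (cong (+ pow2 β *_) (∑-0 (allFin D))) (ℤP.*-zeroʳ (+ pow2 β))))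
        (0≤* (0≤+ D) (0≤+ 1))
    }
    where
    vanish : ∀ f → f zero ≡ 0ℤ → + 4 * ‖ sumOp {D} (λ _ → identity 1) f ‖² ≡ 0ℤ
    vanish f e = cong (+ 4 *_) (‖‖²-cong {1} {sumOp {D} (λ _ → identity 1) f} {λ _ → 0ℤ} λ { zero → trans (∑-cong (allFin D) λ _ → e) (∑-0 (allFin D)) })

  module Climb {D N β : ℕ} (tower : Tower D N (2 ℕ.+ β)) .{{_ : NonZero D}} where

    -- Words double the old fraction 2^-(2+β) of bad points, and carry at most 4 sheets, so the ends
    -- of runs spoil a fraction 4 / Q. With Q = 8 * 2^β both are 2^-(1+β), together 2^-β.
    Q K : ℕ
    Q = pow2 (3 ℕ.+ β)
    K = D ℕ.* D ℕ.* Q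

    instance
      Q≢0 : NonZero Q
      Q≢0 = pow2≢0 (3 ℕ.+ β)
      K≢0 : NonZero K
      K≢0 = ℕP.m*n≢0 (D ℕ.* D) Q {{ℕP.m*n≢0 D D}}

    module _ {m : ℕ} (k : Vec (Fin K) m)
             (mixing : ∀ g → ∑ (allFin K) g ≡ 0ℤ →
                + 64 * ‖ Rotation.conv K (allFin m) (RandomShifts.step K m k) g ‖² ≤ (+ m * + m) * ‖ g ‖²) where
     private
      φ = maps tower
      s : Fin m → ℕ
      s κ = toℕ (lookup k κ)
      module Z = ZigZag φ (gap tower) Q s
      b = ∑[ i ∈ allFin D ] badness (φ i)

      carry-words : ∀ w v → carry (Z.words w) v ℕ.≤ 4
      carry-words w v with FP.combine-surjective {D} {D} w
      ... | i , j , refl rewrite onPair-combine (λ i j → φ i ⊚ φ j) i j =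
        ℕP.+-mono-≤ (carry≤2 tower i (fun (φ j) v)) (carry≤2 tower j v)

      badness-words : (∑[ w ∈ allFin (D ℕ.* D) ] badness (Z.words w)) ≤ + 2 * (+ D * b)
      badness-words = begin
        (∑[ w ∈ allFin (D ℕ.* D) ] badness (Z.words w))
          ≡⟨ trans (∑-combine D D _) (∑-cong (allFin D) λ i → ∑-cong (allFin D) λ j → cong badness (onPair-combine (λ i j → φ i ⊚ φ j) i j)) ⟩
        (∑[ i ∈ allFin D ] ∑[ j ∈ allFin D ] badness (φ i ⊚ φ j))
          ≤⟨ ∑-mono (allFin D) (λ i → ∑-mono (allFin D) λ j → badness-⊚ (φ i) (φ j)) ⟩
        (∑[ i ∈ allFin D ] ∑[ j ∈ allFin D ] (badness (φ i) + badness (φ j)))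
          ≡⟨ trans (∑-cong (allFin D) λ i → trans (∑-⊕ (allFin D) _ _) (cong (_+ b) (trans (∑ℤ-const (allFin D) _)
               (cong (λ n → + n * badness (φ i)) (length-allFin D))))) (trans (∑-⊕ (allFin D) _ _) (cong₂ _+_ (∑-⊗ (allFin D) (+ D) _)
               (trans (∑ℤ-const (allFin D) b) (cong (λ n → + n * b) (length-allFin D))))) ⟩
        + D * b + + D * b
          ≡⟨ alg (+ D * b) ⟩
        + 2 * (+ D * b) ∎
        where
        open ℤP.≤-Reasoning
        alg : ∀ x → x + x ≡ + 2 * x
        alg = ℤR.solve-∀

      badness-R : badness Z.R ≤ + Q * (+ 2 * (+ D * b)) + + (D ℕ.* D) * (+ N * + 4)
      badness-R = ℤP.≤-trans (Run.badness-run (D ℕ.* D) Q Z.words 4 carry-words)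
        (ℤP.+-monoˡ-≤ (+ (D ℕ.* D) * (+ N * + 4)) (*-mono-0≤ (0≤+ Q) badness-words))

      badness-zigzag : (∑[ i ∈ allFin (m ℕ.* m) ] badness (Z.zigzag i)) ≤ + (m ℕ.* m) * badness Z.R
      badness-zigzag = begin
        (∑[ i ∈ allFin (m ℕ.* m) ] badness (Z.zigzag i))
          ≡⟨ trans (∑-combine m m _) (∑-cong (allFin m) λ κ → ∑-cong (allFin m) λ κ′ →
               cong badness (onPair-combine (λ κ κ′ → Z.H κ′ ⊚ Z.R ⊚ Z.H κ) κ κ′)) ⟩
        (∑[ κ ∈ allFin m ] ∑[ κ′ ∈ allFin m ] badness (Z.H κ′ ⊚ Z.R ⊚ Z.H κ))
          ≤⟨ ∑-mono (allFin m) (λ κ → ∑-mono (allFin m) λ κ′ → sandwich κ κ′) ⟩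
        (∑[ κ ∈ allFin m ] ∑[ κ′ ∈ allFin m ] badness Z.R)
          ≡⟨ trans (∑-cong (allFin m) λ _ → trans (∑ℤ-const (allFin m) _) (cong (λ n → + n * badness Z.R) (length-allFin m)))
               (trans (∑ℤ-const (allFin m) _) (cong (λ n → + n * (+ m * badness Z.R)) (length-allFin m))) ⟩
        + m * (+ m * badness Z.R)
          ≡⟨ trans (sym (ℤP.*-assoc (+ m) (+ m) _)) (cong (_* badness Z.R) (sym (ℤP.pos-* m m))) ⟩
        + (m ℕ.* m) * badness Z.R ∎
        where
        open ℤP.≤-Reasoning
        sandwich : ∀ κ κ′ → badness (Z.H κ′ ⊚ Z.R ⊚ Z.H κ) ≤ badness Z.R
        sandwich κ κ′ = begin
          badness (Z.H κ′ ⊚ Z.R ⊚ Z.H κ)                     ≤⟨ badness-⊚ (Z.H κ′) (Z.R ⊚ Z.H κ) ⟩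
          badness (Z.H κ′) + badness (Z.R ⊚ Z.H κ)           ≤⟨ ℤP.+-monoʳ-≤ (badness (Z.H κ′)) (badness-⊚ Z.R (Z.H κ)) ⟩
          badness (Z.H κ′) + (badness Z.R + badness (Z.H κ)) ≡⟨ cong₂ (λ x y → x + (badness Z.R + y))
                                                                  (Shift.badness-shift K N (s κ′)) (Shift.badness-shift K N (s κ)) ⟩
          0ℤ + (badness Z.R + 0ℤ)                            ≡⟨ trans (ℤP.+-identityˡ _) (ℤP.+-identityʳ _) ⟩
          badness Z.R                                        ∎

      -- The run absorbs the carries of the words into the label, so only the two shifts carry, by
      -- at most 1 each. The bound therefore does not grow with height.
      carry-zigzag : ∀ i x → carry (Z.zigzag i) x ℕ.≤ 2
      carry-zigzag i x with FP.combine-surjective {m} {m} i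
      ... | κ , κ′ , refl = subst (λ ψ → carry ψ x ℕ.≤ 2) (sym (onPair-combine (λ κ κ′ → Z.H κ′ ⊚ Z.R ⊚ Z.H κ) κ κ′))
        (ℕP.+-mono-≤ (Shift.carry-shift K N (s κ′) (small κ′) (fun (Z.R ⊚ Z.H κ) x)) (Shift.carry-shift K N (s κ) (small κ) x))
        where
        small : ∀ κ → s κ ℕ.≤ K
        small κ = ℕP.<⇒≤ (FP.toℕ<n (lookup k κ))

      bad-zigzag : + pow2 β * (∑[ i ∈ allFin (m ℕ.* m) ] badness (Z.zigzag i)) ≤ + (m ℕ.* m) * + (K ℕ.* N)
      bad-zigzag = *-cancel-≤ 2 (begin
        + 2 * (+ pow2 β * (∑[ i ∈ allFin (m ℕ.* m) ] badness (Z.zigzag i)))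
          ≤⟨ *-mono-0≤ (0≤+ 2) (*-mono-0≤ (0≤+ (pow2 β)) (ℤP.≤-trans badness-zigzag (*-mono-0≤ (0≤+ (m ℕ.* m)) badness-R))) ⟩
        + 2 * (+ pow2 β * (+ (m ℕ.* m) * (+ Q * (+ 2 * (+ D * b)) + + (D ℕ.* D) * (+ N * + 4))))
          ≡⟨ alg (+ pow2 β) (+ (m ℕ.* m)) (+ Q) (+ D) b (+ (D ℕ.* D)) (+ N) ⟩
        (+ (m ℕ.* m) * (+ Q * + D)) * ((+ 4 * + pow2 β) * b) + + (m ℕ.* m) * (+ (D ℕ.* D) * (+ N * (+ 8 * + pow2 β)))
          ≡⟨ cong₂ (λ x y → (+ (m ℕ.* m) * (+ Q * + D)) * (x * b) + + (m ℕ.* m) * (+ (D ℕ.* D) * (+ N * y))) four eight ⟩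
        (+ (m ℕ.* m) * (+ Q * + D)) * (+ pow2 (2 ℕ.+ β) * b) + + (m ℕ.* m) * (+ (D ℕ.* D) * (+ N * + Q))
          ≤⟨ ℤP.+-monoˡ-≤ _ (*-mono-0≤ (0≤* (0≤+ (m ℕ.* m)) (0≤* (0≤+ Q) (0≤+ D))) (bad tower)) ⟩
        (+ (m ℕ.* m) * (+ Q * + D)) * (+ D * + N) + + (m ℕ.* m) * (+ (D ℕ.* D) * (+ N * + Q))
          ≡⟨ cong (λ z → (+ (m ℕ.* m) * (+ Q * + D)) * (+ D * + N) + + (m ℕ.* m) * (z * (+ N * + Q))) (ℤP.pos-* D D) ⟩
        (+ (m ℕ.* m) * (+ Q * + D)) * (+ D * + N) + + (m ℕ.* m) * ((+ D * + D) * (+ N * + Q))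
          ≡⟨ alg′ (+ (m ℕ.* m)) (+ Q) (+ D) (+ N) ⟩
        + 2 * (+ (m ℕ.* m) * ((+ D * + D * + Q) * + N))
          ≡⟨ cong (λ z → + 2 * (+ (m ℕ.* m) * z)) (trans (ℤP.pos-* K N) (cong (_* + N) (trans (ℤP.pos-* (D ℕ.* D) Q) (cong (_* + Q) (ℤP.pos-* D D))))) ⟨
        + 2 * (+ (m ℕ.* m) * + (K ℕ.* N)) ∎)
        where
        open ℤP.≤-Reasoning
        four : + 4 * + pow2 β ≡ + pow2 (2 ℕ.+ β)
        four = trans (sym (ℤP.pos-* 4 (pow2 β))) (cong +_ (sym (trans (pow2-+ 2 β) (cong (ℕ._* pow2 β) pow2-2))))
        eight : + 8 * + pow2 β ≡ + Q
        eight = trans (sym (ℤP.pos-* 8 (pow2 β))) (cong +_ (sym (trans (pow2-+ 3 β) (cong (ℕ._* pow2 β) pow2-3))))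
        alg : ∀ p M q d b e n → + 2 * (p * (M * (q * (+ 2 * (d * b)) + e * (n * + 4))))
                              ≡ (M * (q * d)) * ((+ 4 * p) * b) + M * (e * (n * (+ 8 * p)))
        alg = ℤR.solve-∀
        alg′ : ∀ M q d n → (M * (q * d)) * (d * n) + M * ((d * d) * (n * q)) ≡ + 2 * (M * ((d * d * q) * n))
        alg′ = ℤR.solve-∀

     climb′ : Tower (m ℕ.* m) (K ℕ.* N) β
     climb′ = record
      { maps = Z.zigzag
      ; carry≤2 = carry-zigzag
      ; gap = Z.zigzag-gap mixing
      ; bad = bad-zigzag
      }

    climb : ∀ m → pow2 96 ℕ.* K ℕ.≤ m ℕ.^ 8 → Tower (m ℕ.* m) (K ℕ.* N) β
    climb m large = uncurry climb′ (RandomShifts.mixing-shifts K m 64 8 (pow2 96) refl pow2-96 large)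

    2≤K : 2 ℕ.≤ K
    2≤K = begin
      2                      ≤⟨ s≤s (s≤s z≤n) ⟩
      8                      ≡⟨ pow2-3 ⟨
      pow2 3                 ≤⟨ pow2-mono (ℕP.m≤m+n 3 β) ⟩
      Q                      ≤⟨ ℕP.m≤n*m Q (D ℕ.* D) {{ℕP.m*n≢0 D D}} ⟩
      D ℕ.* D ℕ.* Q          ∎
      where open ℕP.≤-Reasoning

  -- τ is the distance from the top of the tower; 28 is the least offset for which large-enough holds.
  shiftCount degree exponent : ℕ → ℕ
  shiftCount τ = pow2 (28 ℕ.+ τ)
  degree τ     = shiftCount τ ℕ.* shiftCount τ
  exponent τ   = 6 ℕ.+ 2 ℕ.* τ

  -- In exponents of 2: 96 + 4 (29 + τ) + (9 + 2 τ) = 221 + 6 τ against 8 (28 + τ) = 224 + 8 τ.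
  large-enough : ∀ τ → pow2 96 ℕ.* (degree (suc τ) ℕ.* degree (suc τ) ℕ.* pow2 (3 ℕ.+ exponent τ)) ℕ.≤ shiftCount τ ℕ.^ 8
  large-enough τ = begin
    pow2 96 ℕ.* ((x ℕ.* x) ℕ.* (x ℕ.* x) ℕ.* pow2 (3 ℕ.+ exponent τ))
      ≡⟨ cong (λ z → pow2 96 ℕ.* (z ℕ.* pow2 (3 ℕ.+ exponent τ))) (trans (cong₂ ℕ._*_ x² x²) (sym (pow2-+ (e ℕ.+ e) (e ℕ.+ e)))) ⟩
    pow2 96 ℕ.* (pow2 ((e ℕ.+ e) ℕ.+ (e ℕ.+ e)) ℕ.* pow2 (3 ℕ.+ exponent τ))
      ≡⟨ trans (cong (pow2 96 ℕ.*_) (sym (pow2-+ ((e ℕ.+ e) ℕ.+ (e ℕ.+ e)) (3 ℕ.+ exponent τ)))) (sym (pow2-+ 96 _)) ⟩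
    pow2 (96 ℕ.+ ((e ℕ.+ e) ℕ.+ (e ℕ.+ e) ℕ.+ (3 ℕ.+ exponent τ)))
      ≤⟨ pow2-mono exponents ⟩
    pow2 (f ℕ.+ (f ℕ.+ (f ℕ.+ (f ℕ.+ (f ℕ.+ (f ℕ.+ (f ℕ.+ f)))))))
      ≡⟨ trans (pow2-+ f _) (cong (pow2 f ℕ.*_) (trans (pow2-+ f _) (cong (pow2 f ℕ.*_) (trans (pow2-+ f _) (cong (pow2 f ℕ.*_)
          (trans (pow2-+ f _) (cong (pow2 f ℕ.*_) (trans (pow2-+ f _) (cong (pow2 f ℕ.*_) (trans (pow2-+ f _) (cong (pow2 f ℕ.*_)
          (trans (pow2-+ f f) (cong (pow2 f ℕ.*_) (sym (ℕP.*-identityʳ (pow2 f)))))))))))))))) ⟩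
    pow2 f ℕ.^ 8 ∎
    where
    open ℕP.≤-Reasoning
    e f x : ℕ
    e = 28 ℕ.+ suc τ
    f = 28 ℕ.+ τ
    x = shiftCount (suc τ)
    x² : x ℕ.* x ≡ pow2 (e ℕ.+ e)
    x² = sym (pow2-+ e e)
    exponents : 96 ℕ.+ ((e ℕ.+ e) ℕ.+ (e ℕ.+ e) ℕ.+ (3 ℕ.+ exponent τ)) ℕ.≤ f ℕ.+ (f ℕ.+ (f ℕ.+ (f ℕ.+ (f ℕ.+ (f ℕ.+ (f ℕ.+ f))))))
    exponents = ℕP.≤-trans (ℕP.m≤m+n _ (3 ℕ.+ 2 ℕ.* τ)) (ℕP.≤-reflexive (alg τ))
      where
      alg : ∀ τ → 96 ℕ.+ ((28 ℕ.+ suc τ ℕ.+ (28 ℕ.+ suc τ)) ℕ.+ (28 ℕ.+ suc τ ℕ.+ (28 ℕ.+ suc τ)) ℕ.+ (3 ℕ.+ (6 ℕ.+ 2 ℕ.* τ))) ℕ.+ (3 ℕ.+ 2 ℕ.* τ)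
          ≡ (28 ℕ.+ τ) ℕ.+ ((28 ℕ.+ τ) ℕ.+ ((28 ℕ.+ τ) ℕ.+ ((28 ℕ.+ τ) ℕ.+ ((28 ℕ.+ τ) ℕ.+ ((28 ℕ.+ τ) ℕ.+ ((28 ℕ.+ τ) ℕ.+ (28 ℕ.+ τ)))))))
      alg = ℕR.solve-∀

  degree≢0 : ∀ τ → NonZero (degree τ)
  degree≢0 τ = ℕP.m*n≢0 (shiftCount τ) (shiftCount τ) {{pow2≢0 (28 ℕ.+ τ)}} {{pow2≢0 (28 ℕ.+ τ)}}

  -- Height is gained at the bottom: t falls while τ rises, so the parameters at the top never
  -- depend on t.
  towers : ∀ t τ → Σ ℕ λ N → t ℕ.< N × Tower (degree τ) N (exponent τ)
  towers zero    τ = 1 , s≤s z≤n , trivial (degree τ) (exponent τ)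
  towers (suc t) τ with towers t (suc τ)
  ... | N , t<N , tower = C.K ℕ.* N , bigger , C.climb (shiftCount τ) (large-enough τ)
    where
    exponent-suc : exponent (suc τ) ≡ 2 ℕ.+ exponent τ
    exponent-suc = cong (6 ℕ.+_) (ℕP.*-suc 2 τ)
    module C = Climb {β = exponent τ} (subst (Tower (degree (suc τ)) N) exponent-suc tower) {{degree≢0 (suc τ)}}
    bigger : suc t ℕ.< C.K ℕ.* N
    bigger = begin-strict
      suc t          ≤⟨ t<N ⟩
      N              <⟨ ℕP.m<m+n N (ℕP.≤-trans (s≤s z≤n) t<N) ⟩
      N ℕ.+ N        ≡⟨ cong (N ℕ.+_) (ℕP.+-identityʳ N) ⟨
      2 ℕ.* N        ≤⟨ ℕP.*-monoˡ-≤ N C.2≤K ⟩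
      C.K ℕ.* N      ∎
      where open ℕP.≤-Reasoning

  -- From the top of the tower to partial increasing maps that expand middle-sized sets

  # : ∀ {n} → (Fin n → Bool) → ℕ
  # {n} p = ∑ℕ.∑ (allFin n) (λ x → ∑ℕ.ind (p x))

  ind-cast : ∀ b → ind b ≡ + ∑ℕ.ind b
  ind-cast true  = refl
  ind-cast false = refl

  #-cast : ∀ {n} (p : Fin n → Bool) → (∑[ x ∈ allFin n ] ind (p x)) ≡ + # p
  #-cast {n} p = trans (∑-cong (allFin n) λ x → ind-cast (p x)) (∑-cast (allFin n) _)

  -- edge i is the graph of a partial strictly increasing function on Fin N.
  record Monotone (d N : ℕ) : Set where
    field
      edge       : Fin d → Fin N → Fin N → Bool
      functional : ∀ i {x y y′} → T (edge i x y) → T (edge i x y′) → y ≡ y′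
      increasing : ∀ i {x x′ y y′} → T (edge i x y) → T (edge i x′ y′) → x F.< x′ → y F.< y′

    hit? : (p : Fin N → Bool) (y : Fin N) → Dec (∃ λ i → ∃ λ x → T (p x) × T (edge i x y))
    hit? p y = FP.any? λ i → FP.any? λ x → T? (p x) ×-dec T? (edge i x y)

    boundary : (Fin N → Bool) → Fin N → Bool
    boundary p y = not (p y) ∧ does (hit? p y)

  open Monotone using (boundary)

  T-does : ∀ {P : Set} (d : Dec P) → T (does d) → P
  T-does (yes p) _ = p
  T-does (no _)  ()

  ∑-unique : ∀ {n} (b : Fin n → Bool) B → (∀ x x′ → T (b x) → T (b x′) → x ≡ x′) → (∀ x → T (b x) → T B) →
             (∑[ x ∈ allFin n ] ind (b x)) ≤ ind B
  ∑-unique {n} b B unique implies with FP.any? (λ x → T? (b x))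
  ... | no none = ℤP.≤-trans (ℤP.≤-reflexive (trans (∑-cong (allFin n) λ x → zero-ind (b x) (none ∘ (x ,_))) (∑-0 (allFin n)))) (0≤ind B)
    where
    zero-ind : ∀ b → ¬ T b → ind b ≡ 0ℤ
    zero-ind true  ¬t = ⊥-elim (¬t tt)
    zero-ind false _  = refl
  ... | yes (x₀ , t) = begin
    (∑[ x ∈ allFin n ] ind (b x))                ≤⟨ ∑-mono (allFin n) (λ x → at x (b x) refl) ⟩
    (∑[ x ∈ allFin n ] ind (does (x F.≟ x₀)))    ≡⟨ ∑-ind≡1 x₀ ⟩
    1ℤ                                           ≡⟨ one-ind B (implies x₀ t) ⟨
    ind B                                        ∎
    where
    open ℤP.≤-Reasoning
    one-ind : ∀ b → T b → ind b ≡ 1ℤ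
    one-ind true _ = refl
    at : ∀ x c → b x ≡ c → ind c ≤ ind (does (x F.≟ x₀))
    at x false _ = 0≤ind _
    at x true  e rewrite dec-true (x F.≟ x₀) (unique x x₀ (subst T (sym e) tt) t) = ℤP.≤-refl

  -- If x < x′ < x + N had the same image, the increasing lift would force carry x < carry x′ <
  -- carry x + 1.
  good-injective : ∀ {N} (φ : CircleMap N) x x′ → T (good φ x) → T (good φ x′) → fun φ x ≡ fun φ x′ → ¬ toℕ x ℕ.< toℕ x′
  good-injective {N} φ x x′ g g′ e x<x′ = ℕP.<⇒≱ c<c′ (ℕP.≤-pred c′<1+c)
    where
    c = carry φ x
    c′ = carry φ x′
    cancel : ∀ {j k} → toℕ (fun φ x) ℕ.+ N ℕ.* j ℕ.< toℕ (fun φ x) ℕ.+ N ℕ.* k → j ℕ.< k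
    cancel lt = ℕP.*-cancelˡ-< N _ _ (ℕP.+-cancelˡ-< (toℕ (fun φ x)) _ _ lt)
    c<c′ : c ℕ.< c′
    c<c′ = subst₂ ℕ._<_ (ℕP.+-identityʳ c) (ℕP.+-identityʳ c′) (cancel (subst (λ y → toℕ (fun φ x) ℕ.+ N ℕ.* (c ℕ.+ 0) ℕ.< toℕ y ℕ.+ N ℕ.* (c′ ℕ.+ 0))
      (sym e) (increasing φ x x′ 0 0 g g′ (ℕP.+-monoˡ-< (N ℕ.* 0) x<x′))))
    c′<1+c : c′ ℕ.< suc c
    c′<1+c = subst₂ ℕ._<_ (ℕP.+-identityʳ c′) (ℕP.+-comm c 1) (cancel (subst (λ y → toℕ y ℕ.+ N ℕ.* (c′ ℕ.+ 0) ℕ.< toℕ (fun φ x) ℕ.+ N ℕ.* (c ℕ.+ 1))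
      (sym e) (increasing φ x′ x 0 1 g′ g (begin-strict
        toℕ x′ ℕ.+ N ℕ.* 0   ≡⟨ trans (cong (toℕ x′ ℕ.+_) (ℕP.*-zeroʳ N)) (ℕP.+-identityʳ _) ⟩
        toℕ x′               <⟨ FP.toℕ<n x′ ⟩
        N                    ≡⟨ ℕP.*-identityʳ N ⟨
        N ℕ.* 1              ≤⟨ ℕP.m≤n+m _ (toℕ x) ⟩
        toℕ x ℕ.+ N ℕ.* 1    ∎))))
      where open ℕP.≤-Reasoning

  module Pieces {D N β : ℕ} (tower : Tower D N β) where
    private
      φ = maps tower

      piece : Fin D → Fin 3 → Fin N → Fin N → Bool
      piece i c x y = good (φ i) x ∧ (does (carry (φ i) x ℕ.≟ toℕ c) ∧ does (fun (φ i) x F.≟ y))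

      view : ∀ i c x y → T (piece i c x y) → T (good (φ i) x) × carry (φ i) x ≡ toℕ c × fun (φ i) x ≡ y
      view i c x y t = T-∧ˡ t , T-does (carry (φ i) x ℕ.≟ toℕ c) (T-∧ˡ t′)
                     , T-does (fun (φ i) x F.≟ y) (T-∧ʳ {does (carry (φ i) x ℕ.≟ toℕ c)} t′)
        where t′ = T-∧ʳ {good (φ i) x} t

      unview : ∀ i c x y → T (good (φ i) x) → carry (φ i) x ≡ toℕ c → fun (φ i) x ≡ y → T (piece i c x y)
      unview i c x y g e e′ rewrite dec-true (carry (φ i) x ℕ.≟ toℕ c) e | dec-true (fun (φ i) x F.≟ y) e′ with good (φ i) x
      ... | true = tt

    -- Among points with the same carry the order of the lifts is the order of the images in Fin N.
    -- Carries are 0, 1 or 2, hence three pieces for each map.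
    pieces : Monotone (D ℕ.* 3) N
    pieces = record
      { edge = onPair piece
      ; functional = λ k → functional′ k (FP.combine-surjective {D} {3} k)
      ; increasing = λ k → increasing′ k (FP.combine-surjective {D} {3} k)
      }
      where
      functional′ : ∀ k → (∃ λ i → ∃ λ c → combine i c ≡ k) → ∀ {x y y′} → T (onPair piece k x y) → T (onPair piece k x y′) → y ≡ y′
      functional′ _ (i , c , refl) {x} {y} {y′} t t′ rewrite onPair-combine piece i c =
        trans (sym (proj₂ (proj₂ (view i c x y t)))) (proj₂ (proj₂ (view i c x y′ t′)))
      increasing′ : ∀ k → (∃ λ i → ∃ λ c → combine i c ≡ k) → ∀ {x x′ y y′} →
                    T (onPair piece k x y) → T (onPair piece k x′ y′) → x F.< x′ → y F.< y′
      increasing′ _ (i , c , refl) {x} {x′} {y} {y′} t t′ x<x′ rewrite onPair-combine piece i c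
        with g , e , refl ← view i c x y t | g′ , e′ , refl ← view i c x′ y′ t′ =
        ℕP.+-cancelʳ-< (N ℕ.* (toℕ c ℕ.+ 0)) _ _ (subst₂ (λ s s′ → toℕ (fun (φ i) x) ℕ.+ N ℕ.* (s ℕ.+ 0) ℕ.< toℕ (fun (φ i) x′) ℕ.+ N ℕ.* (s′ ℕ.+ 0)) e e′
          (increasing (φ i) x x′ 0 0 g g′ (ℕP.+-monoˡ-< (N ℕ.* 0) x<x′)))

    module Expansion .{{_ : NonZero D}} .{{_ : NonZero N}} (p : Fin N → Bool) where
      private
        u : Fin N → ℤ
        u x = ind (p x)
        A : (Fin N → ℤ) → Fin N → ℤ
        A = sumOp φ
        ν δ s e out b ∂ : ℤ
        ν = + N
        δ = + D
        s = ∑ (allFin N) u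
        e = ⟨ u ∣ A u ⟩
        out = ∑[ i ∈ allFin D ] ∑[ x ∈ allFin N ] (u x * (1ℤ - u (fun (φ i) x)))
        b = ∑[ i ∈ allFin D ] badness (φ i)
        ∂ = ∑[ y ∈ allFin N ] ind (boundary pieces p y)

        crossing : Fin D → Fin N → Bool
        crossing i x = p x ∧ (good (φ i) x ∧ not (p (fun (φ i) x)))

        crossing-view : ∀ i x → T (crossing i x) → T (p x) × T (good (φ i) x) × ¬ T (p (fun (φ i) x))
        crossing-view i x t with p x | good (φ i) x | p (fun (φ i) x)
        ... | true | true | false = tt , tt , λ ()

        carry′ : ∀ i x → ∃ λ (c : Fin 3) → carry (φ i) x ≡ toℕ c
        carry′ i x = F.fromℕ< (s≤s (carry≤2 tower i x)) , sym (FP.toℕ-fromℕ< (s≤s (carry≤2 tower i x)))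

        crossing-boundary : ∀ i x → T (crossing i x) → T (boundary pieces p (fun (φ i) x))
        crossing-boundary i x t with crossing-view i x t
        ... | px , g , ¬py = lemma (p (fun (φ i) x)) (Monotone.hit? pieces p (fun (φ i) x)) ¬py
          (combine i (proj₁ (carry′ i x)) , x , px , subst (λ f → T (f x (fun (φ i) x))) (sym (onPair-combine piece i (proj₁ (carry′ i x))))
            (unview i (proj₁ (carry′ i x)) x _ g (proj₂ (carry′ i x)) refl))
          where
          lemma : ∀ {X : Set} b (d : Dec X) → ¬ T b → X → T (not b ∧ does d)
          lemma true  _       ¬t _ = ⊥-elim (¬t tt)
          lemma false (yes _) _  _ = tt
          lemma false (no ¬x) _  x = ⊥-elim (¬x x)

        -- Each map is injective on its good points, so distinct crossings of one map end at
        -- distinct boundary points.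
        crossings≤ : ∀ i → (∑[ x ∈ allFin N ] ind (crossing i x)) ≤ ∂
        crossings≤ i = begin
          (∑[ x ∈ allFin N ] ind (crossing i x))
            ≡⟨ ∑-cong (allFin N) (λ x → trans (sym (∑-pick (fun (φ i) x) (λ _ → ind (crossing i x))))
                 (∑-cong (allFin N) λ y → ind-∧ (does (y F.≟ fun (φ i) x)) (crossing i x))) ⟩
          (∑[ x ∈ allFin N ] ∑[ y ∈ allFin N ] ind (does (y F.≟ fun (φ i) x) ∧ crossing i x))
            ≡⟨ ∑-swap (allFin N) (allFin N) _ ⟩
          (∑[ y ∈ allFin N ] ∑[ x ∈ allFin N ] ind (does (y F.≟ fun (φ i) x) ∧ crossing i x))
            ≤⟨ ∑-mono (allFin N) (λ y → ∑-unique (λ x → does (y F.≟ fun (φ i) x) ∧ crossing i x) (boundary pieces p y) (unique y) (implies y)) ⟩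
          ∂ ∎
          where
          open ℤP.≤-Reasoning
          ind-∧ : ∀ a b → ind a * ind b ≡ ind (a ∧ b)
          ind-∧ true  b = ℤP.*-identityˡ _
          ind-∧ false b = refl
          split : ∀ y x → T (does (y F.≟ fun (φ i) x) ∧ crossing i x) → y ≡ fun (φ i) x × T (crossing i x)
          split y x t with y F.≟ fun (φ i) x
          ... | yes e = e , t
          implies : ∀ y x → T (does (y F.≟ fun (φ i) x) ∧ crossing i x) → T (boundary pieces p y)
          implies y x t with split y x t
          ... | refl , cr = crossing-boundary i x cr
          unique : ∀ y x x′ → T (does (y F.≟ fun (φ i) x) ∧ crossing i x) → T (does (y F.≟ fun (φ i) x′) ∧ crossing i x′) → x ≡ x′
          unique y x x′ t t′ with split y x t | split y x′ t′
          ... | e , cr | e′ , cr′ with FP.<-cmp x x′ | crossing-view i x cr | crossing-view i x′ cr′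
          ...   | tri< lt _ _ | _ , g , _ | _ , g′ , _ = ⊥-elim (good-injective (φ i) x x′ g g′ (trans (sym e) e′) lt)
          ...   | tri≈ _ eq _ | _         | _          = eq
          ...   | tri> _ _ gt | _ , g , _ | _ , g′ , _ = ⊥-elim (good-injective (φ i) x′ x g′ g (trans (sym e′) e) gt)

        out≤ : out ≤ δ * ∂ + b
        out≤ = begin
          out
            ≤⟨ ∑-mono (allFin D) (λ i → ∑-mono (allFin N) λ x → leave (p x) (good (φ i) x) (p (fun (φ i) x))) ⟩
          (∑[ i ∈ allFin D ] ∑[ x ∈ allFin N ] (ind (crossing i x) + ind (not (good (φ i) x))))
            ≡⟨ trans (∑-cong (allFin D) λ i → ∑-⊕ (allFin N) _ _) (∑-⊕ (allFin D) _ _) ⟩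
          (∑[ i ∈ allFin D ] ∑[ x ∈ allFin N ] ind (crossing i x)) + b
            ≤⟨ ℤP.+-monoˡ-≤ b (∑-mono (allFin D) crossings≤) ⟩
          (∑[ i ∈ allFin D ] ∂) + b
            ≡⟨ cong (_+ b) (trans (∑ℤ-const (allFin D) ∂) (cong (λ n → + n * ∂) (length-allFin D))) ⟩
          δ * ∂ + b ∎
          where
          open ℤP.≤-Reasoning
          leave : ∀ a g c → ind a * (1ℤ - ind c) ≤ ind (a ∧ (g ∧ not c)) + ind (not g)
          leave false g     c     = 0≤+-mono (0≤ind false) (0≤ind (not g))
          leave true  true  true  = ℤP.≤-refl
          leave true  true  false = ℤP.≤-refl
          leave true  false true  = +≤+ z≤n
          leave true  false false = ℤP.≤-refl

        out≡ : out ≡ δ * s + - e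
        out≡ = begin
          out
            ≡⟨ ∑-cong (allFin D) (λ i → trans (∑-cong (allFin N) λ x → alg (u x) (u (fun (φ i) x)))
                 (trans (∑-⊕ (allFin N) _ _) (cong (ℤ._+_ s) (∑-⊗ (allFin N) (- 1ℤ) _)))) ⟩
          (∑[ i ∈ allFin D ] (s + (- 1ℤ) * (∑[ x ∈ allFin N ] (u x * u (fun (φ i) x)))))
            ≡⟨ trans (∑-⊕ (allFin D) _ _) (cong₂ _+_ (trans (∑ℤ-const (allFin D) s) (cong (λ n → + n * s) (length-allFin D)))
                 (trans (∑-⊗ (allFin D) (- 1ℤ) _) (cong ((- 1ℤ) *_) (trans (∑-swap (allFin D) (allFin N) _)
                   (∑-cong (allFin N) λ x → ∑-⊗ (allFin D) (u x) _))))) ⟩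
          δ * s + (- 1ℤ) * e
            ≡⟨ cong (ℤ._+_ (δ * s)) (ℤP.-1*i≡-i e) ⟩
          δ * s + - e ∎
          where
          open ≡-Reasoning
          alg : ∀ a c → a * (1ℤ - c) ≡ a + (- 1ℤ) * (a * c)
          alg = ℤR.solve-∀

        u² : ∀ x → u x * u x ≡ u x
        u² x with p x
        ... | true  = refl
        ... | false = refl

        f : Fin N → ℤ
        f x = ν * u x + - s

        const-sum : ∀ c → ∑ (allFin N) (λ _ → c) ≡ ν * c
        const-sum c = trans (∑ℤ-const (allFin N) c) (cong (λ n → + n * c) (length-allFin N))

        ∑f≡0 : ∑ (allFin N) f ≡ 0ℤ
        ∑f≡0 = trans (∑-⊕ (allFin N) _ _) (trans (cong₂ _+_ (∑-⊗ (allFin N) ν u) (const-sum (- s))) (alg ν s))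
          where
          alg : ∀ n s → n * s + n * - s ≡ 0ℤ
          alg = ℤR.solve-∀

        Af : ∀ x → A f x ≡ ν * A u x + - (δ * s)
        Af x = trans (∑-⊕ (allFin D) _ _) (cong₂ _+_ (∑-⊗ (allFin D) ν _)
          (trans (∑ℤ-const (allFin D) (- s)) (trans (cong (λ n → + n * - s) (length-allFin D)) (sym (ℤP.neg-distribʳ-* δ s)))))

        ‖f‖² : ‖ f ‖² ≡ ν * (ν * s + - (s * s))
        ‖f‖² = begin
          ‖ f ‖²
            ≡⟨ ∑-cong (allFin N) (λ x → trans (alg ν (u x) s) (cong (λ z → (ν * ν) * z + ((- + 2 * ν * s) * u x + s * s)) (u² x))) ⟩
          (∑[ x ∈ allFin N ] ((ν * ν) * u x + ((- + 2 * ν * s) * u x + s * s)))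
            ≡⟨ trans (∑-3 (allFin N) _ _ _) (cong₂ _+_ (∑-⊗ (allFin N) (ν * ν) u)
                 (cong₂ _+_ (∑-⊗ (allFin N) (- + 2 * ν * s) u) (const-sum (s * s)))) ⟩
          (ν * ν) * s + ((- + 2 * ν * s) * s + ν * (s * s))
            ≡⟨ alg′ ν s ⟩
          ν * (ν * s + - (s * s)) ∎
          where
          open ≡-Reasoning
          alg : ∀ n u s → (n * u + - s) * (n * u + - s) ≡ (n * n) * (u * u) + ((- + 2 * n * s) * u + s * s)
          alg = ℤR.solve-∀
          alg′ : ∀ n s → (n * n) * s + ((- + 2 * n * s) * s + n * (s * s)) ≡ n * (n * s + - (s * s))
          alg′ = ℤR.solve-∀

        ⟨f∣Af⟩ : ⟨ f ∣ A f ⟩ ≡ ν * (ν * e + - (δ * (s * s)))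
        ⟨f∣Af⟩ = begin
          ⟨ f ∣ A f ⟩
            ≡⟨ ∑-cong (allFin N) (λ x → trans (cong (f x *_) (Af x)) (alg ν (u x) s (A u x) δ)) ⟩
          (∑[ x ∈ allFin N ] ((ν * ν) * (u x * A u x) + (- (ν * δ * s) * u x + (- (ν * s) * A u x + δ * (s * s)))))
            ≡⟨ trans (∑-3 (allFin N) _ _ _) (cong₂ _+_ (∑-⊗ (allFin N) (ν * ν) _) (cong₂ _+_ (∑-⊗ (allFin N) (- (ν * δ * s)) u)
                 (trans (∑-⊕ (allFin N) _ _) (cong₂ _+_ (trans (∑-⊗ (allFin N) (- (ν * s)) _) (cong (- (ν * s) *_) (∑-sumOp φ u)))
                   (const-sum (δ * (s * s))))))) ⟩
          (ν * ν) * e + (- (ν * δ * s) * s + (- (ν * s) * (δ * s) + ν * (δ * (s * s))))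
            ≡⟨ alg′ ν e δ s ⟩
          ν * (ν * e + - (δ * (s * s))) ∎
          where
          open ≡-Reasoning
          alg : ∀ n u s a d → (n * u + - s) * (n * a + - (d * s)) ≡ (n * n) * (u * a) + (- (n * d * s) * u + (- (n * s) * a + d * (s * s)))
          alg = ℤR.solve-∀
          alg′ : ∀ n e d s → (n * n) * e + (- (n * d * s) * s + (- (n * s) * (d * s) + n * (d * (s * s)))) ≡ n * (n * e + - (d * (s * s)))
          alg′ = ℤR.solve-∀

        -- The maps need not be closed under inverses, so A need not be symmetric. The quadratic
        -- form is bounded through the norm of A f, by expanding the square of δ f - 2 A f.
        correlation : + 2 * ⟨ f ∣ A f ⟩ ≤ δ * ‖ f ‖²
        correlation = *-cancel-≤ 2 (*-cancel-≤ D (begin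
          δ * (+ 2 * (+ 2 * ⟨ f ∣ A f ⟩))
            ≤⟨ ≤-by S (0≤∑ (allFin N) λ x → 0≤x*x (δ * f x + (- + 2) * A f x)) refl ⟩
          δ * (+ 2 * (+ 2 * ⟨ f ∣ A f ⟩)) + S
            ≡⟨ cong (ℤ._+_ (δ * (+ 2 * (+ 2 * ⟨ f ∣ A f ⟩)))) (trans (∑-cong (allFin N) λ x → alg δ (f x) (A f x))
                 (trans (∑-3 (allFin N) _ _ _) (cong₂ _+_ (∑-⊗ (allFin N) (δ * δ) _)
                   (cong₂ _+_ (∑-⊗ (allFin N) (- + 4 * δ) _) (∑-⊗ (allFin N) (+ 4) _))))) ⟩
          δ * (+ 2 * (+ 2 * ⟨ f ∣ A f ⟩)) + ((δ * δ) * ‖ f ‖² + ((- + 4 * δ) * ⟨ f ∣ A f ⟩ + + 4 * ‖ A f ‖²))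
            ≡⟨ alg′ δ ⟨ f ∣ A f ⟩ ‖ f ‖² ‖ A f ‖² ⟩
          (δ * δ) * ‖ f ‖² + + 4 * ‖ A f ‖²
            ≤⟨ ℤP.+-monoʳ-≤ ((δ * δ) * ‖ f ‖²) (gap tower f ∑f≡0) ⟩
          (δ * δ) * ‖ f ‖² + (δ * δ) * ‖ f ‖²
            ≡⟨ alg″ δ ‖ f ‖² ⟩
          δ * (+ 2 * (δ * ‖ f ‖²)) ∎))
          where
          open ℤP.≤-Reasoning
          S = ∑[ x ∈ allFin N ] ((δ * f x + (- + 2) * A f x) * (δ * f x + (- + 2) * A f x))
          alg : ∀ d y a → (d * y + (- + 2) * a) * (d * y + (- + 2) * a) ≡ (d * d) * (y * y) + ((- + 4 * d) * (y * a) + + 4 * (a * a))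
          alg = ℤR.solve-∀
          alg′ : ∀ d c y a → d * (+ 2 * (+ 2 * c)) + ((d * d) * y + ((- + 4 * d) * c + + 4 * a)) ≡ (d * d) * y + + 4 * a
          alg′ = ℤR.solve-∀
          alg″ : ∀ d y → (d * d) * y + (d * d) * y ≡ d * (+ 2 * (d * y))
          alg″ = ℤR.solve-∀

        internal : + 2 * (ν * e + - (δ * (s * s))) ≤ δ * (ν * s + - (s * s))
        internal = *-cancel-≤ N (subst₂ _≤_
          (trans (cong (+ 2 *_) ⟨f∣Af⟩) (alg (+ 2) ν _)) (trans (cong (δ *_) ‖f‖²) (alg δ ν _)) correlation)
          where
          alg : ∀ a n y → a * (n * y) ≡ n * (a * y)
          alg = ℤR.solve-∀

        0≤s : 0ℤ ≤ s
        0≤s = 0≤∑ (allFin N) λ x → 0≤ind (p x)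

        -- The easy half of Cheeger's inequality: the correlation bound leaves at least δ s (ν - s)
        -- / 2ν exits, and ν - s is at least ν / 4.
        many-out : + 4 * s ≤ + 3 * ν → δ * s ≤ + 8 * out
        many-out 4s≤3ν = *-cancel-≤ N (begin
          ν * (δ * s)
            ≤⟨ ≤-by ((δ * s) * (+ 3 * ν - + 4 * s)) (0≤* (0≤* (0≤+ D) 0≤s) (ℤP.i≤j⇒0≤j-i 4s≤3ν)) (alg ν δ s) ⟩
          + 4 * (δ * s) * (ν - s)
            ≤⟨ ≤-by (+ 4 * (δ * (ν * s + - (s * s)) - + 2 * (ν * e + - (δ * (s * s)))))
                 (0≤* (0≤+ 4) (ℤP.i≤j⇒0≤j-i internal)) (alg′ ν δ s e) ⟩
          ν * (+ 8 * (δ * s + - e))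
            ≡⟨ cong (λ z → ν * (+ 8 * z)) out≡ ⟨
          ν * (+ 8 * out) ∎)
          where
          open ℤP.≤-Reasoning
          alg : ∀ n d s → + 4 * (d * s) * (n - s) ≡ n * (d * s) + (d * s) * (+ 3 * n - + 4 * s)
          alg = ℤR.solve-∀
          alg′ : ∀ n d s e → n * (+ 8 * (d * s + - e)) ≡ + 4 * (d * s) * (n - s) + + 4 * (d * (n * s + - (s * s)) - + 2 * (n * e + - (d * (s * s))))
          alg′ = ℤR.solve-∀

        -- Exits through bad points are few only relative to the whole circle. With at least a
        -- quarter of the points in the set, 64 b ≤ 4 δ s, so they absorb at most half of the lower
        -- bound on exits.
        expansionℤ : + 64 * b ≤ δ * ν → ν ≤ + 4 * s → + 4 * s ≤ + 3 * ν → s ≤ + 16 * ∂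
        expansionℤ bad≤ ν≤4s 4s≤3ν = *-cancel-≤ D (*-cancel-≤ 4 (begin
          + 4 * (δ * s)
            ≡⟨ alg₁ δ s ⟩
          + 8 * (δ * s) + - (δ * (+ 4 * s))
            ≤⟨ ℤP.+-mono-≤ (*-mono-0≤ (0≤+ 8) (many-out 4s≤3ν)) (ℤP.neg-mono-≤ (ℤP.≤-trans bad≤ (*-mono-0≤ (0≤+ D) ν≤4s))) ⟩
          + 8 * (+ 8 * out) + - (+ 64 * b)
            ≤⟨ ℤP.+-monoˡ-≤ (- (+ 64 * b)) (*-mono-0≤ (0≤+ 8) (*-mono-0≤ (0≤+ 8) out≤)) ⟩
          + 8 * (+ 8 * (δ * ∂ + b)) + - (+ 64 * b)
            ≡⟨ alg₂ δ ∂ b ⟩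
          + 4 * (δ * (+ 16 * ∂)) ∎))
          where
          open ℤP.≤-Reasoning
          alg₁ : ∀ d s → + 4 * (d * s) ≡ + 8 * (d * s) + - (d * (+ 4 * s))
          alg₁ = ℤR.solve-∀
          alg₂ : ∀ d y b → + 8 * (+ 8 * (d * y + b)) + - (+ 64 * b) ≡ + 4 * (d * (+ 16 * y))
          alg₂ = ℤR.solve-∀

      expansion : β ≡ 6 → N ℕ.≤ 4 ℕ.* # p → 4 ℕ.* # p ℕ.≤ 3 ℕ.* N → # p ℕ.≤ 16 ℕ.* # (boundary pieces p)
      expansion refl N≤ ≤N = ℤP.drop‿+≤+ (subst₂ _≤_ (#-cast p)
          (trans (cong (+ 16 *_) (#-cast (boundary pieces p))) (sym (ℤP.pos-* 16 (# (boundary pieces p)))))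
          (expansionℤ few
            (subst (ν ≤_) (trans (ℤP.pos-* 4 (# p)) (cong (+ 4 *_) (sym (#-cast p)))) (+≤+ N≤))
            (subst₂ _≤_ (trans (ℤP.pos-* 4 (# p)) (cong (+ 4 *_) (sym (#-cast p)))) (ℤP.pos-* 3 N) (+≤+ ≤N))))
        where
        rescale : ∀ m n → m ≡ n → + m * b ≤ δ * ν → + n * b ≤ δ * ν
        rescale m n refl few = few
        few : + 64 * b ≤ δ * ν
        few = rescale (pow2 6) 64 pow2-6 (bad tower)

open CircleMaps

open import Defs
open import Data.Nat using (_+_; _*_; _≤_; _<_)
import Data.Rational as ℚ
import Data.Rational.Properties as ℚP
import Data.Rational.Unnormalised as ℚᵘ
import Data.Rational.Unnormalised.Properties as ℚᵘP
open ∑ℕ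

-- Pruning
record Enumeration {n} (v : Fin n → Bool) : Set where
  field
    size       : ℕ
    ι          : Fin size → Fin n
    ι-mono     : ∀ {i j} → i F.< j → ι i F.< ι j
    ι-onto     : ∀ x → T (v x) → ∃ λ i → ι i ≡ x
    ∑-restrict : ∀ (f : Fin n → ℕ) → ∑ (allFin n) (λ x → ind (v x) * f x) ≡ ∑ (allFin size) (f ∘ ι)

  ι-reflects : ∀ {i j} → ι i F.< ι j → i F.< j
  ι-reflects {i} {j} lt with FP.<-cmp i j
  ... | tri< i<j _ _  = i<j
  ... | tri≈ _ refl _ = ⊥-elim (ℕP.<-irrefl refl lt)
  ... | tri> _ _ j<i  = ⊥-elim (ℕP.<-asym lt (ι-mono j<i))

  ι-injective : ∀ {i j} → ι i ≡ ι j → i ≡ j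
  ι-injective {i} {j} e with FP.<-cmp i j
  ... | tri< i<j _ _  = ⊥-elim (ℕP.<-irrefl (cong toℕ e) (ι-mono i<j))
  ... | tri≈ _ i≡j _  = i≡j
  ... | tri> _ _ j<i  = ⊥-elim (ℕP.<-irrefl (cong toℕ (sym e)) (ι-mono j<i))

enumerate : ∀ {n} (v : Fin n → Bool) → Enumeration v
enumerate {zero}  v = record
  { size = 0 ; ι = λ () ; ι-mono = λ {} ; ι-onto = λ () ; ∑-restrict = λ f → refl }
enumerate {suc n} v with v zero in v0 | enumerate (v ∘ suc)
... | false | E = record
  { size = size ; ι = suc ∘ ι ; ι-mono = s≤s ∘ ι-mono
  ; ι-onto = λ { zero t → ⊥-elim (subst T v0 t) ; (suc x) t → let i , e = ι-onto x t in i , cong suc e }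
  ; ∑-restrict = λ f → trans (∑-suc n _) (trans (cong (λ b → ind b * f zero + ∑ (allFin n) (λ x → ind (v (suc x)) * f (suc x))) v0)
      (∑-restrict (f ∘ suc))) }
  where open Enumeration E
... | true | E = record
  { size = suc size ; ι = ι⁺ ; ι-mono = λ {i} {j} → mono i j
  ; ι-onto = λ { zero t → zero , refl ; (suc x) t → let i , e = ι-onto x t in suc i , cong suc e }
  ; ∑-restrict = λ f → trans (∑-suc n _) (trans (cong (λ b → ind b * f zero + ∑ (allFin n) (λ x → ind (v (suc x)) * f (suc x))) v0)
      (trans (cong₂ _+_ (ℕP.*-identityˡ (f zero)) (∑-restrict (f ∘ suc))) (sym (∑-suc size (f ∘ ι⁺))))) }
  where
  open Enumeration E
  ι⁺ : Fin (suc size) → Fin (suc n)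
  ι⁺ zero    = zero
  ι⁺ (suc i) = suc (ι i)
  mono : ∀ i j → i F.< j → ι⁺ i F.< ι⁺ j
  mono zero    (suc j) _         = s≤s z≤n
  mono (suc i) (suc j) (s≤s i<j) = s≤s (ι-mono i<j)

T-does⁺ : ∀ {P : Set} (d : Dec P) → P → T (does d)
T-does⁺ (yes _) _ = tt
T-does⁺ (no ¬p) p = ⊥-elim (¬p p)

T-ext : ∀ {a b} → (T a → T b) → (T b → T a) → a ≡ b
T-ext {true}  {true}  _ _ = refl
T-ext {true}  {false} f _ = ⊥-elim (f tt)
T-ext {false} {true}  _ g = ⊥-elim (g tt)
T-ext {false} {false} _ _ = refl

T-not : ∀ {a} → ¬ T a → T (not a)
T-not {true}  ¬t = ¬t tt
T-not {false} _  = tt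

T-not⁻ : ∀ {a} → T (not a) → ¬ T a
T-not⁻ {false} _ ()

T-pair : ∀ {a b} → T a → T b → T (a ∧ b)
T-pair {true} _ t = t

T-∨⁻ : ∀ {a b} → T (a ∨ b) → T a ⊎ T b
T-∨⁻ {true}  t = inj₁ t
T-∨⁻ {false} t = inj₂ t

T-∨ˡ : ∀ {a b} → T a → T (a ∨ b)
T-∨ˡ {true} t = tt

T-∨ʳ : ∀ {a b} → T b → T (a ∨ b)
T-∨ʳ {true}  t = tt
T-∨ʳ {false} t = t

ind-mono : ∀ {a b} → (T a → T b) → ind a ≤ ind b
ind-mono {true}  {true}  _ = ℕP.≤-refl
ind-mono {true}  {false} f = ⊥-elim (f tt)
ind-mono {false}         _ = z≤n

#-mono : ∀ {n} {p q : Fin n → Bool} → (∀ x → T (p x) → T (q x)) → # p ≤ # q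
#-mono {n} p⊆q = ∑-mono (allFin n) λ x → ind-mono (p⊆q x)

#-full : ∀ n → # {n} (λ _ → true) ≡ n
#-full n = trans (∑ℕ-const (allFin n) 1) (trans (ℕP.*-identityʳ _) (length-allFin n))

#≤n : ∀ {n} (p : Fin n → Bool) → # p ≤ n
#≤n {n} p = subst (# p ≤_) (#-full n) (#-mono {n} {p} λ _ _ → tt)

open Monotone using (boundary)

boundary⁺ : ∀ {d N} (M : Monotone d N) p {y} i x → ¬ T (p y) → T (p x) → T (Monotone.edge M i x y) → T (boundary M p y)
boundary⁺ M p {y} i x ¬py px e = T-pair (T-not ¬py) (T-does⁺ (Monotone.hit? M p y) (i , x , px , e))

boundary⁻ : ∀ {d N} (M : Monotone d N) p {y} → T (boundary M p y) →
            ¬ T (p y) × ∃ λ i → ∃ λ x → T (p x) × T (Monotone.edge M i x y)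
boundary⁻ M p {y} t = T-not⁻ (T-∧ˡ t) , T-does (Monotone.hit? M p y) (T-∧ʳ {not (p y)} t)

MiddleExpansion FullExpansion : ∀ {d N} → Monotone d N → Set
MiddleExpansion {d} {N} M = ∀ p → N ≤ 4 * # p → 4 * # p ≤ 3 * N → # p ≤ 16 * # (boundary M p)
FullExpansion {d} {N} M = ∀ p → 2 * # p ≤ N → # p ≤ 32 * # (boundary M p)

-- Deleting a maximal thin set W leaves an expander: a thin set U of the rest would enlarge W.
module Prune {d N : ℕ} .{{_ : NonZero N}} (M : Monotone d N) (middle : MiddleExpansion M) where
  open Monotone M hiding (boundary)

  Thin : (Fin N → Bool) → Set
  Thin p = 32 * # (boundary M p) ≤ # p × 4 * # p ≤ 3 * N

  _∪_ : (Fin N → Bool) → (Fin N → Bool) → Fin N → Bool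
  (p ∪ q) x = p x ∨ q x

  Enlarges : (Fin N → Bool) → Subset N → Set
  Enlarges W U = Thin (W ∪ lookup U) × # W < # (W ∪ lookup U)

  enlarges? : ∀ W U → Dec (Enlarges W U)
  enlarges? W U = (_ ℕ.≤? _ ×-dec _ ℕ.≤? _) ×-dec (_ ℕ.<? _)

  -- Each enlargement gains a point, so the fuel bounds the remaining steps. Additions range over
  -- `Subset N`, whose exhaustive search decides whether one exists.
  maximal : ∀ fuel W → Thin W → N ≤ fuel + # W → ∃ λ W → Thin W × ¬ ∃ λ U → Enlarges W U
  maximal fuel W thin bound with anySubset? (enlarges? W)
  ... | no  none = W , thin , none
  maximal zero W thin bound | yes (U , _ , bigger) =
    ⊥-elim (ℕP.<⇒≱ bigger (ℕP.≤-trans (#≤n (W ∪ lookup U)) bound))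
  maximal (suc fuel) W thin bound | yes (U , thin′ , bigger) =
    maximal fuel (W ∪ lookup U) thin′ (ℕP.≤-trans bound (ℕP.≤-trans (ℕP.≤-reflexive (sym (ℕP.+-suc fuel (# W))))
      (ℕP.+-monoʳ-≤ fuel bigger)))

  private
    #∅ : # {N} (λ _ → false) ≡ 0
    #∅ = ∑-0 (allFin N)

    ∅-thin : Thin (λ _ → false)
    ∅-thin = ℕP.≤-reflexive (trans (cong (32 *_) ∂∅) (trans (ℕP.*-zeroʳ 32) (sym #∅)))
           , subst (_≤ 3 * N) (sym (trans (cong (4 *_) #∅) (ℕP.*-zeroʳ 4))) z≤n
      where
      ∂∅ : # (boundary M (λ _ → false)) ≡ 0
      ∂∅ = ℕP.n≤0⇒n≡0 (ℕP.≤-trans (#-mono {q = λ _ → false} λ y t → proj₁ (proj₂ (proj₂ (proj₂ (boundary⁻ M (λ _ → false) {y} t)))))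
             (ℕP.≤-reflexive #∅))

  module Rest (W : Fin N → Bool) (thin-W : Thin W) (no-larger : ¬ ∃ λ U → Enlarges W U) where
    -- Thinness uses 32 and expansion of middle-sized sets 16: a thin set in the middle range would
    -- satisfy 2 # W ≤ 32 # (boundary M W) ≤ # W and be empty.
    small-W : 4 * # W ≤ N
    small-W with ℕP.≤-total N (4 * # W)
    ... | inj₂ W≤ = W≤
    ... | inj₁ N≤ = ⊥-elim (ℕ.≢-nonZero⁻¹ N (ℕP.n≤0⇒n≡0 (ℕP.≤-trans N≤ (ℕP.≤-reflexive (cong (4 *_) #W≡0)))))
      where
      #W≡0 : # W ≡ 0
      #W≡0 = ℕP.n≤0⇒n≡0 (ℕP.+-cancelˡ-≤ (# W) (# W) 0 (begin
        # W + # W                      ≤⟨ ℕP.+-mono-≤ (middle W N≤ (proj₂ thin-W)) (middle W N≤ (proj₂ thin-W)) ⟩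
        16 * # (boundary M W) + 16 * # (boundary M W) ≡⟨ alg (# (boundary M W)) ⟩
        32 * # (boundary M W)          ≤⟨ proj₁ thin-W ⟩
        # W                            ≡⟨ ℕP.+-identityʳ _ ⟨
        # W + 0                        ∎))
        where
        open ℕP.≤-Reasoning
        alg : ∀ x → 16 * x + 16 * x ≡ 32 * x
        alg = ℕR.solve-∀

    open Enumeration (enumerate (not ∘ W)) public

    #W+size : # W + size ≡ N
    #W+size = begin
      # W + size
        ≡⟨ cong (λ z → # W + z) (trans (sym (#-full size)) (sym (∑-restrict (λ _ → 1)))) ⟩
      # W + ∑ (allFin N) (λ x → ind (not (W x)) * 1)
        ≡⟨ ∑-⊕ (allFin N) _ _ ⟨
      ∑ (allFin N) (λ x → ind (W x) + ind (not (W x)) * 1)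
        ≡⟨ ∑-cong (allFin N) (λ x → one (W x)) ⟩
      # {N} (λ _ → true)
        ≡⟨ #-full N ⟩
      N ∎
      where
      open ≡-Reasoning
      one : ∀ b → ind b + ind (not b) * 1 ≡ 1
      one true  = refl
      one false = refl

    large : 3 * N ≤ 4 * size
    large = ℕP.+-cancelˡ-≤ N (3 * N) (4 * size) (begin
      N + 3 * N               ≡⟨⟩
      4 * N                   ≡⟨ cong (4 *_) #W+size ⟨
      4 * (# W + size)        ≡⟨ ℕP.*-distribˡ-+ 4 (# W) size ⟩
      4 * # W + 4 * size      ≤⟨ ℕP.+-monoˡ-≤ (4 * size) small-W ⟩
      N + 4 * size            ∎)
      where open ℕP.≤-Reasoning

    restricted : Monotone d size
    restricted = record
      { edge = λ i x y → edge i (ι x) (ι y)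
      ; functional = λ i e e′ → ι-injective (functional i e e′)
      ; increasing = λ i e e′ x<x′ → ι-reflects (increasing i e e′ (ι-mono x<x′))
      }

    private
      image? : (q : Fin size → Bool) (y : Fin N) → Dec (∃ λ i → T (q i) × ι i ≡ y)
      image? q y = FP.any? λ i → T? (q i) ×-dec (ι i F.≟ y)

      image : (Fin size → Bool) → Fin N → Bool
      image q y = does (image? q y)

      image-ι : ∀ q i → image q (ι i) ≡ q i
      image-ι q i = T-ext from (λ t → T-does⁺ (image? q (ι i)) (i , t , refl))
        where
        from : T (image q (ι i)) → T (q i)
        from t with T-does (image? q (ι i)) t
        ... | j , qj , e = subst (T ∘ q) (ι-injective e) qj

      ∑-image : ∀ q → ∑ (allFin N) (λ y → ind (not (W y)) * ind (image q y)) ≡ # q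
      ∑-image q = trans (∑-restrict (λ y → ind (image q y))) (∑-cong (allFin size) λ i → cong ind (image-ι q i))

      module _ (q : Fin size → Bool) where
        ∂q = boundary restricted q
        U : Subset N
        U = V.tabulate (image q)

        lookup-U : ∀ y → lookup U y ≡ image q y
        lookup-U = VP.lookup∘tabulate (image q)

        #∪ : # (W ∪ lookup U) ≡ # W + # q
        #∪ = trans (∑-cong (allFin N) λ y → trans (cong (λ b → ind (W y ∨ b)) (lookup-U y)) (disjoint (W y) (image q y)))
               (trans (∑-⊕ (allFin N) _ _) (cong (λ z → # W + z) (∑-image q)))
          where
          disjoint : ∀ a b → ind (a ∨ b) ≡ ind a + ind (not a) * ind b
          disjoint true  b = refl
          disjoint false b = sym (ℕP.+-identityʳ (ind b))

        -- A boundary point of the union that is not hit from W is hit from U; since it lies outside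
        -- W it survives the deletion, so it belongs to the boundary of q in the rest.
        #∂∪ : # (boundary M (W ∪ lookup U)) ≤ # (boundary M W) + # ∂q
        #∂∪ = begin
          # (boundary M (W ∪ lookup U))
            ≤⟨ ∑-mono (allFin N) (λ y → bound (boundary M (W ∪ lookup U) y) (boundary M W y) (W y) (image ∂q y) (cases y)) ⟩
          ∑ (allFin N) (λ y → ind (boundary M W y) + ind (not (W y)) * ind (image ∂q y))
            ≡⟨ trans (∑-⊕ (allFin N) _ _) (cong (λ z → # (boundary M W) + z) (∑-image ∂q)) ⟩
          # (boundary M W) + # ∂q ∎
          where
          open ℕP.≤-Reasoning
          bound : ∀ a b w c → (T a → T b ⊎ ¬ T w × T c) → ind a ≤ ind b + ind (not w) * ind c
          bound false b     w     c     _ = z≤n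
          bound true  true  w     c     _ = s≤s z≤n
          bound true  false true  c     f = [ ⊥-elim , (λ z → ⊥-elim (proj₁ z tt)) ]′ (f tt)
          bound true  false false true  f = ℕP.≤-refl
          bound true  false false false f = [ ⊥-elim , (λ z → ⊥-elim (proj₂ z)) ]′ (f tt)
          cases : ∀ y → T (boundary M (W ∪ lookup U) y) → T (boundary M W y) ⊎ ¬ T (W y) × T (image ∂q y)
          cases y t with boundary⁻ M (W ∪ lookup U) t
          ... | ∉ , i , x , x∈ , e with T-∨⁻ {W x} x∈
          ...   | inj₁ x∈W = inj₁ (boundary⁺ M W i x (∉ ∘ T-∨ˡ) x∈W e)
          ...   | inj₂ x∈U with T-does (image? q x) (subst T (lookup-U x) x∈U) | ι-onto y (T-not (∉ ∘ T-∨ˡ))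
          ...     | a , qa , refl | b , refl = inj₂ (∉ ∘ T-∨ˡ , subst T (sym (image-ι ∂q b))
                      (boundary⁺ restricted q i a (λ qb → ∉ (T-∨ʳ {W (ι b)} (subst T (sym (trans (lookup-U (ι b)) (image-ι q b))) qb))) qa e))

    -- A set q violating the bound would give a larger thin set: boundaries add up, and N/4 + N/2 is
    -- still at most 3N/4.
    expanding : FullExpansion restricted
    expanding q q≤ with # q ℕ.≤? 32 * # (boundary restricted q)
    ... | yes ok = ok
    ... | no  ¬ok = ⊥-elim (no-larger (U q , (thin , size≤) , larger))
      where
      ∂q<q : 32 * # (boundary restricted q) < # q
      ∂q<q = ℕP.≰⇒> ¬ok
      open ℕP.≤-Reasoning
      thin : 32 * # (boundary M (W ∪ lookup (U q))) ≤ # (W ∪ lookup (U q))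
      thin = begin
        32 * # (boundary M (W ∪ lookup (U q)))                      ≤⟨ ℕP.*-monoʳ-≤ 32 (#∂∪ q) ⟩
        32 * (# (boundary M W) + # (boundary restricted q))         ≡⟨ ℕP.*-distribˡ-+ 32 (# (boundary M W)) _ ⟩
        32 * # (boundary M W) + 32 * # (boundary restricted q)      ≤⟨ ℕP.+-mono-≤ (proj₁ thin-W) (ℕP.<⇒≤ ∂q<q) ⟩
        # W + # q                                                   ≡⟨ #∪ q ⟨
        # (W ∪ lookup (U q))                                        ∎
      size≤ : 4 * # (W ∪ lookup (U q)) ≤ 3 * N
      size≤ = begin
        4 * # (W ∪ lookup (U q))     ≡⟨ trans (cong (4 *_) (#∪ q)) (ℕP.*-distribˡ-+ 4 (# W) (# q)) ⟩
        4 * # W + 4 * # q            ≡⟨ cong (λ z → 4 * # W + z) (ℕP.*-assoc 2 2 (# q)) ⟩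
        4 * # W + 2 * (2 * # q)      ≤⟨ ℕP.+-mono-≤ small-W (ℕP.*-monoʳ-≤ 2 (ℕP.≤-trans q≤ (ℕP.≤-trans (ℕP.m≤n+m size (# W)) (ℕP.≤-reflexive #W+size)))) ⟩
        N + 2 * N                    ≡⟨⟩
        3 * N                        ∎
      larger : # W < # (W ∪ lookup (U q))
      larger = begin-strict
        # W                    <⟨ ℕP.m<m+n (# W) (ℕP.≤-<-trans z≤n ∂q<q) ⟩
        # W + # q              ≡⟨ #∪ q ⟨
        # (W ∪ lookup (U q))   ∎

  prune : ∃ λ N′ → 3 * N ≤ 4 * N′ × Σ (Monotone d N′) FullExpansion
  prune with maximal N (λ _ → false) ∅-thin (ℕP.m≤m+n N _)
  ... | W , thin , none = R.size , R.large , R.restricted , R.expanding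
    where module R = Rest W thin none

-- The layered graph

-- In a column the neighbours of layer j are layers j − 1 and j + 1, where layer −1 holds p and the last layer is its
-- own successor. Summing over j counts every element of c twice, and ind (a ∨ b) exceeds the average of ind a and
-- ind b whenever a ≢ b; if all these pairs agree then c is constantly p.
column : ∀ k (p : Bool) (c n : Fin (suc k) → Bool) (m : Bool) →
  (T p → T (n zero)) →
  (∀ j → T (c (F.inject₁ j)) → T (n (suc j))) →
  (∀ j → T (c (suc j)) → T (n (F.inject₁ j))) →
  (T (c (F.fromℕ k)) → T (n (F.fromℕ k))) →
  (T m → ¬ (∀ i → c i ≡ p)) →
  ind p + 2 * # c + ind m ≤ 2 * # n + ind (c zero)
column zero p c n m hp _ _ hlast hm =
  subst₂ (λ x y → ind p + 2 * x + ind m ≤ 2 * y + ind (c zero)) (sym (∑-suc 0 (ind ∘ c))) (sym (∑-suc 0 (ind ∘ n)))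
    (check p (c zero) (n zero) m hp hlast λ t e → hm t λ { zero → e })
  where
  check : ∀ p c n m → (T p → T n) → (T c → T n) → (T m → ¬ c ≡ p) → ind p + 2 * (ind c + 0) + ind m ≤ 2 * (ind n + 0) + ind c
  check true  c     false m     hp hc hm = ⊥-elim (hp tt)
  check p     true  false m     hp hc hm = ⊥-elim (hc tt)
  check false false n     true  hp hc hm = ⊥-elim (hm tt refl)
  check true  true  n     true  hp hc hm = ⊥-elim (hm tt refl)
  check false false false false hp hc hm = z≤n
  check false false true  false hp hc hm = z≤n
  check false true  true  false hp hc hm = ℕP.n≤1+n 2
  check false true  true  true  hp hc hm = ℕP.≤-refl
  check true  false true  false hp hc hm = ℕP.n≤1+n 1
  check true  false true  true  hp hc hm = ℕP.≤-refl
  check true  true  true  false hp hc hm = ℕP.≤-refl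
column (suc k) p c n m hp hup hdown hlast hm =
  subst₂ (λ x y → ind p + 2 * x + ind m ≤ 2 * y + ind (c zero)) (sym (∑-suc (suc k) (ind ∘ c))) (sym (∑-suc (suc k) (ind ∘ n)))
    (go (p BoolP.≟ c (suc zero)))
  where
  c′ n′ : Fin (suc k) → Bool
  c′ = c ∘ suc
  n′ = n ∘ suc
  rest : ∀ m′ → (T m′ → ¬ (∀ i → c′ i ≡ c zero)) → ind (c zero) + 2 * # c′ + ind m′ ≤ 2 * # n′ + ind (c′ zero)
  rest m′ = column k (c zero) c′ n′ m′ (hup zero) (hup ∘ suc) (hdown ∘ suc) hlast
  alg₁ : ∀ p a C m x m′ → p + 2 * (a + C) + m + (x + m′) ≡ (p + x + m) + (a + 2 * C + m′) + a
  alg₁ = ℕR.solve-∀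
  alg₂ : ∀ n N a x m′ → 2 * n + m′ + (2 * N + x) + a ≡ 2 * (n + N) + a + (x + m′)
  alg₂ = ℕR.solve-∀
  combine-with : ∀ m′ → (T m′ → ¬ (∀ i → c′ i ≡ c zero)) → ind p + ind (c′ zero) + ind m ≤ 2 * ind (n zero) + ind m′ →
    ind p + 2 * (ind (c zero) + # c′) + ind m ≤ 2 * (ind (n zero) + # n′) + ind (c zero)
  combine-with m′ hm′ local = ℕP.+-cancelʳ-≤ (ind (c′ zero) + ind m′) _ _ (subst₂ _≤_
    (sym (alg₁ (ind p) (ind (c zero)) (# c′) (ind m) (ind (c′ zero)) (ind m′)))
    (alg₂ (ind (n zero)) (# n′) (ind (c zero)) (ind (c′ zero)) (ind m′))
    (ℕP.+-monoˡ-≤ (ind (c zero)) (ℕP.+-mono-≤ local (rest m′ hm′))))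
  agree : ∀ p n m → (T p → T n) → ind p + ind p + ind m ≤ 2 * ind n + ind m
  agree true  true  m _ = ℕP.≤-refl
  agree true  false m h = ⊥-elim (h tt)
  agree false n     m _ = ℕP.m≤n+m (ind m) (2 * ind n)
  differ : ∀ p x n m → ¬ p ≡ x → (T p → T n) → (T x → T n) → ind p + ind x + ind m ≤ 2 * ind n + 0
  differ true  true  n     m p≢x _ _ = ⊥-elim (p≢x refl)
  differ false false n     m p≢x _ _ = ⊥-elim (p≢x refl)
  differ true  false false m _ h _ = ⊥-elim (h tt)
  differ false true  false m _ _ h = ⊥-elim (h tt)
  differ true  false true  true  _ _ _ = ℕP.≤-refl
  differ true  false true  false _ _ _ = ℕP.n≤1+n 1
  differ false true  true  true  _ _ _ = ℕP.≤-refl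
  differ false true  true  false _ _ _ = ℕP.n≤1+n 1
  go : Dec (p ≡ c (suc zero)) → ind p + 2 * (ind (c zero) + # c′) + ind m ≤ 2 * (ind (n zero) + # n′) + ind (c zero)
  -- Unequal values leave a slack of one here, which pays for `m`; otherwise the debt `m` is passed
  -- down the column.
  go (no p≢c₁) = combine-with false (λ ()) (differ p (c′ zero) (n zero) m p≢c₁ hp (hdown zero))
  go (yes p≡c₁) = combine-with m
    (λ t all≡ → hm t λ { zero → trans (sym (all≡ zero)) (sym p≡c₁) ; (suc i) → trans (all≡ i) (trans (sym (all≡ zero)) (sym p≡c₁)) })
    (subst (λ x → ind p + ind x + ind m ≤ 2 * ind (n zero) + ind m) p≡c₁ (agree p (n zero) m hp))

module Layers {d N : ℕ} (M : Monotone d N) where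
  open Monotone M hiding (boundary)

  ℓ n : ℕ
  ℓ = suc (d + 1)
  n = ℓ * N

  -- The identity on the first and the last layer closes each column up to a single cycle of length 2ℓ.
  inner : Fin d ⊎ Fin 1 → Fin N → Fin N → Bool
  inner (inj₁ i) x y = edge i x y
  inner (inj₂ _) x y = does (x F.≟ y)

  stay : Fin ℓ → Fin N → Fin N → Bool
  stay zero    = inner (inj₂ zero)
  stay (suc j) = inner (F.splitAt d j)

  link : Fin ℓ → Fin N → Fin ℓ → Fin N → Bool
  link i x j y = (does (toℕ j ℕ.≟ suc (toℕ i)) ∧ does (x F.≟ y))
               ∨ ((does (toℕ i ℕ.≟ suc (toℕ j)) ∧ does (x F.≟ y))
               ∨ (does (i F.≟ j) ∧ stay i x y))

  adj : BipGraph n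
  adj a b = onPair (λ i x → onPair (λ j y → link i x j y) b) a

  adj-combine : ∀ i x j y → adj (combine i x) (combine j y) ≡ link i x j y
  adj-combine i x j y = trans (onPair-combine (λ i x → onPair (link i x) (combine j y)) i x) (onPair-combine (link i x) j y)

  -- The page depends on the layers alone. Every layer has a single map, so all flat edges fit on
  -- one page whatever d is. Layers farther apart get the last page by default and have no edges.
  kind : Fin ℓ → Fin ℓ → Fin 3
  kind i j with toℕ j ℕ.≟ suc (toℕ i) | toℕ i ℕ.≟ suc (toℕ j)
  ... | yes _ | _     = zero
  ... | no  _ | yes _ = suc zero
  ... | no  _ | no  _ = suc (suc zero)

  colour : Fin n → Fin n → Fin 3
  colour a b = onPair (λ i _ → onPair {n = N} (λ j _ → kind i j) b) a

  colour-combine : ∀ i (x : Fin N) j (y : Fin N) → colour (combine i x) (combine j y) ≡ kind i j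
  colour-combine i x j y = trans (onPair-combine (λ i (_ : Fin N) → onPair {n = N} (λ j _ → kind i j) (combine j y)) i x)
                                 (onPair-combine (λ j (_ : Fin N) → kind i j) j y)

  data Link (i : Fin ℓ) (x : Fin N) (j : Fin ℓ) (y : Fin N) : Fin 3 → Set where
    up   : toℕ j ≡ suc (toℕ i) → x ≡ y → Link i x j y zero
    down : toℕ i ≡ suc (toℕ j) → x ≡ y → Link i x j y (suc zero)
    flat : i ≡ j → T (stay i x y) → Link i x j y (suc (suc zero))

  kind-up : ∀ i j → toℕ j ≡ suc (toℕ i) → kind i j ≡ zero
  kind-up i j e with toℕ j ℕ.≟ suc (toℕ i)
  ... | yes _ = refl
  ... | no ¬e = ⊥-elim (¬e e)

  kind-down : ∀ i j → toℕ i ≡ suc (toℕ j) → kind i j ≡ suc zero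
  kind-down i j e with toℕ j ℕ.≟ suc (toℕ i) | toℕ i ℕ.≟ suc (toℕ j)
  ... | yes e′ | _     = ⊥-elim (ℕP.<-asym (ℕP.≤-reflexive (sym e)) (ℕP.≤-reflexive (sym e′)))
  ... | no  _  | yes _ = refl
  ... | no  _  | no ¬e = ⊥-elim (¬e e)

  kind-flat : ∀ i → kind i i ≡ suc (suc zero)
  kind-flat i with toℕ i ℕ.≟ suc (toℕ i)
  ... | yes e = ⊥-elim (ℕP.1+n≢n (sym e))
  ... | no  _ = refl

  view : ∀ i x j y → T (link i x j y) → Link i x j y (kind i j)
  view i x j y t with T-∨⁻ {does (toℕ j ℕ.≟ suc (toℕ i)) ∧ does (x F.≟ y)} t
  ... | inj₁ u = subst (Link i x j y) (sym (kind-up i j e)) (up e (T-does (x F.≟ y) (T-∧ʳ {does (toℕ j ℕ.≟ suc (toℕ i))} u)))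
    where e = T-does (toℕ j ℕ.≟ suc (toℕ i)) (T-∧ˡ u)
  ... | inj₂ t′ with T-∨⁻ {does (toℕ i ℕ.≟ suc (toℕ j)) ∧ does (x F.≟ y)} t′
  ...   | inj₁ u = subst (Link i x j y) (sym (kind-down i j e)) (down e (T-does (x F.≟ y) (T-∧ʳ {does (toℕ i ℕ.≟ suc (toℕ j))} u)))
    where e = T-does (toℕ i ℕ.≟ suc (toℕ j)) (T-∧ˡ u)
  ...   | inj₂ u with T-does (i F.≟ j) (T-∧ˡ u)
  ...     | refl = subst (Link i x i y) (sym (kind-flat i)) (flat refl (T-∧ʳ {does (i F.≟ i)} u))

  link-up : ∀ i j y → toℕ j ≡ suc (toℕ i) → T (link i y j y)
  link-up i j y e = T-∨ˡ (T-pair (T-does⁺ (toℕ j ℕ.≟ suc (toℕ i)) e) (T-does⁺ (y F.≟ y) refl))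

  link-down : ∀ i j y → toℕ i ≡ suc (toℕ j) → T (link i y j y)
  link-down i j y e = T-∨ʳ {does (toℕ j ℕ.≟ suc (toℕ i)) ∧ does (y F.≟ y)}
    (T-∨ˡ (T-pair (T-does⁺ (toℕ i ℕ.≟ suc (toℕ j)) e) (T-does⁺ (y F.≟ y) refl)))

  link-flat : ∀ i x y → T (stay i x y) → T (link i x i y)
  link-flat i x y t = T-∨ʳ {does (toℕ i ℕ.≟ suc (toℕ i)) ∧ does (x F.≟ y)}
    (T-∨ʳ {does (toℕ i ℕ.≟ suc (toℕ i)) ∧ does (x F.≟ y)} (T-pair (T-does⁺ (i F.≟ i) refl) t))

  private
    inner-functional : ∀ s {x y y′} → T (inner s x y) → T (inner s x y′) → y ≡ y′
    inner-functional (inj₁ i)             t t′ = functional i t t′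
    inner-functional (inj₂ _) {x} {y} {y′} t t′ = trans (sym (T-does (x F.≟ y) t)) (T-does (x F.≟ y′) t′)

    inner-increasing : ∀ s {x x′ y y′} → T (inner s x y) → T (inner s x′ y′) → x F.< x′ → y F.< y′
    inner-increasing (inj₁ i)                  t t′ lt = increasing i t t′ lt
    inner-increasing (inj₂ _) {x} {x′} {y} {y′} t t′ lt with refl ← T-does (x F.≟ y) t | refl ← T-does (x′ F.≟ y′) t′ = lt

    stay-functional : ∀ i {x y y′} → T (stay i x y) → T (stay i x y′) → y ≡ y′
    stay-functional zero {x} = inner-functional (inj₂ zero) {x}
    stay-functional (suc j) = inner-functional (F.splitAt d j)

    stay-increasing : ∀ i {x x′ y y′} → T (stay i x y) → T (stay i x′ y′) → x F.< x′ → y F.< y′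
    stay-increasing zero {x} {x′} = inner-increasing (inj₂ zero) {x} {x′}
    stay-increasing (suc j) = inner-increasing (F.splitAt d j)

  Lex : Fin ℓ → Fin N → Fin ℓ → Fin N → Set
  Lex i x i′ x′ = toℕ i < toℕ i′ ⊎ (toℕ i ≡ toℕ i′ × toℕ x < toℕ x′)

  position : ∀ i (x : Fin N) → toℕ (combine {ℓ} i x) ≡ toℕ x + N * toℕ i
  position i x = trans (FP.toℕ-combine i x) (ℕP.+-comm (N * toℕ i) (toℕ x))

  lex⁻ : ∀ i x i′ x′ → combine i x F.< combine i′ x′ → Lex i x i′ x′
  lex⁻ i x i′ x′ lt = lex-elim N (FP.toℕ<n x′) (subst₂ _<_ (position i x) (position i′ x′) lt)

  lex⁺ : ∀ i x i′ x′ → Lex i x i′ x′ → combine i x F.< combine i′ x′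
  lex⁺ i x i′ x′ l = subst₂ _<_ (sym (position i x)) (sym (position i′ x′)) (go l)
    where
    go : Lex i x i′ x′ → toℕ x + N * toℕ i < toℕ x′ + N * toℕ i′
    go (inj₁ lt)       = lex-< N (FP.toℕ<n x) lt
    go (inj₂ (e , lt)) = subst (λ z → toℕ x + N * z < toℕ x′ + N * toℕ i′) (sym e) (ℕP.+-monoˡ-< (N * toℕ i′) lt)

  -- Up and down change every layer by the same amount and keep the column; flat keeps the layer and
  -- applies its one increasing map. Lexicographic order survives in each case.
  link-increasing : ∀ {k i x j y i′ x′ j′ y′} → Link i x j y k → Link i′ x′ j′ y′ k → Lex i x i′ x′ → Lex j y j′ y′
  link-increasing (up e refl) (up e′ refl) (inj₁ lt) = inj₁ (subst₂ _<_ (sym e) (sym e′) (s≤s lt))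
  link-increasing (up e refl) (up e′ refl) (inj₂ (≡i , lt)) = inj₂ (trans e (trans (cong suc ≡i) (sym e′)) , lt)
  link-increasing (down e refl) (down e′ refl) (inj₁ lt) = inj₁ (ℕP.≤-pred (subst₂ _<_ e e′ lt))
  link-increasing (down e refl) (down e′ refl) (inj₂ (≡i , lt)) = inj₂ (ℕP.suc-injective (trans (sym e) (trans ≡i e′)) , lt)
  link-increasing (flat refl s) (flat refl s′) (inj₁ lt) = inj₁ lt
  link-increasing {i = i} {x = x} {y = y} {x′ = x′} {y′ = y′} (flat refl s) (flat refl s′) (inj₂ (≡i , lt)) with FP.toℕ-injective ≡i
  ... | refl = inj₂ (refl , stay-increasing i s s′ lt)

  link-functional : ∀ {k i x j y j′ y′} → Link i x j y k → Link i x j′ y′ k → j ≡ j′ × y ≡ y′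
  link-functional (up e refl)   (up e′ refl)   = FP.toℕ-injective (trans e (sym e′)) , refl
  link-functional (down e refl) (down e′ refl) = FP.toℕ-injective (ℕP.suc-injective (trans (sym e) e′)) , refl
  link-functional {i = i} (flat refl s) (flat refl s′) = refl , stay-functional i s s′

  adj-link : ∀ i x j y → T (adj (combine i x) (combine j y)) → Link i x j y (colour (combine i x) (combine j y))
  adj-link i x j y t = subst (Link i x j y) (sym (colour-combine i x j y)) (view i x j y (subst T (adj-combine i x j y) t))

  adj-increasing : ∀ a b a′ b′ → T (adj a b) → T (adj a′ b′) → colour a b ≡ colour a′ b′ → a F.< a′ → b F.< b′
  adj-increasing a b a′ b′ t t′ e lt
    with i , x , refl ← FP.combine-surjective {ℓ} {N} a | j , y , refl ← FP.combine-surjective {ℓ} {N} b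
    with i′ , x′ , refl ← FP.combine-surjective {ℓ} {N} a′ | j′ , y′ , refl ← FP.combine-surjective {ℓ} {N} b′ =
    lex⁺ j y j′ y′ (link-increasing (adj-link i x j y t) (subst (Link i′ x′ j′ y′) (sym e) (adj-link i′ x′ j′ y′ t′)) (lex⁻ i x i′ x′ lt))

  adj-functional : ∀ a b b′ → T (adj a b) → T (adj a b′) → colour a b ≡ colour a b′ → b ≡ b′
  adj-functional a b b′ t t′ e
    with i , x , refl ← FP.combine-surjective {ℓ} {N} a
    with j , y , refl ← FP.combine-surjective {ℓ} {N} b | j′ , y′ , refl ← FP.combine-surjective {ℓ} {N} b′ =
    uncurry (cong₂ combine) (link-functional (adj-link i x j y t) (subst (Link i x j′ y′) (sym e) (adj-link i x j′ y′ t′)))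

-- The book embedding

-- A is listed in increasing and B in decreasing order, so that an increasing map from A to B is a nested matching.
spine : ∀ {n} → V n → Fin (n + n)
spine {n} (inj₁ a) = a F.↑ˡ n
spine {n} (inj₂ b) = n F.↑ʳ F.opposite b

spine-A : ∀ {n} (a : Fin n) → toℕ (spine (inj₁ a)) < n
spine-A {n} a = subst (_< n) (sym (FP.toℕ-↑ˡ a n)) (FP.toℕ<n a)

spine-B : ∀ {n} (b : Fin n) → n ≤ toℕ (spine (inj₂ b))
spine-B {n} b = subst (n ≤_) (sym (FP.toℕ-↑ʳ n (F.opposite b))) (ℕP.m≤m+n n _)

spine-A< : ∀ {n} (a a′ : Fin n) → toℕ (spine (inj₁ a)) < toℕ (spine (inj₁ a′)) → a F.< a′
spine-A< {n} a a′ = subst₂ _<_ (FP.toℕ-↑ˡ a n) (FP.toℕ-↑ˡ a′ n)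

spine-B< : ∀ {n} (b b′ : Fin n) → toℕ (spine (inj₂ b)) < toℕ (spine (inj₂ b′)) → b′ F.< b
spine-B< {n} b b′ lt with b′ F.<? b
... | yes b′<b = b′<b
... | no  b′≮b = ⊥-elim (ℕP.<⇒≱ (ℕP.+-cancelˡ-< n _ _ (subst₂ _<_ (FP.toℕ-↑ʳ n (F.opposite b)) (FP.toℕ-↑ʳ n (F.opposite b′)) lt))
    (subst₂ _≤_ (sym (FP.opposite-prop b′)) (sym (FP.opposite-prop b)) (ℕP.∸-monoʳ-≤ n (s≤s (ℕP.≮⇒≥ b′≮b)))))

spine-bijection : ∀ n → V n ⤖ Fin (n + n)
spine-bijection n = mk⤖ (injective , surjective)
  where
  injective : ∀ {v w : V n} → spine v ≡ spine w → v ≡ w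
  injective {inj₁ a} {inj₁ a′} e = cong inj₁ (FP.↑ˡ-injective n a a′ e)
  injective {inj₁ a} {inj₂ b}  e = ⊥-elim (ℕP.<⇒≱ (subst (λ z → toℕ z < n) e (spine-A a)) (spine-B b))
  injective {inj₂ b} {inj₁ a}  e = ⊥-elim (ℕP.<⇒≱ (subst (λ z → toℕ z < n) (sym e) (spine-A a)) (spine-B b))
  injective {inj₂ b} {inj₂ b′} e = cong inj₂ (trans (sym (FP.opposite-involutive b))
    (trans (cong F.opposite (FP.↑ʳ-injective n (F.opposite b) (F.opposite b′) e)) (FP.opposite-involutive b′)))
  surjective : ∀ y → ∃ λ v → ∀ {w : V n} → w ≡ v → spine w ≡ y
  surjective y with F.splitAt n y in eq
  ... | inj₁ a = inj₁ a , λ { refl → FP.splitAt⁻¹-↑ˡ eq }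
  ... | inj₂ c = inj₂ (F.opposite c) , λ { refl → trans (cong (n F.↑ʳ_) (FP.opposite-involutive c)) (FP.splitAt⁻¹-↑ʳ eq) }

module Book {d N : ℕ} (M : Monotone d N) where
  open Layers M

  book : PushdownBookEmbedding 3 adj
  book = record
    { order = spine-bijection n
    ; page = λ a b _ → colour a b
    ; noCrossing = λ a b a′ b′ e e′ same → λ
        -- Only this orientation is compatible with all of A preceding all of B; it would reverse
        -- the order of a page's map.
        { (inj₁ (a<a′ , _ , b<b′)) → ℕP.<-asym (adj-increasing a b a′ b′ e e′ same (spine-A< a a′ a<a′)) (spine-B< b b′ b<b′)
        ; (inj₂ (inj₁ (b<a′ , _ , _))) → B≮A b a′ b<a′
        ; (inj₂ (inj₂ (inj₁ (_ , _ , b<a′)))) → B≮A b a′ b<a′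
        ; (inj₂ (inj₂ (inj₂ (_ , b′<a , _)))) → B≮A b′ a b′<a }
    ; matching = λ
        { a b .a b′ e e′ same (inj₁ refl) → refl , adj-functional a b b′ e e′ same
        ; a b a′ .b e e′ same (inj₂ refl) → co-functional a b a′ e e′ same , refl }
    }
    where
    B≮A : ∀ b a → ¬ toℕ (spine {n} (inj₂ b)) < toℕ (spine {n} (inj₁ a))
    B≮A b a lt = ℕP.<⇒≱ (ℕP.<-trans lt (spine-A a)) (spine-B b)
    co-functional : ∀ a b a′ → T (adj a b) → T (adj a′ b) → colour a b ≡ colour a′ b → a ≡ a′
    co-functional a b a′ e e′ same with FP.<-cmp a a′
    ... | tri< lt _ _ = ⊥-elim (ℕP.<-irrefl refl (adj-increasing a b a′ b e e′ same lt))
    ... | tri≈ _ eq _ = eq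
    ... | tri> _ _ gt = ⊥-elim (ℕP.<-irrefl refl (adj-increasing a′ b a b e′ e (sym same) gt))

-- Vertex expansion of the layered graph

∣∣≡# : ∀ {n} (S : Subset n) → ∣ S ∣ ≡ # (lookup S)
∣∣≡# []          = refl
∣∣≡# {suc n} (true ∷ S)  = trans (cong suc (∣∣≡# S)) (sym (∑-suc n (ind ∘ lookup (true ∷ S))))
∣∣≡# {suc n} (false ∷ S) = trans (∣∣≡# S) (sym (∑-suc n (ind ∘ lookup (false ∷ S))))

N⁺ : ∀ {n} (adj : BipGraph n) S a b → T (lookup S a) → T (adj a b) → T (lookup (N adj S) b)
N⁺ adj S a b a∈ e = subst T (sym (VP.lookup∘tabulate _ b))
  (lemma (FP.any? λ a → (a ∈? S) ×-dec T? (adj a b)) (a , VP.lookup⇒[]= a S (Equivalence.to T-≡ a∈) , e))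
  where
  lemma : ∀ {X : Set} (d : Dec X) → X → T (if ⌊ d ⌋ then inside else outside)
  lemma (yes _) _ = tt
  lemma (no ¬x) x = ⊥-elim (¬x x)

module Expander {d N′ : ℕ} (M : Monotone d N′) (expanding : FullExpansion M) where
  open Layers M

  first-flat : ∀ y → T (stay zero y y)
  first-flat y = T-does⁺ (y F.≟ y) refl

  last-flat : ∀ y → T (stay (F.fromℕ (d + 1)) y y)
  last-flat y = subst (λ j → T (stay j y y)) last≡ (subst (λ s → T (inner s y y)) (sym (FP.splitAt-↑ʳ d 1 zero)) (T-does⁺ (y F.≟ y) refl))
    where
    last≡ : suc (d F.↑ʳ zero {0}) ≡ F.fromℕ (d + 1)
    last≡ = FP.toℕ-injective (trans (cong suc (FP.toℕ-↑ʳ d (zero {0}))) (trans (sym (ℕP.+-suc d 0)) (sym (FP.toℕ-fromℕ (d + 1)))))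

  module _ (S : Subset n) where
    private
      inS inN : Fin ℓ → Fin N′ → Bool
      inS i y = lookup S (combine i y)
      inN j y = lookup (N adj S) (combine j y)

      step : ∀ i x j y → T (link i x j y) → T (inS i x) → T (inN j y)
      step i x j y e t = N⁺ adj S (combine i x) (combine j y) t (subst T (sym (adj-combine i x j y)) e)

      full? : ∀ y → Dec (∀ i → T (inS i y))
      full? y = FP.all? λ i → T? (inS i y)

      some? : ∀ y → Dec (∃ λ i → T (inS i y))
      some? y = FP.any? λ i → T? (inS i y)

      -- The columns that win a vertex: mixed ones through their own cycle, boundary columns of the
      -- full ones through the increasing maps.
      full mixed gain : Fin N′ → Bool
      full y  = does (full? y)
      mixed y = does (some? y) ∧ not (full y)
      gain y  = mixed y ∨ boundary M full y

      count countN : Fin N′ → ℕ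
      count y  = # (λ i → inS i y)
      countN y = # (λ j → inN j y)

      #-pos : ∀ {k} (p : Fin k → Bool) x → T (p x) → 1 ≤ # p
      #-pos {k} p x t = begin
        1                                               ≡⟨ ∑-pick x (λ _ → 1) ⟨
        ∑ (allFin k) (λ y → ind (does (y F.≟ x)) * 1)   ≤⟨ ∑-mono (allFin k) (λ y → ℕP.≤-trans (ℕP.≤-reflexive (ℕP.*-identityʳ _))
                                                             (ind-mono λ e → subst (T ∘ p) (sym (T-does (y F.≟ x) e)) t)) ⟩
        # p                                             ∎
        where open ℕP.≤-Reasoning

      -- The first flat edge puts a copy of layer 0 before the column, so `column` applies with p =
      -- c 0 and the two extra terms cancel.
      twice : ∀ y m → (T m → ¬ (∀ i → inS i y ≡ inS zero y)) → 2 * count y + ind m ≤ 2 * countN y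
      twice y m hm = ℕP.+-cancelʳ-≤ (ind (inS zero y)) _ _ (ℕP.≤-trans (ℕP.≤-reflexive (alg (2 * count y) (ind m) (ind (inS zero y))))
        (column (d + 1) (inS zero y) (λ i → inS i y) (λ j → inN j y) m
          (step zero y zero y (link-flat zero y y (first-flat y)))
          (λ j → step (F.inject₁ j) y (suc j) y (link-up (F.inject₁ j) (suc j) y (cong suc (sym (FP.toℕ-inject₁ j)))))
          (λ j → step (suc j) y (F.inject₁ j) y (link-down (suc j) (F.inject₁ j) y (cong suc (sym (FP.toℕ-inject₁ j)))))
          (step (F.fromℕ (d + 1)) y (F.fromℕ (d + 1)) y (link-flat (F.fromℕ (d + 1)) y y (last-flat y)))
          hm))
        where
        alg : ∀ a m z → a + m + z ≡ z + a + m
        alg = ℕR.solve-∀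

      -- Parity: an excess of one between even numbers is an excess of two.
      halve : ∀ a b m → 2 * a + ind m ≤ 2 * b → a + ind m ≤ b
      halve a b false h = ℕP.≤-trans (ℕP.≤-reflexive (ℕP.+-identityʳ a))
        (ℕP.*-cancelˡ-≤ 2 (ℕP.≤-trans (ℕP.≤-reflexive (sym (ℕP.+-identityʳ (2 * a)))) h))
      halve a b true  h = ℕP.≤-trans (ℕP.≤-reflexive (ℕP.+-comm a 1))
        (ℕP.*-cancelˡ-< 2 a b (ℕP.≤-trans (ℕP.≤-reflexive (ℕP.+-comm 1 (2 * a))) h))

      -- If the column meets S but is not full, its cycle gives the extra vertex. If it misses S and
      -- is a boundary column, the layer of the map that hits it supplies one neighbour.
      column-gain : ∀ y → count y + ind (gain y) ≤ countN y
      column-gain y = go (gain y) refl (some? y)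
        where
        not-full : T (gain y) → ¬ (∀ i → T (inS i y))
        not-full t all with T-∨⁻ {mixed y} t
        ... | inj₁ mx = T-not⁻ (T-∧ʳ {does (some? y)} mx) (T-does⁺ (full? y) all)
        ... | inj₂ ∂  = proj₁ (boundary⁻ M full ∂) (T-does⁺ (full? y) all)
        go : ∀ g → gain y ≡ g → Dec (∃ λ i → T (inS i y)) → count y + ind g ≤ countN y
        go false _ _ = halve (count y) (countN y) false (twice y false λ ())
        go true e (yes (i , t)) = halve (count y) (countN y) true (twice y true λ _ const →
          not-full (subst T (sym e) tt) λ j → subst T (trans (const i) (sym (const j))) t)
        go true e (no none) with T-∨⁻ {mixed y} (subst T (sym e) tt)
        ... | inj₁ mx = ⊥-elim (none (T-does (some? y) (T-∧ˡ mx)))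
        ... | inj₂ ∂ with boundary⁻ M full ∂
        ...   | _ , i , x , fx , exy = ℕP.≤-trans (ℕP.≤-reflexive (cong (_+ 1) count≡0))
                  (#-pos (λ j → inN j y) (suc (i F.↑ˡ 1)) (step (suc (i F.↑ˡ 1)) x (suc (i F.↑ˡ 1)) y
                    (link-flat (suc (i F.↑ˡ 1)) x y (subst (λ s → T (inner s x y)) (sym (FP.splitAt-↑ˡ d i 1)) exy))
                    (T-does (full? x) fx (suc (i F.↑ˡ 1)))))
          where
          count≡0 : count y ≡ 0
          count≡0 = ℕP.n≤0⇒n≡0 (ℕP.≤-trans (#-mono {p = λ i → inS i y} {q = λ _ → false} λ i t → none (i , t))
            (ℕP.≤-reflexive (∑-0 (allFin ℓ))))

      count≤ : ∀ y → count y ≤ ℓ * (ind (full y) + ind (mixed y))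
      count≤ y = go (some? y)
        where
        one : ∀ s b → T s → 1 ≤ ind b + ind (s ∧ not b)
        one true true  _ = ℕP.≤-refl
        one true false _ = ℕP.≤-refl
        go : Dec (∃ λ i → T (inS i y)) → count y ≤ ℓ * (ind (full y) + ind (mixed y))
        go (no none) = ℕP.≤-trans (ℕP.≤-trans (#-mono {p = λ i → inS i y} {q = λ _ → false} λ i t → none (i , t))
          (ℕP.≤-reflexive (∑-0 (allFin ℓ)))) z≤n
        go (yes some) = ℕP.≤-trans (#≤n (λ i → inS i y)) (ℕP.≤-trans (ℕP.≤-reflexive (sym (ℕP.*-identityʳ ℓ)))
          (ℕP.*-monoʳ-≤ ℓ (one (does (some? y)) (full y) (T-does⁺ (some? y) some))))

      full-count : ∀ y → ℓ * ind (full y) ≤ count y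
      full-count y = go (full y) refl
        where
        go : ∀ b → full y ≡ b → ℓ * ind b ≤ count y
        go false _ = ℕP.≤-trans (ℕP.≤-reflexive (ℕP.*-zeroʳ ℓ)) z≤n
        go true  e = ℕP.≤-trans (ℕP.≤-reflexive (trans (ℕP.*-identityʳ ℓ) (sym (#-full ℓ))))
          (#-mono {p = λ _ → true} {q = λ i → inS i y} λ i _ → T-does (full? y) (subst T (sym e) tt) i)

      transpose : ∀ (R : Subset n) → ∣ R ∣ ≡ ∑ (allFin N′) (λ y → # (λ (i : Fin ℓ) → lookup R (combine i y)))
      transpose R = trans (∣∣≡# R) (trans (∑-combine ℓ N′ (ind ∘ lookup R)) (∑-swap (allFin ℓ) (allFin N′) _))

      total : ∣ S ∣ + # gain ≤ ∣ N adj S ∣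
      total = begin
        ∣ S ∣ + # gain                                   ≡⟨ trans (cong (_+ # gain) (transpose S)) (sym (∑-⊕ (allFin N′) count (ind ∘ gain))) ⟩
        ∑ (allFin N′) (λ y → count y + ind (gain y))     ≤⟨ ∑-mono (allFin N′) column-gain ⟩
        ∑ (allFin N′) countN                             ≡⟨ transpose (N adj S) ⟨
        ∣ N adj S ∣                                      ∎
        where open ℕP.≤-Reasoning

      size≤ : ∣ S ∣ ≤ ℓ * (# full + # mixed)
      size≤ = begin
        ∣ S ∣                                                         ≡⟨ transpose S ⟩
        ∑ (allFin N′) count                                           ≤⟨ ∑-mono (allFin N′) count≤ ⟩
        ∑ (allFin N′) (λ y → ℓ * (ind (full y) + ind (mixed y)))      ≡⟨ trans (∑-⊗ (allFin N′) ℓ _) (cong (ℓ *_) (∑-⊕ (allFin N′) (ind ∘ full) (ind ∘ mixed))) ⟩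
        ℓ * (# full + # mixed)                                        ∎
        where open ℕP.≤-Reasoning

      full≤ : 2 * ∣ S ∣ ≤ n → 2 * # full ≤ N′
      full≤ 2S≤n = ℕP.*-cancelˡ-≤ ℓ (begin
        ℓ * (2 * # full)      ≡⟨ alg ℓ (# full) ⟩
        2 * (ℓ * # full)      ≡⟨ cong (2 *_) (∑-⊗ (allFin N′) ℓ (ind ∘ full)) ⟨
        2 * ∑ (allFin N′) (λ y → ℓ * ind (full y)) ≤⟨ ℕP.*-monoʳ-≤ 2 (∑-mono (allFin N′) full-count) ⟩
        2 * ∑ (allFin N′) count ≡⟨ cong (2 *_) (transpose S) ⟨
        2 * ∣ S ∣             ≤⟨ 2S≤n ⟩
        ℓ * N′                ∎)
        where
        open ℕP.≤-Reasoning
        alg : ∀ l f → l * (2 * f) ≡ 2 * (l * f)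
        alg = ℕR.solve-∀

    -- S lies in the full and the mixed columns. Full ones number at most 32 times their boundary,
    -- so ∣ S ∣ ≤ 33 ℓ # gain, while the neighbourhood exceeds S by # gain.
    expansion : 2 * ∣ S ∣ ≤ n → (ℓ + 32 * ℓ) * ∣ S ∣ + ∣ S ∣ ≤ (ℓ + 32 * ℓ) * ∣ N adj S ∣
    expansion 2S≤n = begin
      (ℓ + 32 * ℓ) * ∣ S ∣ + ∣ S ∣
        ≤⟨ ℕP.+-monoʳ-≤ ((ℓ + 32 * ℓ) * ∣ S ∣) (ℕP.≤-trans size≤ (ℕP.*-monoʳ-≤ ℓ (ℕP.+-mono-≤
             (ℕP.≤-trans (expanding full (full≤ 2S≤n)) (ℕP.*-monoʳ-≤ 32 (#-mono {p = boundary M full} {q = gain} λ y t → T-∨ʳ {mixed y} t)))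
             (#-mono {p = mixed} {q = gain} λ y t → T-∨ˡ t)))) ⟩
      (ℓ + 32 * ℓ) * ∣ S ∣ + ℓ * (32 * # gain + # gain)
        ≡⟨ alg ℓ ∣ S ∣ (# gain) ⟩
      (ℓ + 32 * ℓ) * (∣ S ∣ + # gain)
        ≤⟨ ℕP.*-monoʳ-≤ (ℓ + 32 * ℓ) total ⟩
      (ℓ + 32 * ℓ) * ∣ N adj S ∣ ∎
      where
      open ℕP.≤-Reasoning
      alg : ∀ l s g → (l + 32 * l) * s + l * (32 * g + g) ≡ (l + 32 * l) * (s + g)
      alg = ℕR.solve-∀

-- The rational constant and the family of graphs

unit-fraction : ℕ → ℚ.ℚ
unit-fraction k = + 1 ℚ./ suc k

private
  toℚᵘ-/ : ∀ i k → ℚ.toℚᵘ (i ℚ./ suc k) ℚᵘ.≃ ℚᵘ.mkℚᵘ i k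
  toℚᵘ-/ i k = ℚP.toℚᵘ-fromℚᵘ (ℚᵘ.mkℚᵘ i k)

unit-fraction-pos : ∀ k → ℚ.0ℚ ℚ.< unit-fraction k
unit-fraction-pos k = ℚP.toℚᵘ-cancel-< (ℚᵘP.<-respʳ-≃ (ℚᵘP.≃-sym (toℚᵘ-/ (+ 1) k)) (ℚᵘ.*<* (+<+ (s≤s z≤n))))

unit-fraction≤1 : ∀ k → unit-fraction k ℚ.≤ ℚ.1ℚ
unit-fraction≤1 k = ℚP.toℚᵘ-cancel-≤ (ℚᵘP.≤-respˡ-≃ (ℚᵘP.≃-sym (toℚᵘ-/ (+ 1) k)) (ℚᵘ.*≤* (+≤+ (s≤s z≤n))))

rational-bound : ∀ k s t → suc k * s + s ≤ suc k * t → (ℚ.1ℚ ℚ.+ unit-fraction k) ℚ.* ℕ→ℚ s ℚ.≤ ℕ→ℚ t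
rational-bound k s t h = ℚP.toℚᵘ-cancel-≤ (begin
  ℚ.toℚᵘ ((ℚ.1ℚ ℚ.+ unit-fraction k) ℚ.* ℕ→ℚ s)
    ≃⟨ ℚP.toℚᵘ-homo-* (ℚ.1ℚ ℚ.+ unit-fraction k) (ℕ→ℚ s) ⟩
  ℚ.toℚᵘ (ℚ.1ℚ ℚ.+ unit-fraction k) ℚᵘ.* ℚ.toℚᵘ (ℕ→ℚ s)
    ≃⟨ ℚᵘP.*-cong (ℚᵘP.≃-trans (ℚP.toℚᵘ-homo-+ ℚ.1ℚ (unit-fraction k)) (ℚᵘP.+-congʳ ℚᵘ.1ℚᵘ (toℚᵘ-/ (+ 1) k))) (toℚᵘ-/ (+ s) 0) ⟩
  (ℚᵘ.1ℚᵘ ℚᵘ.+ ℚᵘ.mkℚᵘ (+ 1) k) ℚᵘ.* ℚᵘ.mkℚᵘ (+ s) 0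
    ≤⟨ ℚᵘ.*≤* (subst₂ ℤ._≤_ (lhs (+ suc k) (+ s)) rhs (subst₂ ℤ._≤_
         (trans (ℤP.pos-+ (suc k * s) s) (cong (ℤ._+ + s) (ℤP.pos-* (suc k) s))) (ℤP.pos-* (suc k) t) (+≤+ h))) ⟩
  ℚᵘ.mkℚᵘ (+ t) 0
    ≃⟨ toℚᵘ-/ (+ t) 0 ⟨
  ℚ.toℚᵘ (ℕ→ℚ t) ∎)
  where
  open ℚᵘP.≤-Reasoning
  lhs : ∀ k s → k ℤ.* s ℤ.+ s ≡ (+ 1 ℤ.* k ℤ.+ + 1 ℤ.* + 1) ℤ.* s ℤ.* + 1
  lhs = ℤR.solve-∀
  rhs : + suc k ℤ.* + t ≡ + t ℤ.* + (1 * suc k * 1)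
  rhs = trans (ℤP.*-comm (+ suc k) (+ t)) (cong (λ z → + t ℤ.* + z) (sym (trans (ℕP.*-identityʳ (1 * suc k)) (ℕP.*-identityˡ (suc k)))))

-- The constant ε depends on D alone, which is why the number of maps must stay fixed while the
-- circles grow.
pushdown-expanders : ∀ D .{{_ : NonZero D}} → (∀ t → Σ ℕ λ N → t < N × Tower D N 6) →
    Σ ℚ.ℚ λ ε → (ℚ.0ℚ ℚ.< ε) × (ε ℚ.≤ ℚ.1ℚ) ×
    ((m : ℕ) → Σ ℕ λ n → (m ≤ n) × Σ (BipGraph n) λ G →
    IsBipExpander ε G × PushdownBookEmbedding 3 G)
pushdown-expanders D towers-D = unit-fraction k , unit-fraction-pos k , unit-fraction≤1 k , family
  where
  d ℓ k : ℕ
  d = D * 3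
  ℓ = suc (d + 1)
  -- `suc k` is ℓ + 32 * ℓ by computation, so ε = 1 / (33 ℓ).
  k = (d + 1) + 32 * ℓ

  family : (m : ℕ) → Σ ℕ λ n → (m ≤ n) × Σ (BipGraph n) λ G → IsBipExpander (unit-fraction k) G × PushdownBookEmbedding 3 G
  family m = build (towers-D (2 * m))
    where
    build : (Σ ℕ λ N → 2 * m < N × Tower D N 6) →
            Σ ℕ λ n → (m ≤ n) × Σ (BipGraph n) λ G → IsBipExpander (unit-fraction k) G × PushdownBookEmbedding 3 G
    build (N₀ , 2m<N₀ , tower) = layered (Prune.prune (Pieces.pieces tower) (λ p → Pieces.Expansion.expansion tower p refl))
      where
      instance
        N₀≢0 : NonZero N₀
        N₀≢0 = ℕ.>-nonZero (ℕP.≤-trans (s≤s z≤n) 2m<N₀)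
      layered : (∃ λ N′ → 3 * N₀ ≤ 4 * N′ × Σ (Monotone d N′) FullExpansion) →
                Σ ℕ λ n → (m ≤ n) × Σ (BipGraph n) λ G → IsBipExpander (unit-fraction k) G × PushdownBookEmbedding 3 G
      layered (N′ , 3N₀≤4N′ , M , expanding) = Layers.n M , ℕP.≤-trans m≤N′ (ℕP.m≤m+n N′ _) , Layers.adj M
        , (λ S 2S≤n → rational-bound k ∣ S ∣ ∣ N (Layers.adj M) S ∣ (Expander.expansion M expanding S 2S≤n))
        , Book.book M
        where
        open ℕP.≤-Reasoning
        m≤N′ : m ≤ N′
        m≤N′ = ℕP.*-cancelˡ-≤ 4 (begin
          4 * m              ≡⟨ ℕP.*-assoc 2 2 m ⟩
          2 * (2 * m)        ≤⟨ ℕP.*-monoʳ-≤ 2 (ℕP.<⇒≤ 2m<N₀) ⟩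
          2 * N₀             ≤⟨ ℕP.*-monoˡ-≤ N₀ (ℕP.n≤1+n 2) ⟩
          3 * N₀             ≤⟨ 3N₀≤4N′ ⟩
          4 * N′             ∎)

theorem3 : Σ ℚ.ℚ λ ε → (ℚ.0ℚ ℚ.< ε) × (ε ℚ.≤ ℚ.1ℚ) ×
    ((m : ℕ) → Σ ℕ λ n → (m ≤ n) × Σ (BipGraph n) λ G →
    IsBipExpander ε G × PushdownBookEmbedding 3 G)
theorem3 = pushdown-expanders (degree 0) {{degree≢0 0}} (λ t → towers t 0)
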